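{- Let $A,B\in\mathbb{Z}$ with $B\neq 0$, and let $n,m$ be positive integers satisfying $1\le m<n$ and $n>2$. Assume that $\gcd(n,mB)=1$. Let $f(X)=X^n+A(BX+1)^m$ be irreducible over $\mathbb{Q}$, and let $D=n^n+(-1)^{n+m}B^n(n-m)^{n-m}m^mA$. Then $f$ is monogenic if and only if both $A$ and $D$ are square-free.
   Context: A monic irreducible polynomial $f\in\mathbb{Z}[X]$ with root $\theta$ is called monogenic if $\mathbb{Z}[\theta]=\mathcal{O}_K$, where $\mathcal{O}_K$ is the ring of integers of $K=\mathbb{Q}(\theta)$. An integer is square-free if it is not divisible by $p^2$ for any prime $p$ (so $\pm1$ are square-free and $0$ is not). -}

module Defs where

open import Algebra.Bundles using (CommutativeRing; Semiring)
import Algebra.Definitions.RawMagma as RawMagmaDefs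
import Algebra.Definitions.RawSemiring as RawSemiringDefs
import Algebra.Properties.AbelianGroup as AbelianGroupProperties
import Algebra.Properties.CommutativeSemigroup as CommutativeSemigroupProperties
import Algebra.Properties.Ring as RingProperties
open import Data.Integer.Base as ℤ using (ℤ; +_; -1ℤ)
open import Data.Integer.Divisibility using () renaming (_∣_ to _∣ℤ_)
import Data.Integer.Properties as ℤ
open import Data.List.Base using (List; []; _∷_; map; foldr)
open import Data.Nat.Base as ℕ using (ℕ; zero; suc)
open import Data.Nat.Primality using (Prime)
open import Data.Product.Base using (∃-syntax; _×_; _,_)
open import Data.Rational.Base using (ℚ; _/_)
import Data.Rational.Properties as ℚ
open import Function.Bundles using (_⇔_)
open import Level using (Level; 0ℓ; _⊔_)
import Relation.Binary.Reasoning.Setoid as SetoidReasoning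
open import Relation.Nullary.Negation.Core using (¬_)

-- R[X].  A polynomial is its list of coefficients, constant term first;
-- trailing zeros are allowed, so equality compares coefficients.

module Polynomial {c ℓ : Level} (R : CommutativeRing c ℓ) where

  open CommutativeRing R
  open RingProperties ring using (-0#≈0#)
  open CommutativeSemigroupProperties +-commutativeSemigroup using (interchange)
  open CommutativeSemigroupProperties *-commutativeSemigroup using (x∙yz≈y∙xz)

  Poly : Set c
  Poly = List Carrier

  coeff : Poly → ℕ → Carrier
  coeff []      _       = 0#
  coeff (a ∷ _) zero    = a
  coeff (_ ∷ p) (suc k) = coeff p k

  infix 4 _≋_
  record _≋_ (p q : Poly) : Set ℓ where
    constructor mk≋
    field at : ∀ k → coeff p k ≈ coeff q k
  open _≋_ public

  infixl 6 _⊕_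
  _⊕_ : Poly → Poly → Poly
  []      ⊕ q       = q
  (a ∷ p) ⊕ []      = a ∷ p
  (a ∷ p) ⊕ (b ∷ q) = a + b ∷ p ⊕ q

  ⊖_ : Poly → Poly
  ⊖_ = map (-_)

  infixr 7 _·_
  _·_ : Carrier → Poly → Poly
  a · p = map (a *_) p

  infixl 7 _⊗_
  _⊗_ : Poly → Poly → Poly
  []      ⊗ _ = []
  (a ∷ p) ⊗ q = a · q ⊕ (0# ∷ p ⊗ q)

  C : Carrier → Poly
  C a = a ∷ []

  X : Poly
  X = 0# ∷ 1# ∷ []

  Monic : Poly → Set ℓ
  Monic p = ∃[ d ] (coeff p d ≈ 1# × (∀ k → d ℕ.< k → coeff p k ≈ 0#))

  coeff-⊕ : ∀ p q k → coeff (p ⊕ q) k ≈ coeff p k + coeff q k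
  coeff-⊕ []      q       k       = sym (+-identityˡ _)
  coeff-⊕ (a ∷ p) []      k       = sym (+-identityʳ _)
  coeff-⊕ (a ∷ p) (b ∷ q) zero    = refl
  coeff-⊕ (a ∷ p) (b ∷ q) (suc k) = coeff-⊕ p q k

  coeff-⊖ : ∀ p k → coeff (⊖ p) k ≈ - coeff p k
  coeff-⊖ []      k       = sym -0#≈0#
  coeff-⊖ (a ∷ p) zero    = refl
  coeff-⊖ (a ∷ p) (suc k) = coeff-⊖ p k

  coeff-· : ∀ a p k → coeff (a · p) k ≈ a * coeff p k
  coeff-· a []      k       = sym (zeroʳ a)
  coeff-· a (b ∷ p) zero    = refl
  coeff-· a (b ∷ p) (suc k) = coeff-· a p k

  ≋-refl : ∀ {p} → p ≋ p
  ≋-refl = mk≋ λ _ → refl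

  ≋-sym : ∀ {p q} → p ≋ q → q ≋ p
  ≋-sym e = mk≋ λ k → sym (at e k)

  ≋-trans : ∀ {p q r} → p ≋ q → q ≋ r → p ≋ r
  ≋-trans e e′ = mk≋ λ k → trans (at e k) (at e′ k)

  ∷-cong : ∀ {a b p q} → a ≈ b → p ≋ q → a ∷ p ≋ b ∷ q
  ∷-cong e e′ = mk≋ λ { zero → e ; (suc k) → at e′ k }

  0∷[]≋[] : 0# ∷ [] ≋ []
  0∷[]≋[] = mk≋ λ { zero → refl ; (suc k) → refl }

  ⊕-cong : ∀ {p p′ q q′} → p ≋ p′ → q ≋ q′ → p ⊕ q ≋ p′ ⊕ q′
  ⊕-cong {p} {p′} {q} {q′} e e′ = mk≋ λ k →
    trans (coeff-⊕ p q k)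
      (trans (+-cong (at e k) (at e′ k)) (sym (coeff-⊕ p′ q′ k)))

  ⊕-assoc : ∀ p q r → (p ⊕ q) ⊕ r ≋ p ⊕ (q ⊕ r)
  ⊕-assoc p q r = mk≋ λ k → begin
    coeff ((p ⊕ q) ⊕ r) k                 ≈⟨ coeff-⊕ (p ⊕ q) r k ⟩
    coeff (p ⊕ q) k + coeff r k           ≈⟨ +-congʳ (coeff-⊕ p q k) ⟩
    coeff p k + coeff q k + coeff r k     ≈⟨ +-assoc _ _ _ ⟩
    coeff p k + (coeff q k + coeff r k)   ≈⟨ +-congˡ (coeff-⊕ q r k) ⟨
    coeff p k + coeff (q ⊕ r) k           ≈⟨ coeff-⊕ p (q ⊕ r) k ⟨
    coeff (p ⊕ (q ⊕ r)) k                 ∎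
    where open SetoidReasoning setoid

  ⊕-comm : ∀ p q → p ⊕ q ≋ q ⊕ p
  ⊕-comm p q = mk≋ λ k →
    trans (coeff-⊕ p q k) (trans (+-comm _ _) (sym (coeff-⊕ q p k)))

  ⊕-identityʳ : ∀ p → p ⊕ [] ≋ p
  ⊕-identityʳ p = ⊕-comm p []

  ⊖-cong : ∀ {p q} → p ≋ q → ⊖ p ≋ ⊖ q
  ⊖-cong {p} {q} e = mk≋ λ k →
    trans (coeff-⊖ p k) (trans (-‿cong (at e k)) (sym (coeff-⊖ q k)))

  ⊖-inverseˡ : ∀ p → (⊖ p) ⊕ p ≋ []
  ⊖-inverseˡ p = mk≋ λ k →
    trans (coeff-⊕ (⊖ p) p k) (trans (+-congʳ (coeff-⊖ p k)) (-‿inverseˡ _))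

  ⊖-inverseʳ : ∀ p → p ⊕ (⊖ p) ≋ []
  ⊖-inverseʳ p = ≋-trans (⊕-comm p (⊖ p)) (⊖-inverseˡ p)

  ⊕-interchange : ∀ p q r s → (p ⊕ q) ⊕ (r ⊕ s) ≋ (p ⊕ r) ⊕ (q ⊕ s)
  ⊕-interchange p q r s = mk≋ λ k → begin
    coeff ((p ⊕ q) ⊕ (r ⊕ s)) k
      ≈⟨ trans (coeff-⊕ (p ⊕ q) (r ⊕ s) k) (+-cong (coeff-⊕ p q k) (coeff-⊕ r s k)) ⟩
    (coeff p k + coeff q k) + (coeff r k + coeff s k)
      ≈⟨ interchange _ _ _ _ ⟩
    (coeff p k + coeff r k) + (coeff q k + coeff s k)
      ≈⟨ trans (coeff-⊕ (p ⊕ r) (q ⊕ s) k) (+-cong (coeff-⊕ p r k) (coeff-⊕ q s k)) ⟨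
    coeff ((p ⊕ r) ⊕ (q ⊕ s)) k ∎
    where open SetoidReasoning setoid

  ·-cong : ∀ {a b p q} → a ≈ b → p ≋ q → a · p ≋ b · q
  ·-cong {a} {b} {p} {q} e e′ = mk≋ λ k →
    trans (coeff-· a p k) (trans (*-cong e (at e′ k)) (sym (coeff-· b q k)))

  ·-zeroˡ : ∀ p → 0# · p ≋ []
  ·-zeroˡ p = mk≋ λ k → trans (coeff-· 0# p k) (zeroˡ _)

  ·-identityˡ : ∀ p → 1# · p ≋ p
  ·-identityˡ p = mk≋ λ k → trans (coeff-· 1# p k) (*-identityˡ _)

  ·-distribˡ : ∀ a p q → a · (p ⊕ q) ≋ a · p ⊕ a · q
  ·-distribˡ a p q = mk≋ λ k → begin
    coeff (a · (p ⊕ q)) k                  ≈⟨ coeff-· a (p ⊕ q) k ⟩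
    a * coeff (p ⊕ q) k                    ≈⟨ *-congˡ (coeff-⊕ p q k) ⟩
    a * (coeff p k + coeff q k)            ≈⟨ distribˡ _ _ _ ⟩
    a * coeff p k + a * coeff q k          ≈⟨ +-cong (coeff-· a p k) (coeff-· a q k) ⟨
    coeff (a · p) k + coeff (a · q) k      ≈⟨ coeff-⊕ (a · p) (a · q) k ⟨
    coeff (a · p ⊕ a · q) k                ∎
    where open SetoidReasoning setoid

  ·-assoc : ∀ a b p → (a * b) · p ≋ a · (b · p)
  ·-assoc a b p = mk≋ λ k → begin
    coeff ((a * b) · p) k     ≈⟨ coeff-· (a * b) p k ⟩
    a * b * coeff p k         ≈⟨ *-assoc _ _ _ ⟩
    a * (b * coeff p k)       ≈⟨ *-congˡ (coeff-· b p k) ⟨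
    a * coeff (b · p) k       ≈⟨ coeff-· a (b · p) k ⟨
    coeff (a · (b · p)) k     ∎
    where open SetoidReasoning setoid

  ·-∷0 : ∀ a p → a · (0# ∷ p) ≋ 0# ∷ a · p
  ·-∷0 a p = ∷-cong (zeroʳ a) ≋-refl

  0∷-⊕ : ∀ p q → 0# ∷ (p ⊕ q) ≋ (0# ∷ p) ⊕ (0# ∷ q)
  0∷-⊕ p q = ∷-cong (sym (+-identityʳ 0#)) ≋-refl

  ⊗-congˡ : ∀ p {q r} → q ≋ r → p ⊗ q ≋ p ⊗ r
  ⊗-congˡ []      e = ≋-refl
  ⊗-congˡ (a ∷ p) e = ⊕-cong (·-cong refl e) (∷-cong refl (⊗-congˡ p e))

  ⊗-zeroʳ : ∀ p → p ⊗ [] ≋ []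
  ⊗-zeroʳ []      = ≋-refl
  ⊗-zeroʳ (a ∷ p) = ≋-trans (∷-cong refl (⊗-zeroʳ p)) 0∷[]≋[]

  ⊗-distribˡ : ∀ p q r → p ⊗ (q ⊕ r) ≋ p ⊗ q ⊕ p ⊗ r
  ⊗-distribˡ []      q r = ≋-refl
  ⊗-distribˡ (a ∷ p) q r =
    ≋-trans
      (⊕-cong (·-distribˡ a q r)
        (≋-trans (∷-cong refl (⊗-distribˡ p q r)) (0∷-⊕ (p ⊗ q) (p ⊗ r))))
      (⊕-interchange (a · q) (a · r) (0# ∷ p ⊗ q) (0# ∷ p ⊗ r))

  ⊗-∷ʳ : ∀ p b q → p ⊗ (b ∷ q) ≋ b · p ⊕ (0# ∷ p ⊗ q)
  ⊗-∷ʳ []      b q = ≋-sym 0∷[]≋[]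
  ⊗-∷ʳ (a ∷ p) b q = ∷-cong (+-congʳ (*-comm a b))
    (≋-trans (⊕-cong (≋-refl {a · q}) (⊗-∷ʳ p b q))
    (≋-trans (≋-sym (⊕-assoc (a · q) (b · p) (0# ∷ p ⊗ q)))
    (≋-trans (⊕-cong (⊕-comm (a · q) (b · p)) (≋-refl {0# ∷ p ⊗ q}))
             (⊕-assoc (b · p) (a · q) (0# ∷ p ⊗ q)))))

  ⊗-comm : ∀ p q → p ⊗ q ≋ q ⊗ p
  ⊗-comm []      q = ≋-sym (⊗-zeroʳ q)
  ⊗-comm (a ∷ p) q =
    ≋-trans (⊕-cong (≋-refl {a · q}) (∷-cong refl (⊗-comm p q)))
            (≋-sym (⊗-∷ʳ q a p))

  ⊗-cong : ∀ {p p′ q q′} → p ≋ p′ → q ≋ q′ → p ⊗ q ≋ p′ ⊗ q′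
  ⊗-cong {p} {p′} {q} {q′} e e′ =
    ≋-trans (⊗-congˡ p e′)
      (≋-trans (⊗-comm p q′) (≋-trans (⊗-congˡ q′ e) (⊗-comm q′ p′)))

  ⊗-distribʳ : ∀ p q r → (q ⊕ r) ⊗ p ≋ q ⊗ p ⊕ r ⊗ p
  ⊗-distribʳ p q r =
    ≋-trans (⊗-comm (q ⊕ r) p)
      (≋-trans (⊗-distribˡ p q r) (⊕-cong (⊗-comm p q) (⊗-comm p r)))

  ·-⊗ : ∀ a p q → (a · p) ⊗ q ≋ a · (p ⊗ q)
  ·-⊗ a []      q = ≋-refl
  ·-⊗ a (b ∷ p) q =
    ≋-trans
      (⊕-cong (·-assoc a b q)
        (≋-trans (∷-cong refl (·-⊗ a p q)) (≋-sym (·-∷0 a (p ⊗ q)))))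
      (≋-sym (·-distribˡ a (b · q) (0# ∷ p ⊗ q)))

  0∷-⊗ : ∀ p q → (0# ∷ p) ⊗ q ≋ 0# ∷ p ⊗ q
  0∷-⊗ p q = ⊕-cong (·-zeroˡ q) (≋-refl {0# ∷ p ⊗ q})

  ⊗-assoc : ∀ p q r → (p ⊗ q) ⊗ r ≋ p ⊗ (q ⊗ r)
  ⊗-assoc []      q r = ≋-refl
  ⊗-assoc (a ∷ p) q r =
    ≋-trans (⊗-distribʳ r (a · q) (0# ∷ p ⊗ q))
      (⊕-cong (·-⊗ a q r)
        (≋-trans (0∷-⊗ (p ⊗ q) r) (∷-cong refl (⊗-assoc p q r))))

  ⊗-identityˡ : ∀ p → C 1# ⊗ p ≋ p
  ⊗-identityˡ p =
    ≋-trans (⊕-cong (·-identityˡ p) 0∷[]≋[]) (⊕-identityʳ p)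

  ⊗-identityʳ : ∀ p → p ⊗ C 1# ≋ p
  ⊗-identityʳ p = ≋-trans (⊗-comm p (C 1#)) (⊗-identityˡ p)

  commutativeRing : CommutativeRing c ℓ
  commutativeRing = record
    { Carrier = Poly
    ; _≈_ = _≋_
    ; _+_ = _⊕_
    ; _*_ = _⊗_
    ; -_  = ⊖_
    ; 0#  = []
    ; 1#  = C 1#
    ; isCommutativeRing = record
      { isRing = record
        { +-isAbelianGroup = record
          { isGroup = record
            { isMonoid = record
              { isSemigroup = record
                { isMagma = record
                  { isEquivalence = record
                    { refl = ≋-refl ; sym = ≋-sym ; trans = ≋-trans }
                  ; ∙-cong = ⊕-cong
                  }
                ; assoc = ⊕-assoc
                }
              ; identity = (λ _ → ≋-refl) , ⊕-identityʳ
              }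
            ; inverse = ⊖-inverseˡ , ⊖-inverseʳ
            ; ⁻¹-cong = ⊖-cong
            }
          ; comm = ⊕-comm
          }
        ; *-cong = ⊗-cong
        ; *-assoc = ⊗-assoc
        ; *-identity = ⊗-identityˡ , ⊗-identityʳ
        ; distrib = ⊗-distribˡ , ⊗-distribʳ
        }
      ; *-comm = ⊗-comm
      }
    }

-- The quotient S/(f): same carrier, with equality up to a multiple of f.

module Quotient {c ℓ : Level} (S : CommutativeRing c ℓ) where

  open CommutativeRing S
  open RawSemiringDefs (Semiring.rawSemiring semiring) using (_∣_)
  open RawMagmaDefs *-rawMagma using (_,_)
  open RingProperties ring
    using (-‿distribˡ-*; -‿distribʳ-*; -‿involutive)
  open AbelianGroupProperties +-abelianGroup using () renaming (⁻¹-∙-comm to -‿+-comm)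
  open CommutativeSemigroupProperties +-commutativeSemigroup using (interchange)

  infix 4 _≈_mod_
  _≈_mod_ : Carrier → Carrier → Carrier → Set (c ⊔ ℓ)
  x ≈ y mod f = f ∣ (x - y)

  private
    module _ (f : Carrier) where

      open SetoidReasoning setoid

      ≈⇒mod : ∀ {x y} → x ≈ y → x ≈ y mod f
      ≈⇒mod {x} {y} e = 0# , (begin
        0# * f  ≈⟨ zeroˡ f ⟩
        0#      ≈⟨ -‿inverseʳ y ⟨
        y - y   ≈⟨ +-congʳ e ⟨
        x - y   ∎)

      mod-neg : ∀ {x y} → x ≈ y mod f → (- x) ≈ (- y) mod f
      mod-neg {x} {y} (q , e) = - q , (begin
        - q * f      ≈⟨ -‿distribˡ-* q f ⟨
        - (q * f)    ≈⟨ -‿cong e ⟩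
        - (x - y)    ≈⟨ -‿+-comm x (- y) ⟨
        - x - (- y)  ∎)

      mod-sym : ∀ {x y} → x ≈ y mod f → y ≈ x mod f
      mod-sym {x} {y} (q , e) = - q , (begin
        - q * f        ≈⟨ -‿distribˡ-* q f ⟨
        - (q * f)      ≈⟨ -‿cong e ⟩
        - (x - y)      ≈⟨ -‿+-comm x (- y) ⟨
        - x + - (- y)  ≈⟨ +-congˡ (-‿involutive y) ⟩
        - x + y        ≈⟨ +-comm (- x) y ⟩
        y - x          ∎)

      mod-trans : ∀ {x y z} → x ≈ y mod f → y ≈ z mod f → x ≈ z mod f
      mod-trans {x} {y} {z} (q , e) (r , e′) = q + r , (begin
        (q + r) * f            ≈⟨ distribʳ f q r ⟩
        q * f + r * f          ≈⟨ +-cong e e′ ⟩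
        (x - y) + (y - z)      ≈⟨ +-assoc x (- y) (y - z) ⟩
        x + (- y + (y - z))    ≈⟨ +-congˡ (+-assoc (- y) y (- z)) ⟨
        x + ((- y + y) - z)    ≈⟨ +-congˡ (+-congʳ (-‿inverseˡ y)) ⟩
        x + (0# - z)           ≈⟨ +-congˡ (+-identityˡ (- z)) ⟩
        x - z                  ∎)

      mod-+ : ∀ {x y u v} → x ≈ y mod f → u ≈ v mod f → (x + u) ≈ (y + v) mod f
      mod-+ {x} {y} {u} {v} (q , e) (r , e′) = q + r , (begin
        (q + r) * f            ≈⟨ distribʳ f q r ⟩
        q * f + r * f          ≈⟨ +-cong e e′ ⟩
        (x - y) + (u - v)      ≈⟨ interchange x (- y) u (- v) ⟩
        (x + u) + (- y - v)    ≈⟨ +-congˡ (-‿+-comm y v) ⟩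
        (x + u) - (y + v)      ∎)

      mod-*ˡ : ∀ x {u v} → u ≈ v mod f → (x * u) ≈ (x * v) mod f
      mod-*ˡ x {u} {v} (q , e) = x * q , (begin
        x * q * f          ≈⟨ *-assoc x q f ⟩
        x * (q * f)        ≈⟨ *-congˡ e ⟩
        x * (u - v)        ≈⟨ distribˡ x u (- v) ⟩
        x * u + x * - v    ≈⟨ +-congˡ (-‿distribʳ-* x v) ⟨
        x * u - x * v      ∎)

      mod-* : ∀ {x y u v} → x ≈ y mod f → u ≈ v mod f → (x * u) ≈ (y * v) mod f
      mod-* {x} {y} {u} {v} e e′ =
        mod-trans (mod-*ˡ x e′)
          (mod-trans (≈⇒mod (*-comm x v))
            (mod-trans (mod-*ˡ v e) (≈⇒mod (*-comm v y))))

  quotientRing : Carrier → CommutativeRing c (c ⊔ ℓ)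
  quotientRing f = record
    { Carrier = Carrier
    ; _≈_ = _≈_mod f
    ; _+_ = _+_
    ; _*_ = _*_
    ; -_  = -_
    ; 0#  = 0#
    ; 1#  = 1#
    ; isCommutativeRing = record
      { isRing = record
        { +-isAbelianGroup = record
          { isGroup = record
            { isMonoid = record
              { isSemigroup = record
                { isMagma = record
                  { isEquivalence = record
                    { refl  = ≈⇒mod f refl
                    ; sym   = mod-sym f
                    ; trans = mod-trans f
                    }
                  ; ∙-cong = mod-+ f
                  }
                ; assoc = λ x y z → ≈⇒mod f (+-assoc x y z)
                }
              ; identity = (λ x → ≈⇒mod f (+-identityˡ x))
                         , (λ x → ≈⇒mod f (+-identityʳ x))
              }
            ; inverse = (λ x → ≈⇒mod f (-‿inverseˡ x))
                      , (λ x → ≈⇒mod f (-‿inverseʳ x))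
            ; ⁻¹-cong = mod-neg f
            }
          ; comm = λ x y → ≈⇒mod f (+-comm x y)
          }
        ; *-cong = mod-* f
        ; *-assoc = λ x y z → ≈⇒mod f (*-assoc x y z)
        ; *-identity = (λ x → ≈⇒mod f (*-identityˡ x))
                     , (λ x → ≈⇒mod f (*-identityʳ x))
        ; distrib = (λ x y z → ≈⇒mod f (distribˡ x y z))
                  , (λ x y z → ≈⇒mod f (distribʳ x y z))
        }
      ; *-comm = λ x y → ≈⇒mod f (*-comm x y)
      }
    }

module ℤ[X] = Polynomial ℤ.+-*-commutativeRing
module ℚ[X] = Polynomial ℚ.+-*-commutativeRing

ℤ[X]-ring ℚ[X]-ring : CommutativeRing 0ℓ 0ℓ
ℤ[X]-ring = ℤ[X].commutativeRing
ℚ[X]-ring = ℚ[X].commutativeRing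

toℚ[X] : ℤ[X].Poly → ℚ[X].Poly
toℚ[X] = map (_/ 1)

IrreducibleOverℚ : ℤ[X].Poly → Set
IrreducibleOverℚ f = Irreducible (toℚ[X] f)
  where open RawSemiringDefs (Semiring.rawSemiring (CommutativeRing.semiring ℚ[X]-ring)) using (Irreducible)

-- K = ℚ(θ) is realised as ℚ[X]/(f), with θ the class of X.  It is a field
-- when f is irreducible over ℚ.

module NumberField (f : ℤ[X].Poly) where

  open Quotient ℚ[X]-ring using (quotientRing)

  K : CommutativeRing 0ℓ 0ℓ
  K = quotientRing (toℚ[X] f)

  open CommutativeRing K

  θ : Carrier
  θ = ℚ[X].X

  fromℤ : ℤ → Carrier
  fromℤ a = ℚ[X].C (a / 1)

  eval : ℤ[X].Poly → Carrier → Carrier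
  eval h x = foldr (λ a v → fromℤ a + x * v) 0# h

  infix 4 _∈ℤ[θ] _∈𝓞

  _∈ℤ[θ] : Carrier → Set
  x ∈ℤ[θ] = ∃[ g ] x ≈ eval g θ

  _∈𝓞 : Carrier → Set
  x ∈𝓞 = ∃[ h ] (ℤ[X].Monic h × eval h x ≈ 0#)

-- ℤ[θ] = 𝓞_K.  Meaningful as a definition of "monogenic" for f monic and
-- irreducible over ℚ.

Monogenic : ℤ[X].Poly → Set
Monogenic f = ∀ x → x ∈ℤ[θ] ⇔ x ∈𝓞
  where open NumberField f

SquareFree : ℤ → Set
SquareFree a = ∀ p → Prime p → ¬ ((+ p) ℤ.^ 2 ∣ℤ a)

fPoly : (n m : ℕ) (A B : ℤ) → ℤ[X].Poly
fPoly n m A B = X ^ n + C A * (C B * X + 1#) ^ m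
  where
  open CommutativeRing ℤ[X]-ring
  open RawSemiringDefs (Semiring.rawSemiring semiring) using (_^_)
  open ℤ[X] using (C; X)

-- The truncated subtraction n ∸ m agrees with n - m, as only m < n is used.

D : (n m : ℕ) (A B : ℤ) → ℤ
D n m A B =
  (+ n) ^ n + -1ℤ ^ (n ℕ.+ m) * B ^ n * (+ (n ℕ.∸ m)) ^ (n ℕ.∸ m) * (+ m) ^ m * A
  where open import Data.Integer.Base using (_+_; _*_; _^_)

{-# OPTIONS --safe #-}

-- Write v = (n-m)B, b = BX+1, L = vX+n.  Then X b f′ = n b f - A bᵐ L and b is a
-- unit modulo f, so modulo a prime p ∤ A every repeated root of f is a root of L.
-- If p ∣ v then L is a nonzero constant modulo p; otherwise its only root is
-- a = -n/v, and vⁿ f(a) = (-1)ⁿ D modulo p².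
-- If p ∣ A then f = Xⁿ modulo p; put a = 0, where f(a) = A.
--
-- Let A and D be square-free, x integral and p x = g(θ).  With h = gcd(f , g) and
-- f = h f₁ modulo p, a monic equation for x gives f ∣ hᵈ, whence f₁ divides a power
-- of X - a.  If f₁ is not a unit modulo p, then f₁ x = u(θ) with u integral, and the
-- monic equation, multiplied by f₁ᵈ and evaluated at a, forces p² ∣ f(a).
-- Hence f₁ is a unit, f ∣ g modulo p, and x ∈ ℤ[θ].
--
-- Conversely, if p² ∣ A put w = Xⁿ⁻¹, and if p² ∣ D (with p ∤ n) let w be the quotient
-- of f by X - a; in both cases (w(θ)/p)² ∈ ℤ[θ] while w is monic of degree n-1.
module Submission where

open import Algebra.Bundles using (CommutativeRing)
import Algebra.Definitions.RawMagma as RawMagma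
open import Data.Fin.Base as Fin using (Fin; zero; suc; toℕ)
import Data.Fin.Properties as Fin
open import Data.Integer.Base as ℤ using (ℤ; +_; -[1+_]; 0ℤ; 1ℤ)
import Data.Integer.Divisibility as Unsigned
import Data.Integer.Divisibility.Signed as Signed
open import Data.Integer.GCD using (gcd; gcd-greatest)
import Data.Integer.Properties as ℤ
open import Data.List.Base using (List; []; _∷_; foldr; length)
open import Data.List.Relation.Unary.All using (All; []; _∷_)
open import Data.Maybe.Base using (Maybe; just; nothing)
open import Data.Nat.Base as ℕ using (ℕ; zero; suc; _≤_; _<_; z≤n; s≤s)
import Data.Nat.Coprimality as Coprimality
import Data.Nat.Divisibility as ℕ
open import Data.Nat.GCD using (module Bézout)
open import Data.Nat.ListAction using (product)
open import Data.Nat.Primality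
  using (Prime; euclidsLemma; prime⇒irreducible; prime⇒nonTrivial; prime⇒nonZero)
open import Data.Nat.Primality.Factorisation using (factorise; module PrimeFactorisation)
import Data.Nat.Properties as ℕ
open import Data.Product.Base using (∃-syntax; _×_; _,_; proj₁; proj₂)
open import Data.Rational.Base as ℚ using (ℚ; mkℚ; _/_; toℚᵘ; fromℚᵘ; 0ℚ; 1ℚ)
import Data.Rational.Properties as ℚ
open import Data.Rational.Unnormalised.Base as ℚᵘ using (mkℚᵘ; *≡*)
import Data.Rational.Unnormalised.Properties as ℚᵘ
open import Data.Sum.Base using (_⊎_; inj₁; inj₂; [_,_]′)
open import Defs
open import Function.Base using (_∘_)
open import Function.Bundles using (_⇔_; mk⇔; module Equivalence)
open import Level using (Level; _⊔_)
open import Relation.Binary.PropositionalEquality as ≡ using (_≡_; _≢_)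
open import Relation.Nullary using (¬_; contradiction; yes; no)

-- Commutative rings

-- Dedekind's criterion would ask for the irreducible factors of f modulo p. The gcd of f with the
-- numerator g replaces them, so modulo p a Euclidean algorithm is enough. Multiplicities enter
-- through f ∣ hᵈ: every root of f is then a root of h, so every root of the cofactor f₁ is a
-- repeated root of f. Residues modulo p are kept as integer polynomials, and each congruence
-- carries its quotient by p, because these quotients decide divisibility by p². From f = h f₁ + k₂
-- p and g = h g₁ + k₁ p comes u = k₁ f₁ - g₁ k₂; at a common zero a of h and f₁ modulo p, p²
-- divides f(a) exactly when p divides k₂(a). The element known to be integral is x, whereas the
-- known numerator is that of p N x, with N the part of the denominator still to be cleared. The
-- equation of x is therefore homogenised with denominator p N or f₁ N, and N is absorbed into a
-- cofactor. In the converse, if p divides n, the gcd condition makes the coefficient of A in D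
-- prime to p while p² ∣ nⁿ, so p² ∣ D leads back to p² ∣ A.

module RingSolver {c ℓ : Level} (R : CommutativeRing c ℓ) where

  open CommutativeRing R
  open import Algebra.Properties.Ring ring using (-‿distribˡ-*; -‿distribʳ-*; -‿involutive; -0#≈0#)
  open import Algebra.Properties.AbelianGroup +-abelianGroup using () renaming (⁻¹-∙-comm to -‿+-comm)
  open import Algebra.Properties.Semiring.Mult.TCOptimised semiring
    using (×-homo-+; ×1-homo-*; 1+×) renaming (_×_ to _⨰_)
  open import Algebra.Solver.Ring.AlmostCommutativeRing
  open import Relation.Binary.Reasoning.Setoid setoid

  -- With the optimised multiple, `fromℤ` sends 0 and 1 definitionally to `0#` and `1#`, so the
  -- constants `:0` and `:1` in solved identities match the goals as they stand.
  fromℤ : ℤ → Carrier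
  fromℤ (+ n)      = n ⨰ 1#
  fromℤ (-[1+ n ]) = - (suc n ⨰ 1#)

  fromℤ-neg : ∀ i → fromℤ (ℤ.- i) ≈ - fromℤ i
  fromℤ-neg (+ zero)    = sym -0#≈0#
  fromℤ-neg (+ (suc n)) = refl
  fromℤ-neg (-[1+ n ])  = sym (-‿involutive _)

  fromℤ-⊖ : ∀ m n → fromℤ (m ℤ.⊖ n) ≈ m ⨰ 1# - n ⨰ 1#
  fromℤ-⊖ m       zero    = sym (trans (+-congˡ -0#≈0#) (+-identityʳ _))
  fromℤ-⊖ zero    (suc n) = sym (+-identityˡ _)
  fromℤ-⊖ (suc m) (suc n) = begin
    fromℤ (suc m ℤ.⊖ suc n)                  ≡⟨ ≡.cong fromℤ (ℤ.[1+m]⊖[1+n]≡m⊖n m n) ⟩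
    fromℤ (m ℤ.⊖ n)                          ≈⟨ fromℤ-⊖ m n ⟩
    x - y                                    ≈⟨ +-congʳ (+-identityˡ x) ⟨
    (0# + x) - y                             ≈⟨ +-congʳ (+-congʳ (-‿inverseʳ 1#)) ⟨
    (1# - 1# + x) - y                        ≈⟨ +-congʳ (+-assoc _ _ _) ⟩
    (1# + (- 1# + x)) - y                    ≈⟨ +-congʳ (+-congˡ (+-comm _ _)) ⟩
    (1# + (x - 1#)) - y                      ≈⟨ +-congʳ (+-assoc _ _ _) ⟨
    (1# + x - 1#) - y                        ≈⟨ +-assoc _ _ _ ⟩
    (1# + x) + (- 1# - y)                    ≈⟨ +-congˡ (-‿+-comm 1# y) ⟩
    (1# + x) - (1# + y)                      ≈⟨ +-cong (1+× m 1#) (-‿cong (1+× n 1#)) ⟨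
    suc m ⨰ 1# - suc n ⨰ 1#                  ∎
    where
    x = m ⨰ 1#
    y = n ⨰ 1#

  fromℤ-+ : ∀ i j → fromℤ (i ℤ.+ j) ≈ fromℤ i + fromℤ j
  fromℤ-+ (+ m)      (+ n)      = ×-homo-+ 1# m n
  fromℤ-+ (+ m)      (-[1+ n ]) = fromℤ-⊖ m (suc n)
  fromℤ-+ (-[1+ m ]) (+ n)      = trans (fromℤ-⊖ n (suc m)) (+-comm _ _)
  fromℤ-+ (-[1+ m ]) (-[1+ n ]) = begin
    - (suc (suc (m ℕ.+ n)) ⨰ 1#)      ≡⟨ ≡.cong (λ k → - (k ⨰ 1#)) (≡.cong suc (≡.sym (ℕ.+-suc m n))) ⟩
    - ((suc m ℕ.+ suc n) ⨰ 1#)        ≈⟨ -‿cong (×-homo-+ 1# (suc m) (suc n)) ⟩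
    - (suc m ⨰ 1# + suc n ⨰ 1#)       ≈⟨ -‿+-comm _ _ ⟨
    - (suc m ⨰ 1#) - (suc n ⨰ 1#)     ∎

  fromℤ-*⁺ : ∀ m j → fromℤ (+ m ℤ.* j) ≈ fromℤ (+ m) * fromℤ j
  fromℤ-*⁺ m (+ n) = trans (reflexive (≡.cong fromℤ (≡.sym (ℤ.pos-* m n)))) (×1-homo-* m n)
  fromℤ-*⁺ m (-[1+ n ]) = begin
    fromℤ (+ m ℤ.* -[1+ n ])            ≡⟨ ≡.cong fromℤ (≡.sym (ℤ.neg-distribʳ-* (+ m) (+ suc n))) ⟩
    fromℤ (ℤ.- (+ m ℤ.* + suc n))       ≈⟨ fromℤ-neg (+ m ℤ.* + suc n) ⟩
    - fromℤ (+ m ℤ.* + suc n)           ≈⟨ -‿cong (fromℤ-*⁺ m (+ suc n)) ⟩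
    - (fromℤ (+ m) * fromℤ (+ suc n))   ≈⟨ -‿distribʳ-* _ _ ⟩
    fromℤ (+ m) * fromℤ -[1+ n ]        ∎

  fromℤ-* : ∀ i j → fromℤ (i ℤ.* j) ≈ fromℤ i * fromℤ j
  fromℤ-* (+ m)      j = fromℤ-*⁺ m j
  fromℤ-* (-[1+ m ]) j = begin
    fromℤ (-[1+ m ] ℤ.* j)              ≡⟨ ≡.cong fromℤ (≡.sym (ℤ.neg-distribˡ-* (+ suc m) j)) ⟩
    fromℤ (ℤ.- (+ suc m ℤ.* j))         ≈⟨ fromℤ-neg (+ suc m ℤ.* j) ⟩
    - fromℤ (+ suc m ℤ.* j)             ≈⟨ -‿cong (fromℤ-*⁺ (suc m) j) ⟩
    - (fromℤ (+ suc m) * fromℤ j)       ≈⟨ -‿distribˡ-* _ _ ⟩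
    fromℤ -[1+ m ] * fromℤ j            ∎

  private
    homomorphism : CommutativeRing.rawRing ℤ.+-*-commutativeRing
                     -Raw-AlmostCommutative⟶ fromCommutativeRing R
    homomorphism = record
      { ⟦_⟧ = fromℤ ; +-homo = fromℤ-+ ; *-homo = fromℤ-* ; -‿homo = fromℤ-neg
      ; 0-homo = refl ; 1-homo = refl }

    coeff≟ : ∀ i j → Maybe (fromℤ i ≈ fromℤ j)
    coeff≟ i j with i ℤ.≟ j
    ... | yes ≡.refl = just refl
    ... | no  _      = nothing

  open import Algebra.Solver.Ring _ _ homomorphism coeff≟ public
    using (solve; _:=_; _:+_; _:*_; _:-_; :-_; con)
    renaming (Polynomial to Expression)

  :1 :0 : ∀ {n} → Expression n
  :1 = con (+ 1)
  :0 = con (+ 0)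

module RingIdentities {c ℓ : Level} (R : CommutativeRing c ℓ) where

  open CommutativeRing R
  open RingSolver R
  open import Algebra.Properties.CommutativeSemiring.Exp commutativeSemiring public
    using (_^_; ^-congˡ; ^-homo-*; ^-distrib-*)
  open import Algebra.Definitions.RawMagma *-rawMagma using (_∣_; _,_)
  open import Relation.Binary.Reasoning.Setoid setoid

  -- As much of the binomial theorem as the proof uses: modulo `a` only the last term survives.
  ^-+-split : ∀ d a b → ∃[ t ] (a + b) ^ d ≈ a * t + b ^ d
  ^-+-split zero    a b = 0# , solve 1 (λ a → :1 := a :* :0 :+ :1) refl a
  ^-+-split (suc d) a b with t , e ← ^-+-split d a b =
    a * t + b ^ d + b * t , trans (*-congˡ e)
      (solve 4 (λ a b t v → (a :+ b) :* (a :* t :+ v) := a :* (a :* t :+ v :+ b :* t) :+ b :* v) refl a b t (b ^ d))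

  1^ : ∀ n → 1# ^ n ≈ 1#
  1^ zero    = refl
  1^ (suc n) = trans (*-identityˡ _) (1^ n)

  -1^² : ∀ n → (- 1#) ^ n * (- 1#) ^ n ≈ 1#
  -1^² n = begin
    (- 1#) ^ n * (- 1#) ^ n  ≈⟨ ^-distrib-* (- 1#) (- 1#) n ⟨
    (- 1# * - 1#) ^ n        ≈⟨ ^-congˡ n (solve 0 (:- :1 :* :- :1 := :1) refl) ⟩
    1# ^ n                   ≈⟨ 1^ n ⟩
    1#                       ∎

  -- Modulo `f` the element `u` is `y * g`. This moves the statement "divides a power" from one
  -- element to the next: from the numerator to the gcd, from there to `L`, and from `L` to `X - a`.
  ∣-^-combination : ∀ {f g u x y} d → u ≈ x * f + y * g → f ∣ g ^ d → f ∣ u ^ d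
  ∣-^-combination {f} {g} {u} {x} {y} d e (z , e′) with t , e″ ← ^-+-split d (x * f) (y * g) =
    x * t + y ^ d * z , (begin
      (x * t + y ^ d * z) * f
              ≈⟨ solve 5 (λ x t w z f → (x :* t :+ w :* z) :* f := x :* f :* t :+ w :* (z :* f)) refl x t (y ^ d) z f ⟩
      x * f * t + y ^ d * (z * f)            ≈⟨ +-congˡ (*-congˡ e′) ⟩
      x * f * t + y ^ d * g ^ d              ≈⟨ +-congˡ (^-distrib-* y g d) ⟨
      x * f * t + (y * g) ^ d                ≈⟨ e″ ⟨
      (x * f + y * g) ^ d                    ≈⟨ ^-congˡ d e ⟨
      u ^ d                                  ∎)

  comaximal∧∣^⇒unit : ∀ {f e x y} d → x * f + y * e ≈ 1# → f ∣ e ^ d → f ∣ 1#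
  comaximal∧∣^⇒unit d e f∣ with z , e′ ← ∣-^-combination d (sym e) f∣ = z , trans e′ (1^ d)

  comaximal-^ : ∀ {f e x y} d → x * f + y * e ≈ 1# → ∃[ z ] z * f + y ^ d * e ^ d ≈ 1#
  comaximal-^ {f} {e} {x} {y} d h with t , e′ ← ^-+-split d (x * f) (y * e) =
    x * t , (begin
      x * t * f + y ^ d * e ^ d
              ≈⟨ +-cong (solve 3 (λ x t f → x :* t :* f := x :* f :* t) refl x t f) (sym (^-distrib-* y e d)) ⟩
      x * f * t + (y * e) ^ d        ≈⟨ e′ ⟨
      (x * f + y * e) ^ d            ≈⟨ ^-congˡ d h ⟩
      1# ^ d                         ≈⟨ 1^ d ⟩
      1#                             ∎)

  -- Modulo b = BX + 1 one has BX = -1, so Bⁿf = (BX)ⁿ is a sign.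
  trinomial-comaximal : ∀ n m {A B X b f} → b ≈ B * X + 1# → f ≈ X ^ n + A * b ^ suc m →
                        ∃[ x ] ∃[ y ] x * f + y * b ≈ 1#
  trinomial-comaximal n m {A} {B} {X} {b} {f} hb hf with t , e ← ^-+-split n b (- 1#) =
    ε * B ^ n , - (ε * t + ε * B ^ n * A * b ^ m) , (begin
      ε * B ^ n * f + y * b
        ≈⟨ +-congʳ (*-congˡ hf) ⟩
      ε * B ^ n * (X ^ n + A * (b * b ^ m)) + y * b
        ≈⟨ solve 7 (λ ε Bn Xn A b bm t →
             ε :* Bn :* (Xn :+ A :* (b :* bm)) :+ (:- (ε :* t :+ ε :* Bn :* A :* bm)) :* b
             := ε :* (Bn :* Xn) :- ε :* b :* t) refl ε (B ^ n) (X ^ n) A b (b ^ m) t ⟩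
      ε * (B ^ n * X ^ n) - ε * b * t
        ≈⟨ +-congʳ (*-congˡ (^-distrib-* B X n)) ⟨
      ε * (B * X) ^ n - ε * b * t
        ≈⟨ +-congʳ (*-congˡ (^-congˡ n BX≈)) ⟩
      ε * (b - 1#) ^ n - ε * b * t
        ≈⟨ +-congʳ (*-congˡ e) ⟩
      ε * (b * t + ε) - ε * b * t
        ≈⟨ solve 3 (λ ε b t → ε :* (b :* t :+ ε) :- ε :* b :* t := ε :* ε) refl ε b t ⟩
      ε * ε
        ≈⟨ -1^² n ⟩
      1# ∎)
    where
    ε = (- 1#) ^ n
    y = - (ε * t + ε * B ^ n * A * b ^ m)
    BX≈ : B * X ≈ b - 1#
    BX≈ = trans (solve 2 (λ B X → B :* X := B :* X :+ :1 :- :1) refl B X) (+-congʳ (sym hb))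

  -- Eliminating Xⁿ in favour of `f` leaves the factor n b - m B X, and this is `L`. Powers and
  -- their derivatives enter only through the relations `X * dx ≈ n̂ * xn` and
  -- `b * db ≈ m̂ * bm * B`, which makes the claim a pure ring identity.
  logarithmic-derivative : ∀ {f f′ xn dx bm db X b A B L n̂ m̂ N̂} →
    X * dx ≈ n̂ * xn → b * db ≈ m̂ * bm * B →
    f ≈ xn + A * bm → f′ ≈ dx + A * db →
    b ≈ B * X + 1# → n̂ ≈ m̂ + N̂ → L ≈ N̂ * B * X + n̂ →
    X * b * f′ ≈ n̂ * b * f - A * bm * L
  logarithmic-derivative {f} {f′} {xn} {dx} {bm} {db} {X} {b} {A} {B} {L} {n̂} {m̂} {N̂} hx hb ef ef′ eb en eL = begin
    X * b * f′
      ≈⟨ *-congˡ ef′ ⟩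
    X * b * (dx + A * db)
      ≈⟨ solve 5 (λ X b dx A db → X :* b :* (dx :+ A :* db) := b :* (X :* dx) :+ A :* X :* (b :* db)) refl X b dx A db ⟩
    b * (X * dx) + A * X * (b * db)
      ≈⟨ +-cong (*-congˡ hx) (*-congˡ hb) ⟩
    b * (n̂ * xn) + A * X * (m̂ * bm * B)
      ≈⟨ solve 9 (λ b n xn A X m bm B N → b :* (n :* xn) :+ A :* X :* (m :* bm :* B)
           := n :* b :* xn :+ A :* bm :* ((m :+ N) :* (B :* X :+ :1) :- (N :* B :* X :+ (m :+ N)))) refl b n̂ xn A X
                   m̂ bm B N̂ ⟩
    n̂ * b * xn + A * bm * ((m̂ + N̂) * (B * X + 1#) - (N̂ * B * X + (m̂ + N̂)))
      ≈⟨ +-congˡ (*-congˡ (+-cong (*-cong (sym en) (sym eb)) (-‿cong (+-congˡ (sym en))))) ⟩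
    n̂ * b * xn + A * bm * (n̂ * b - (N̂ * B * X + n̂))
      ≈⟨ +-congˡ (*-congˡ (+-congˡ (-‿cong (sym eL)))) ⟩
    n̂ * b * xn + A * bm * (n̂ * b - L)
      ≈⟨ solve 6 (λ n b xn A bm L → n :* b :* xn :+ A :* bm :* (n :* b :- L) := n :* b :* (xn :+ A :* bm) :- A :* bm
              :* L) refl n̂ b xn A bm L ⟩
    n̂ * b * (xn + A * bm) - A * bm * L
      ≈⟨ +-congʳ (*-congˡ (sym ef)) ⟩
    n̂ * b * f - A * bm * L ∎

  -- Since b is a unit modulo f, the formula for f′ puts L in (f , f′) ⊆ (c , f₁).
  critical-combination : ∀ m {A A′ X L n b f f′ c c′ f₁ f₁′ x y} →
    A′ * A ≈ 1# → x * f + y * b ≈ 1# →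
    X * b * f′ ≈ n * b * f - A * b ^ m * L →
    f ≈ c * f₁ → f′ ≈ c′ * f₁ + c * f₁′ →
    ∃[ u ] ∃[ v ] L ≈ u * f₁ + v * c
  critical-combination m {A} {A′} {X} {L} {n} {b} {f} {f′} {c} {c′} {f₁} {f₁′} {x} {y} hA hb hf′ hf hd
    with z , e ← comaximal-^ m hb =
    z * L * c + k * (n * b * c - X * b * c′) , - (k * X * b * f₁′) , (begin
      L
        ≈⟨ *-identityˡ L ⟨
      1# * L
        ≈⟨ *-congʳ e ⟨
      (z * f + y ^ m * b ^ m) * L
        ≈⟨ *-congʳ (+-congˡ (*-identityˡ _)) ⟨
      (z * f + 1# * (y ^ m * b ^ m)) * L
        ≈⟨ *-congʳ (+-congˡ (*-congʳ hA)) ⟨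
      (z * f + A′ * A * (y ^ m * b ^ m)) * L
        ≈⟨ solve 9 (λ z f A′ A ym bm L n b →
             (z :* f :+ A′ :* A :* (ym :* bm)) :* L
             := z :* f :* L :+ A′ :* ym :* (n :* b :* f :- (n :* b :* f :- A :* bm :* L)))
             refl z f A′ A (y ^ m) (b ^ m) L n b ⟩
      z * f * L + k * (n * b * f - (n * b * f - A * b ^ m * L))
        ≈⟨ +-congˡ (*-congˡ (+-congˡ (-‿cong hf′))) ⟨
      z * f * L + k * (n * b * f - X * b * f′)
        ≈⟨ +-cong (*-congʳ (*-congˡ hf)) (*-congˡ (+-cong (*-congˡ hf) (-‿cong (*-congˡ hd)))) ⟩
      z * (c * f₁) * L + k * (n * b * (c * f₁) - X * b * (c′ * f₁ + c * f₁′))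
        ≈⟨ solve 10 (λ z c f₁ L k n b X c′ f₁′ →
             z :* (c :* f₁) :* L :+ k :* (n :* b :* (c :* f₁) :- X :* b :* (c′ :* f₁ :+ c :* f₁′))
             := (z :* L :* c :+ k :* (n :* b :* c :- X :* b :* c′)) :* f₁ :+ (:- (k :* X :* b :* f₁′)) :* c)
             refl z c f₁ L k n b X c′ f₁′ ⟩
      (z * L * c + k * (n * b * c - X * b * c′)) * f₁ + - (k * X * b * f₁′) * c ∎)
    where
    k = A′ * y ^ m

  -- From v a = -n follows v (B a + 1) = -n B + N B = -m B. Of vⁿ = vᵐ vᴺ the first factor is spent
  -- on (B a + 1)ᵐ, and the second is Nᴺ Bᴺ. The ring is arbitrary because `a` exists only in a
  -- residue ring where `v` is invertible.
  critical-value : ∀ m N {A B a n̂ m̂ N̂ v} → n̂ ≈ m̂ + N̂ → v ≈ N̂ * B → v * a ≈ - n̂ →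
    v ^ (m ℕ.+ N) * (a ^ (m ℕ.+ N) + A * (B * a + 1#) ^ m)
      ≈ (- 1#) ^ (m ℕ.+ N) * (n̂ ^ (m ℕ.+ N) + (- 1#) ^ (m ℕ.+ N ℕ.+ m) * B ^ (m ℕ.+ N) * N̂ ^ N * m̂ ^ m * A)
  critical-value m N {A} {B} {a} {n̂} {m̂} {N̂} {v} hn hv ha = begin
    v ^ n * (a ^ n + A * b ^ m)
      ≈⟨ distribˡ _ _ _ ⟩
    v ^ n * a ^ n + v ^ n * (A * b ^ m)
      ≈⟨ +-cong (sym (^-distrib-* v a n)) (*-congʳ (^-homo-* v m N)) ⟩
    (v * a) ^ n + v ^ m * v ^ N * (A * b ^ m)
      ≈⟨ +-cong (^-congˡ n (trans ha (neg1 n̂)))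
           (solve 4 (λ vm vN A bm → vm :* vN :* (A :* bm) := vm :* bm :* vN :* A) refl (v ^ m) (v ^ N) A (b ^ m)) ⟩
    (- 1# * n̂) ^ n + v ^ m * b ^ m * v ^ N * A
      ≈⟨ +-cong (^-distrib-* (- 1#) n̂ n)
           (*-congʳ (*-cong (trans (sym (^-distrib-* v b m))
                   (trans (^-congˡ m vb≈) (trans (^-distrib-* _ _ m) (*-congˡ (^-distrib-* m̂ B m)))))
                            (trans (^-congˡ N hv) (^-distrib-* N̂ B N)))) ⟩
    εn * n̂ ^ n + εm * (m̂ ^ m * B ^ m) * (N̂ ^ N * B ^ N) * A
      ≈⟨ +-congˡ (solve 6 (λ εm mm Bm NN BN A → εm :* (mm :* Bm) :* (NN :* BN) :* A
           := :1 :* εm :* (Bm :* BN) :* NN :* mm :* A) refl εm (m̂ ^ m) (B ^ m) (N̂ ^ N) (B ^ N) A) ⟩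
    εn * n̂ ^ n + 1# * εm * (B ^ m * B ^ N) * N̂ ^ N * m̂ ^ m * A
      ≈⟨ +-congˡ (*-congʳ (*-congʳ (*-congʳ (*-cong (*-congʳ (-1^² n)) (^-homo-* B m N))))) ⟨
    εn * n̂ ^ n + εn * εn * εm * B ^ n * N̂ ^ N * m̂ ^ m * A
      ≈⟨ solve 7 (λ εn nn εm Bn NN mm A → εn :* nn :+ εn :* εn :* εm :* Bn :* NN :* mm :* A
           := εn :* (nn :+ εn :* εm :* Bn :* NN :* mm :* A)) refl εn (n̂ ^ n) εm (B ^ n) (N̂ ^ N) (m̂ ^ m) A ⟩
    εn * (n̂ ^ n + εn * εm * B ^ n * N̂ ^ N * m̂ ^ m * A)
      ≈⟨ *-congˡ (+-congˡ (*-congʳ (*-congʳ (*-congʳ (*-congʳ (^-homo-* (- 1#) n m)))))) ⟨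
    εn * (n̂ ^ n + (- 1#) ^ (n ℕ.+ m) * B ^ n * N̂ ^ N * m̂ ^ m * A) ∎
    where
    n = m ℕ.+ N
    b = B * a + 1#
    εn = (- 1#) ^ n
    εm = (- 1#) ^ m
    neg1 : ∀ x → - x ≈ - 1# * x
    neg1 = solve 1 (λ x → :- x := :- :1 :* x) refl
    vb≈ : v * b ≈ - 1# * (m̂ * B)
    vb≈ = begin
      v * b                       ≈⟨ solve 3 (λ v B a → v :* (B :* a :+ :1) := B :* (v :* a) :+ v) refl v B a ⟩
      B * (v * a) + v             ≈⟨ +-cong (*-congˡ (trans ha (-‿cong hn))) hv ⟩
      B * - (m̂ + N̂) + N̂ * B
              ≈⟨ solve 3 (λ B m N → B :* :- (m :+ N) :+ N :* B := :- :1 :* (m :* B)) refl B m̂ N̂ ⟩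
      - 1# * (m̂ * B)              ∎

-- Polynomials and their values

module Polynomials {r ℓ : Level} (R : CommutativeRing r ℓ) where

  open CommutativeRing R
  open RingSolver R
  open Polynomial R public
  private module PS = RingSolver (Polynomial.commutativeRing R)
  open RingIdentities (Polynomial.commutativeRing R) public using (_^_; ^-congˡ)
  open import Relation.Binary.Reasoning.Setoid setoid

  tail : Poly → Poly
  tail []      = []
  tail (a ∷ p) = p

  coeff-tail : ∀ p k → coeff (tail p) k ≈ coeff p (suc k)
  coeff-tail []      k = refl
  coeff-tail (a ∷ p) k = refl

  Degree< : ℕ → Poly → Set ℓ
  Degree< n p = ∀ k → n ℕ.≤ k → coeff p k ≈ 0#

  MonicOfDegree : ℕ → Poly → Set ℓ
  MonicOfDegree n p = coeff p n ≈ 1# × Degree< (suc n) p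

  Degree<-resp : ∀ {n p q} → p ≋ q → Degree< n p → Degree< n q
  Degree<-resp e h k n≤k = trans (sym (at e k)) (h k n≤k)

  Degree<-mono : ∀ {m n p} → m ℕ.≤ n → Degree< m p → Degree< n p
  Degree<-mono m≤n h k n≤k = h k (ℕ.≤-trans m≤n n≤k)

  Degree<0⇒≋[] : ∀ {p} → Degree< 0 p → p ≋ []
  Degree<0⇒≋[] h = mk≋ λ k → h k z≤n

  Degree<-[] : ∀ n → Degree< n []
  Degree<-[] n k _ = refl

  Degree<-tail : ∀ {n a p} → Degree< (suc n) (a ∷ p) → Degree< n p
  Degree<-tail h k n≤k = h (suc k) (s≤s n≤k)

  Degree<-∷ : ∀ {n a p} → Degree< n p → Degree< (suc n) (a ∷ p)
  Degree<-∷ h (suc k) (s≤s n≤k) = h k n≤k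

  Degree<-length : ∀ p → Degree< (length p) p
  Degree<-length []      k       _       = refl
  Degree<-length (a ∷ p) (suc k) (s≤s h) = Degree<-length p k h

  Degree<-⊕ : ∀ {n} p q → Degree< n p → Degree< n q → Degree< n (p ⊕ q)
  Degree<-⊕ p q h h′ k n≤k = trans (coeff-⊕ p q k) (trans (+-cong (h k n≤k) (h′ k n≤k)) (+-identityˡ 0#))

  Degree<-⊖ : ∀ {n} p → Degree< n p → Degree< n (⊖ p)
  Degree<-⊖ p h k n≤k = trans (coeff-⊖ p k) (trans (-‿cong (h k n≤k)) (solve 0 (:- :0 := :0) refl))

  Degree<-· : ∀ {n} a p → Degree< n p → Degree< n (a · p)
  Degree<-· a p h k n≤k = trans (coeff-· a p k) (trans (*-congˡ (h k n≤k)) (zeroʳ a))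

  0∷⊗≋[] : ∀ {p} q → p ≋ [] → 0# ∷ p ⊗ q ≋ []
  0∷⊗≋[] q e = ≋-trans (∷-cong refl (⊗-cong e (≋-refl {q}))) 0∷[]≋[]

  Degree<-⊗ : ∀ m n p q → Degree< (suc m) p → Degree< n q → Degree< (m ℕ.+ n) (p ⊗ q)
  Degree<-⊗ m       n []      q hp hq = Degree<-[] (m ℕ.+ n)
  Degree<-⊗ zero    n (a ∷ p) q hp hq =
    Degree<-⊕ (a · q) (0# ∷ p ⊗ q) (Degree<-· a q hq)
      (Degree<-resp (≋-sym (0∷⊗≋[] q (Degree<0⇒≋[] {p} (Degree<-tail {0} {a} {p} hp)))) (Degree<-[] n))
  Degree<-⊗ (suc m) n (a ∷ p) q hp hq =
    Degree<-⊕ (a · q) (0# ∷ p ⊗ q) (Degree<-· a q (Degree<-mono {p = q} (ℕ.m≤n+m n (suc m)) hq))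
      (Degree<-∷ {m ℕ.+ n} {0#} {p ⊗ q} (Degree<-⊗ m n p q (Degree<-tail {suc m} {a} {p} hp) hq))

  coeff-⊗-top : ∀ m n p q → Degree< (suc m) p → Degree< (suc n) q →
                coeff (p ⊗ q) (m ℕ.+ n) ≈ coeff p m * coeff q n
  coeff-⊗-top m       n []      q hp hq = sym (zeroˡ _)
  coeff-⊗-top zero    n (a ∷ p) q hp hq = begin
    coeff (a · q ⊕ (0# ∷ p ⊗ q)) n              ≈⟨ coeff-⊕ (a · q) (0# ∷ p ⊗ q) n ⟩
    coeff (a · q) n + coeff (0# ∷ p ⊗ q) n
            ≈⟨ +-cong (coeff-· a q n) (at (0∷⊗≋[] q (Degree<0⇒≋[] {p} (Degree<-tail {0} {a} {p} hp))) n) ⟩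
    a * coeff q n + 0#                          ≈⟨ +-identityʳ _ ⟩
    a * coeff q n                               ∎
  coeff-⊗-top (suc m) n (a ∷ p) q hp hq = begin
    coeff (a · q ⊕ (0# ∷ p ⊗ q)) (suc (m ℕ.+ n))          ≈⟨ coeff-⊕ (a · q) (0# ∷ p ⊗ q) (suc (m ℕ.+ n)) ⟩
    coeff (a · q) (suc (m ℕ.+ n)) + coeff (p ⊗ q) (m ℕ.+ n)
      ≈⟨ +-cong (Degree<-· a q hq (suc (m ℕ.+ n)) (s≤s (ℕ.m≤n+m n m)))
              (coeff-⊗-top m n p q (Degree<-tail {suc m} {a} {p} hp) hq) ⟩
    0# + coeff p m * coeff q n                  ≈⟨ +-identityˡ _ ⟩
    coeff p m * coeff q n                       ∎

  MonicOfDegree-⊗ : ∀ m n p q → MonicOfDegree m p → MonicOfDegree n q → MonicOfDegree (m ℕ.+ n) (p ⊗ q)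
  MonicOfDegree-⊗ m n p q (hp , hp′) (hq , hq′) =
    trans (coeff-⊗-top m n p q hp′ hq′) (trans (*-cong hp hq) (*-identityˡ 1#)) ,
    Degree<-mono {p = p ⊗ q} (ℕ.≤-reflexive (ℕ.+-suc m n)) (Degree<-⊗ m (suc n) p q hp′ hq′)

  MonicOfDegree-⊕ : ∀ n p q → MonicOfDegree n p → Degree< n q → MonicOfDegree n (p ⊕ q)
  MonicOfDegree-⊕ n p q (h , h′) hq =
    trans (coeff-⊕ p q n) (trans (+-cong h (hq n ℕ.≤-refl)) (+-identityʳ 1#)) ,
    Degree<-⊕ p q h′ (Degree<-mono {p = q} (ℕ.n≤1+n n) hq)

  MonicOfDegree-C1 : MonicOfDegree 0 (C 1#)
  MonicOfDegree-C1 = refl , Degree<-∷ (Degree<-[] 0)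

  MonicOfDegree-X^ : ∀ n → MonicOfDegree n (X ^ n)
  MonicOfDegree-X^ zero    = MonicOfDegree-C1
  MonicOfDegree-X^ (suc n) = MonicOfDegree-⊗ 1 n X (X ^ n) (refl , Degree<-∷ (Degree<-∷ (Degree<-[] 0)))
          (MonicOfDegree-X^ n)

  Degree<-C : ∀ a → Degree< 1 (C a)
  Degree<-C a = Degree<-∷ (Degree<-[] 0)

  Degree<-^ : ∀ n p → Degree< 2 p → Degree< (suc n) (p ^ n)
  Degree<-^ zero    p h = Degree<-C 1#
  Degree<-^ (suc n) p h = Degree<-⊗ 1 (suc n) p (p ^ n) h (Degree<-^ n p h)

  ∷≋C⊕X⊗ : ∀ a p → a ∷ p ≋ C a ⊕ X ⊗ p
  ∷≋C⊕X⊗ a p = ≋-trans (∷-cong (sym (+-identityʳ a)) ≋-refl)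
    (⊕-cong (≋-refl {C a}) (≋-sym (≋-trans (0∷-⊗ (C 1#) p) (∷-cong refl (⊗-identityˡ p)))))

  ·≋C⊗ : ∀ a p → a · p ≋ C a ⊗ p
  ·≋C⊗ a p = ≋-sym (≋-trans (⊕-cong (≋-refl {a · p}) 0∷[]≋[]) (⊕-identityʳ _))

  C-⊗ : ∀ a b → C (a * b) ≋ C a ⊗ C b
  C-⊗ a b = ·≋C⊗ a (C b)

  C-cong : ∀ {a b} → a ≈ b → C a ≋ C b
  C-cong e = ∷-cong e ≋-refl

  -- The recursion follows the list of `f`: if the tail has remainder `r`, then `a ∷ r` has degree
  -- at most `n`, and a single multiple of `g` brings it below `n`. The degree of `f` never has to
  -- be known.
  division : ∀ n g → MonicOfDegree n g → ∀ f → ∃[ q ] ∃[ r ] (f ≋ q ⊗ g ⊕ r × Degree< n r)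
  division n g hg [] = [] , [] , ≋-refl , Degree<-[] n
  division n g (h₁ , h₂) (a ∷ f) with q , r , e , hr ← division n g (h₁ , h₂) f =
    c ∷ q , s ⊕ ⊖ (c · g) , e′ , deg
    where
    s = a ∷ r
    c = coeff s n
    e′ : a ∷ f ≋ (c · g ⊕ (0# ∷ q ⊗ g)) ⊕ (s ⊕ ⊖ (c · g))
    e′ = ≋-trans (∷-cong (sym (+-identityˡ a)) e)
      (PS.solve 3 (λ x y z → x PS.:+ y PS.:= z PS.:+ x PS.:+ (y PS.:- z)) ≋-refl (0# ∷ q ⊗ g) s (c · g))
    coeffs : ∀ k → coeff (s ⊕ ⊖ (c · g)) k ≈ coeff s k - c * coeff g k
    coeffs k = trans (coeff-⊕ s (⊖ (c · g)) k) (+-congˡ (trans (coeff-⊖ (c · g) k) (-‿cong (coeff-· c g k))))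
    deg : Degree< n (s ⊕ ⊖ (c · g))
    deg k n≤k with ℕ.m≤n⇒m<n∨m≡n n≤k
    ... | inj₂ ≡.refl = trans (coeffs k)
            (trans (+-congˡ (-‿cong (*-congˡ h₁))) (solve 1 (λ c → c :- c :* :1 := :0) refl c))
    ... | inj₁ n<k    = trans (coeffs k)
            (trans (+-cong (Degree<-∷ {a = a} hr k n<k) (-‿cong (*-congˡ (h₂ k n<k))))
            (solve 1 (λ c → :0 :- c :* :0 := :0) refl c))

  -- A list may end in zeros, so `q` offers no leading coefficient to inspect. Above position `n`
  -- the summand `a · f` contributes nothing, so the hypothesis passes to the tail; once the tail is
  -- zero, coefficient `n` of the product is `a`.
  monic-cancel : ∀ n f → MonicOfDegree n f → ∀ q → Degree< n (q ⊗ f) → q ≋ []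
  monic-cancel n f hf []      h = ≋-refl
  monic-cancel n f (h₁ , h₂) (a ∷ q) h = ≋-trans (∷-cong a≈0 q≋[]) 0∷[]≋[]
    where
    q≋[] : q ≋ []
    q≋[] = monic-cancel n f (h₁ , h₂) q λ k n≤k → begin
      coeff (q ⊗ f) k                                     ≈⟨ +-identityˡ _ ⟨
      0# + coeff (q ⊗ f) k                                ≈⟨ +-congʳ (Degree<-· a f h₂ (suc k) (s≤s n≤k)) ⟨
      coeff (a · f) (suc k) + coeff (q ⊗ f) k             ≈⟨ coeff-⊕ (a · f) (0# ∷ q ⊗ f) (suc k) ⟨
      coeff ((a ∷ q) ⊗ f) (suc k)                         ≈⟨ h (suc k) (ℕ.m≤n⇒m≤1+n n≤k) ⟩
      0#                                                  ∎
    a≈0 : a ≈ 0#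
    a≈0 = begin
      a                                                   ≈⟨ solve 1 (λ a → a := a :* :1 :+ :0) refl a ⟩
      a * 1# + 0#
              ≈⟨ +-cong (trans (coeff-· a f n) (*-congˡ h₁)) (at (0∷⊗≋[] f q≋[]) n) ⟨
      coeff (a · f) n + coeff (0# ∷ q ⊗ f) n              ≈⟨ coeff-⊕ (a · f) (0# ∷ q ⊗ f) n ⟨
      coeff ((a ∷ q) ⊗ f) n                               ≈⟨ h n ℕ.≤-refl ⟩
      0#                                                  ∎

  -- The product rule for a + X p, which keeps exponents out of the recursion.
  deriv : Poly → Poly
  deriv []      = []
  deriv (a ∷ p) = p ⊕ (0# ∷ deriv p)

  deriv-≋[] : ∀ p → p ≋ [] → deriv p ≋ []
  deriv-≋[] []      e = ≋-refl
  deriv-≋[] (a ∷ p) e = ≋-trans (⊕-cong p≋[] (∷-cong refl (deriv-≋[] p p≋[]))) 0∷[]≋[]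
    where
    p≋[] : p ≋ []
    p≋[] = mk≋ λ k → at e (suc k)

  deriv-cong : ∀ {p q} → p ≋ q → deriv p ≋ deriv q
  deriv-cong {[]}    {q}     e = ≋-sym (deriv-≋[] q (≋-sym e))
  deriv-cong {a ∷ p} {[]}    e = deriv-≋[] (a ∷ p) e
  deriv-cong {a ∷ p} {b ∷ q} e = ⊕-cong e′ (∷-cong refl (deriv-cong e′))
    where
    e′ : p ≋ q
    e′ = mk≋ λ k → at e (suc k)

  deriv-⊕ : ∀ p q → deriv (p ⊕ q) ≋ deriv p ⊕ deriv q
  deriv-⊕ []      q       = ≋-refl
  deriv-⊕ (a ∷ p) []      = ≋-sym (⊕-identityʳ _)
  deriv-⊕ (a ∷ p) (b ∷ q) =
    ≋-trans (⊕-cong (≋-refl {p ⊕ q}) (≋-trans (∷-cong refl (deriv-⊕ p q)) (0∷-⊕ (deriv p) (deriv q))))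
            (⊕-interchange p q (0# ∷ deriv p) (0# ∷ deriv q))

  deriv-· : ∀ a p → deriv (a · p) ≋ a · deriv p
  deriv-· a []      = ≋-refl
  deriv-· a (b ∷ p) =
    ≋-trans (⊕-cong (≋-refl {a · p}) (≋-trans (∷-cong refl (deriv-· a p)) (≋-sym (·-∷0 a (deriv p)))))
            (≋-sym (·-distribˡ a p (0# ∷ deriv p)))

  deriv-⊗ : ∀ p q → deriv (p ⊗ q) ≋ deriv p ⊗ q ⊕ p ⊗ deriv q
  deriv-⊗ []      q = ≋-refl
  deriv-⊗ (a ∷ p) q =
    ≋-trans (deriv-⊕ (a · q) (0# ∷ p ⊗ q))
    (≋-trans (⊕-cong (deriv-· a q)
                (⊕-cong (≋-refl {p ⊗ q}) (≋-trans (∷-cong refl (deriv-⊗ p q)) (0∷-⊕ (deriv p ⊗ q) (p ⊗ deriv q)))))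
    (≋-trans (PS.solve 4 (λ x y z w → x PS.:+ (y PS.:+ (z PS.:+ w)) PS.:= y PS.:+ z PS.:+ (x PS.:+ w)) ≋-refl
                (a · deriv q) (p ⊗ q) (0# ∷ deriv p ⊗ q) (0# ∷ p ⊗ deriv q))
    (⊕-cong (≋-sym (≋-trans (⊗-distribʳ q p (0# ∷ deriv p)) (⊕-cong (≋-refl {p ⊗ q}) (0∷-⊗ (deriv p) q))))
            (≋-refl {a · deriv q ⊕ (0# ∷ p ⊗ deriv q)}))))

module ℤP = Polynomials ℤ.+-*-commutativeRing
module ℚP = Polynomials ℚ.+-*-commutativeRing

-- Evaluation along a homomorphism, and integrality

record Homomorphism {r ℓ s ℓ′ : Level} (R : CommutativeRing r ℓ) (S : CommutativeRing s ℓ′)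
                    : Set (r ⊔ ℓ ⊔ s ⊔ ℓ′) where
  private
    module R = CommutativeRing R
    module S = CommutativeRing S
  field
    ⟦_⟧   : R.Carrier → S.Carrier
    ⟦⟧-cong : ∀ {a b} → a R.≈ b → ⟦ a ⟧ S.≈ ⟦ b ⟧
    0-homo  : ⟦ R.0# ⟧ S.≈ S.0#
    1-homo  : ⟦ R.1# ⟧ S.≈ S.1#
    +-homo  : ∀ a b → ⟦ a R.+ b ⟧ S.≈ ⟦ a ⟧ S.+ ⟦ b ⟧
    *-homo  : ∀ a b → ⟦ a R.* b ⟧ S.≈ ⟦ a ⟧ S.* ⟦ b ⟧

module Evaluation {r ℓ s ℓ′ : Level} {R : CommutativeRing r ℓ} {S : CommutativeRing s ℓ′}
                  (H : Homomorphism R S) where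

  private module R = CommutativeRing R
  open CommutativeRing S hiding (zero)
  open RingSolver S
  open Homomorphism H
  open Polynomials R
  open RingIdentities S using () renaming (_^_ to _^ˢ_; ^-congˡ to ^ˢ-congˡ)
  open import Algebra.Properties.Group +-group using (inverseˡ-unique)
  open import Algebra.Properties.Semiring.Sum semiring using (sum; sum-cong-≋; *-distribˡ-sum; ∑-distrib-+)
  open import Relation.Binary.Reasoning.Setoid setoid

  -- The same fold as `eval` of `NumberField`, so that over the constants of K the two agree
  -- definitionally and integrality statements need no translation of their evaluations.
  ev : Poly → Carrier → Carrier
  ev p x = foldr (λ a v → ⟦ a ⟧ + x * v) 0# p

  sum-≈0 : ∀ {k} (t : Fin k → Carrier) → (∀ i → t i ≈ 0#) → sum t ≈ 0#
  sum-≈0 {zero}  t h = refl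
  sum-≈0 {suc k} t h = trans (+-cong (h zero) (sum-≈0 (t ∘ suc) (h ∘ suc))) (+-identityˡ 0#)

  module _ (x : Carrier) where

    ev-≋[] : ∀ p → p ≋ [] → ev p x ≈ 0#
    ev-≋[] []      e = refl
    ev-≋[] (a ∷ p) e = begin
      ⟦ a ⟧ + x * ev p x   ≈⟨ +-cong (trans (⟦⟧-cong (at e 0)) 0-homo) (*-congˡ (ev-≋[] p (mk≋ (λ k → at e (suc k))))) ⟩
      0# + x * 0#          ≈⟨ solve 1 (λ x → :0 :+ x :* :0 := :0) refl x ⟩
      0#                   ∎

    ev-cong : ∀ {p q} → p ≋ q → ev p x ≈ ev q x
    ev-cong {[]}    {q}     e = sym (ev-≋[] q (≋-sym e))
    ev-cong {a ∷ p} {[]}    e = ev-≋[] (a ∷ p) e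
    ev-cong {a ∷ p} {b ∷ q} e = +-cong (⟦⟧-cong (at e 0)) (*-congˡ (ev-cong {p} {q} (mk≋ (λ k → at e (suc k)))))

    ev-⊕ : ∀ p q → ev (p ⊕ q) x ≈ ev p x + ev q x
    ev-⊕ []      q       = sym (+-identityˡ _)
    ev-⊕ (a ∷ p) []      = sym (+-identityʳ _)
    ev-⊕ (a ∷ p) (b ∷ q) = trans (+-cong (+-homo a b) (*-congˡ (ev-⊕ p q)))
      (solve 5 (λ a b x u v → a :+ b :+ x :* (u :+ v) := a :+ x :* u :+ (b :+ x :* v)) refl ⟦ a ⟧ ⟦ b ⟧ x (ev p x)
              (ev q x))

    ev-· : ∀ a p → ev (a · p) x ≈ ⟦ a ⟧ * ev p x
    ev-· a []      = sym (zeroʳ _)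
    ev-· a (b ∷ p) = trans (+-cong (*-homo a b) (*-congˡ (ev-· a p)))
      (solve 4 (λ a b x u → a :* b :+ x :* (a :* u) := a :* (b :+ x :* u)) refl ⟦ a ⟧ ⟦ b ⟧ x (ev p x))

    ev-0∷ : ∀ p → ev (R.0# ∷ p) x ≈ x * ev p x
    ev-0∷ p = trans (+-congʳ 0-homo) (+-identityˡ _)

    ev-⊗ : ∀ p q → ev (p ⊗ q) x ≈ ev p x * ev q x
    ev-⊗ []      q = sym (zeroˡ _)
    ev-⊗ (a ∷ p) q = begin
      ev (a · q ⊕ (R.0# ∷ p ⊗ q)) x            ≈⟨ ev-⊕ (a · q) (R.0# ∷ p ⊗ q) ⟩
      ev (a · q) x + ev (R.0# ∷ p ⊗ q) x       ≈⟨ +-cong (ev-· a q) (trans (ev-0∷ (p ⊗ q)) (*-congˡ (ev-⊗ p q))) ⟩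
      ⟦ a ⟧ * ev q x + x * (ev p x * ev q x)
              ≈⟨ solve 4 (λ a x u v → a :* v :+ x :* (u :* v) := (a :+ x :* u) :* v) refl ⟦ a ⟧ x (ev p x) (ev q x) ⟩
      (⟦ a ⟧ + x * ev p x) * ev q x            ∎

    ev-C : ∀ a → ev (C a) x ≈ ⟦ a ⟧
    ev-C a = trans (+-congˡ (zeroʳ x)) (+-identityʳ _)

    ev-⊖ : ∀ p → ev (⊖ p) x ≈ - ev p x
    ev-⊖ p = inverseˡ-unique _ _ (trans (sym (ev-⊕ (⊖ p) p)) (ev-cong (⊖-inverseˡ p)))

    ev-X : ev X x ≈ x
    ev-X = trans (ev-0∷ (C R.1#)) (trans (*-congˡ (trans (ev-C R.1#) 1-homo)) (*-identityʳ x))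

    ev-^ : ∀ p n → ev (p ^ n) x ≈ ev p x ^ˢ n
    ev-^ p zero    = trans (ev-C R.1#) 1-homo
    ev-^ p (suc n) = trans (ev-⊗ p (p ^ n)) (*-congˡ (ev-^ p n))

    ev-Degree< : ∀ n p → Degree< n p → ev p x ≈ sum {n} (λ j → ⟦ coeff p (toℕ j) ⟧ * x ^ˢ toℕ j)
    ev-Degree< zero    p       h = ev-≋[] p (Degree<0⇒≋[] h)
    ev-Degree< (suc n) []      h = sym (sum-≈0 {suc n} _ (λ j → trans (*-congʳ 0-homo) (zeroˡ (x ^ˢ toℕ j))))
    ev-Degree< (suc n) (a ∷ p) h = +-cong (sym (*-identityʳ _)) (begin
      x * ev p x
              ≈⟨ *-congˡ (ev-Degree< n p (Degree<-tail {n} {a} {p} h)) ⟩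
      x * sum {n} (λ j → ⟦ coeff p (toℕ j) ⟧ * x ^ˢ toℕ j)          ≈⟨ *-distribˡ-sum {n} x _ ⟩
      sum {n} (λ j → x * (⟦ coeff p (toℕ j) ⟧ * x ^ˢ toℕ j))
              ≈⟨ sum-cong-≋ {n} (λ j → solve 3 (λ x a b → x :* (a :* b) := a :* (x :* b)) refl x ⟦ coeff p (toℕ j) ⟧
              (x ^ˢ toℕ j)) ⟩
      sum {n} (λ j → ⟦ coeff p (toℕ j) ⟧ * (x * x ^ˢ toℕ j))        ∎)

    -- Cayley–Hamilton without determinants: clearing the first column by
    -- cross-multiplication doubles d and keeps the diagonal dominant in degree.
    elimination : ∀ n d (M : Fin n → Fin n → Poly) (v : Fin n → Carrier) →
      (∀ i → MonicOfDegree d (M i i)) → (∀ i j → i ≢ j → Degree< d (M i j)) →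
      (∀ i → sum (λ j → ev (M i j) x * v j) ≈ 0#) →
      ∃[ e ] ∃[ h ] (MonicOfDegree e h × ∀ j → ev h x * v j ≈ 0#)
    elimination zero    d M v diag off rel = 0 , C R.1# , MonicOfDegree-C1 , λ ()
    elimination (suc n) d M v diag off rel = extend (elimination n (d ℕ.+ d) M′ (v ∘ suc) diag′ off′ rel′)
      where
      M₀₀ = M zero zero
      M′ : Fin n → Fin n → Poly
      M′ i j = M₀₀ ⊗ M (suc i) (suc j) ⊕ ⊖ (M (suc i) zero ⊗ M zero (suc j))
      rest : Fin (suc n) → Carrier
      rest i = sum (λ j → ev (M i (suc j)) x * v (suc j))
      cross : ∀ i j → Degree< (d ℕ.+ d) (⊖ (M (suc i) zero ⊗ M zero (suc j)))
      cross i j = Degree<-⊖ (M (suc i) zero ⊗ M zero (suc j))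
        (Degree<-⊗ d d (M (suc i) zero) (M zero (suc j))
          (Degree<-mono {p = M (suc i) zero} (ℕ.n≤1+n d) (off (suc i) zero (λ ()))) (off zero (suc j) (λ ())))
      diag′ : ∀ i → MonicOfDegree (d ℕ.+ d) (M′ i i)
      diag′ i = MonicOfDegree-⊕ (d ℕ.+ d) (M₀₀ ⊗ M (suc i) (suc i)) _
        (MonicOfDegree-⊗ d d M₀₀ (M (suc i) (suc i)) (diag zero) (diag (suc i))) (cross i i)
      off′ : ∀ i j → i ≢ j → Degree< (d ℕ.+ d) (M′ i j)
      off′ i j i≢j = Degree<-⊕ (M₀₀ ⊗ M (suc i) (suc j)) _
        (Degree<-⊗ d d M₀₀ (M (suc i) (suc j)) (proj₂ (diag zero)) (off (suc i) (suc j) (i≢j ∘ Fin.suc-injective)))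
                (cross i j)
      ev-M′ : ∀ i j → ev (M′ i j) x * v (suc j) ≈
              ev M₀₀ x * (ev (M (suc i) (suc j)) x * v (suc j)) + (- ev (M (suc i) zero) x) *
                      (ev (M zero (suc j)) x * v (suc j))
      ev-M′ i j = trans (*-congʳ (trans (ev-⊕ (M₀₀ ⊗ M (suc i) (suc j)) (⊖ (M (suc i) zero ⊗ M zero (suc j))))
          (+-cong (ev-⊗ M₀₀ (M (suc i) (suc j)))
                  (trans (ev-⊖ (M (suc i) zero ⊗ M zero (suc j))) (-‿cong (ev-⊗ (M (suc i) zero) (M zero (suc j))))))))
        (solve 5 (λ a b c d v → (a :* b :+ :- (c :* d)) :* v := a :* (b :* v) :+ (:- c) :* (d :* v)) refl
          (ev M₀₀ x) (ev (M (suc i) (suc j)) x) (ev (M (suc i) zero) x) (ev (M zero (suc j)) x) (v (suc j)))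
      rel′ : ∀ i → sum (λ j → ev (M′ i j) x * v (suc j)) ≈ 0#
      rel′ i = begin
        sum (λ j → ev (M′ i j) x * v (suc j))
          ≈⟨ sum-cong-≋ (ev-M′ i) ⟩
        sum (λ j → a * (ev (M (suc i) (suc j)) x * v (suc j)) + (- b) * (ev (M zero (suc j)) x * v (suc j)))
          ≈⟨ ∑-distrib-+ (λ j → a * (ev (M (suc i) (suc j)) x * v (suc j)))
                  (λ j → (- b) * (ev (M zero (suc j)) x * v (suc j))) ⟩
        sum (λ j → a * (ev (M (suc i) (suc j)) x * v (suc j))) + sum (λ j → (- b) * (ev (M zero (suc j)) x * v (suc j)))
          ≈⟨ +-cong (*-distribˡ-sum {n} a _) (*-distribˡ-sum {n} (- b) _) ⟨
        a * rest (suc i) + (- b) * rest zero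
          ≈⟨ solve 5 (λ a b r r₀ w → a :* r :+ (:- b) :* r₀ := a :* (b :* w :+ r) :- b :* (a :* w :+ r₀)) refl a b
                  (rest (suc i)) (rest zero) (v zero) ⟩
        a * (b * v zero + rest (suc i)) - b * (a * v zero + rest zero)
          ≈⟨ +-cong (*-congˡ (rel (suc i))) (-‿cong (*-congˡ (rel zero))) ⟩
        a * 0# - b * 0#
          ≈⟨ solve 2 (λ a b → a :* :0 :- b :* :0 := :0) refl a b ⟩
        0# ∎
        where
        a = ev M₀₀ x
        b = ev (M (suc i) zero) x
      kill-rest : ∀ {h} → (∀ j → ev h x * v (suc j) ≈ 0#) → ev h x * rest zero ≈ 0#
      kill-rest {h} kills = trans (*-distribˡ-sum {n} (ev h x) _) (sum-≈0 {n} _ λ j →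
        trans (solve 3 (λ h m v → h :* (m :* v) := m :* (h :* v)) refl (ev h x) (ev (M zero (suc j)) x) (v (suc j)))
          (trans (*-congˡ (kills j)) (zeroʳ _)))
      -- `h` annihilates the later coordinates, hence also `rest zero`, which is the negative of
      -- M₀₀(x) v₀. The extra factor `M₀₀` therefore makes the product annihilate `v zero` as well.
      extend : (∃[ e ] ∃[ h ] (MonicOfDegree e h × ∀ j → ev h x * v (suc j) ≈ 0#)) →
               ∃[ e ] ∃[ h ] (MonicOfDegree e h × ∀ j → ev h x * v j ≈ 0#)
      extend (e , h , h-monic , h-kills) =
        e ℕ.+ d , h ⊗ M₀₀ , MonicOfDegree-⊗ e d h M₀₀ h-monic (diag zero) , λ
          { zero    → begin
              ev (h ⊗ M₀₀) x * v zero               ≈⟨ *-congʳ (ev-⊗ h M₀₀) ⟩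
              ev h x * ev M₀₀ x * v zero            ≈⟨ *-assoc _ _ _ ⟩
              ev h x * (ev M₀₀ x * v zero)          ≈⟨ +-identityʳ _ ⟨
              ev h x * (ev M₀₀ x * v zero) + 0#     ≈⟨ +-congˡ (kill-rest {h} h-kills) ⟨
              ev h x * (ev M₀₀ x * v zero) + ev h x * rest zero ≈⟨ distribˡ _ _ _ ⟨
              ev h x * (ev M₀₀ x * v zero + rest zero)          ≈⟨ *-congˡ (rel zero) ⟩
              ev h x * 0#                           ≈⟨ zeroʳ _ ⟩
              0#                                    ∎
          ; (suc j) → begin
              ev (h ⊗ M₀₀) x * v (suc j)            ≈⟨ *-congʳ (ev-⊗ h M₀₀) ⟩
              ev h x * ev M₀₀ x * v (suc j)
                      ≈⟨ solve 3 (λ h m v → h :* m :* v := m :* (h :* v)) refl (ev h x) (ev M₀₀ x) (v (suc j)) ⟩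
              ev M₀₀ x * (ev h x * v (suc j))       ≈⟨ *-congˡ (h-kills j) ⟩
              ev M₀₀ x * 0#                         ≈⟨ zeroʳ _ ⟩
              0#                                    ∎ }

  -- The polynomial p(X²): it turns an equation for y² into one for y.
  stretch : Poly → Poly
  stretch []      = []
  stretch (a ∷ p) = a ∷ R.0# ∷ stretch p

  ev-stretch : ∀ p x → ev (stretch p) x ≈ ev p (x * x)
  ev-stretch []      x = refl
  ev-stretch (a ∷ p) x = begin
    ⟦ a ⟧ + x * (⟦ R.0# ⟧ + x * ev (stretch p) x)   ≈⟨ +-congˡ (*-congˡ (+-cong 0-homo (*-congˡ (ev-stretch p x)))) ⟩
    ⟦ a ⟧ + x * (0# + x * ev p (x * x))
            ≈⟨ solve 3 (λ a x v → a :+ x :* (:0 :+ x :* v) := a :+ x :* x :* v) refl ⟦ a ⟧ x (ev p (x * x)) ⟩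
    ⟦ a ⟧ + x * x * ev p (x * x)                    ∎

  coeff-stretch : ∀ p k → coeff (stretch p) (k ℕ.+ k) R.≈ coeff p k
  coeff-stretch []      k       = R.refl
  coeff-stretch (a ∷ p) zero    = R.refl
  coeff-stretch (a ∷ p) (suc k) = R.trans
          (R.reflexive (≡.cong (coeff (a ∷ R.0# ∷ stretch p)) (≡.cong suc (ℕ.+-suc k k)))) (coeff-stretch p k)

  Degree<-stretch : ∀ n p → Degree< (suc n) p → Degree< (suc (n ℕ.+ n)) (stretch p)
  Degree<-stretch n       []      h = Degree<-[] _
  Degree<-stretch zero    (a ∷ p) h = Degree<-∷ {0} {a} (λ
    { zero _ → R.refl ; (suc k) _ → R.trans (stretch-≋[] p (Degree<0⇒≋[] (Degree<-tail {0} {a} {p} h)) k) R.refl })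
    where
    stretch-≋[] : ∀ p → p ≋ [] → ∀ k → coeff (stretch p) k R.≈ R.0#
    stretch-≋[] []      e k             = R.refl
    stretch-≋[] (a ∷ p) e zero          = at e 0
    stretch-≋[] (a ∷ p) e (suc zero)    = R.refl
    stretch-≋[] (a ∷ p) e (suc (suc k)) = stretch-≋[] p (mk≋ (λ k → at e (suc k))) k
  Degree<-stretch (suc n) (a ∷ p) h = Degree<-∷ {suc n ℕ.+ suc n} {a}
          (≡.subst (λ k → Degree< k (R.0# ∷ stretch p)) (≡.cong suc (≡.sym (ℕ.+-suc n n)))
    (Degree<-∷ {suc (n ℕ.+ n)} {R.0#} (Degree<-stretch n p (Degree<-tail {suc n} {a} {p} h))))

  MonicOfDegree-stretch : ∀ n p → MonicOfDegree n p → MonicOfDegree (n ℕ.+ n) (stretch p)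
  MonicOfDegree-stretch n p (h₁ , h₂) = R.trans (coeff-stretch p n) h₁ , Degree<-stretch n p h₂

  diagonal : ∀ {n} → Fin n → Fin n → Poly → Poly
  diagonal zero    zero    p = p
  diagonal zero    (suc j) p = []
  diagonal (suc i) zero    p = []
  diagonal (suc i) (suc j) p = diagonal i j p

  diagonal-≡ : ∀ {n} (i : Fin n) p → diagonal i i p ≡ p
  diagonal-≡ zero    p = ≡.refl
  diagonal-≡ (suc i) p = diagonal-≡ i p

  diagonal-≢ : ∀ {n} (i j : Fin n) p → i ≢ j → diagonal i j p ≡ []
  diagonal-≢ zero    zero    p i≢j = contradiction ≡.refl i≢j
  diagonal-≢ zero    (suc j) p i≢j = ≡.refl
  diagonal-≢ (suc i) zero    p i≢j = ≡.refl
  diagonal-≢ (suc i) (suc j) p i≢j = diagonal-≢ i j p (i≢j ∘ ≡.cong suc)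

  sum-diagonal : ∀ {n} x (i : Fin n) p (v : Fin n → Carrier) → sum (λ j → ev (diagonal i j p) x * v j) ≈ ev p x * v i
  sum-diagonal {suc n} x zero    p v = trans (+-congˡ (sum-≈0 {n} _ λ j → zeroˡ (v (suc j)))) (+-identityʳ _)
  sum-diagonal {suc n} x (suc i) p v = trans (+-cong (zeroˡ (v zero)) (sum-diagonal x i p (v ∘ suc))) (+-identityˡ _)

  module _ (θ : Carrier) {n : ℕ} {f : Poly} (f-monic : MonicOfDegree (suc n) f) (f[θ]≈0 : ev f θ ≈ 0#) where

    -- Reduced modulo `f`, multiplication by `x` on the powers 1, θ, ..., θⁿ has the matrix `entry`,
    -- so X I - `entry` taken at `x` annihilates these powers. `elimination` gives a monic `h` with
    -- h(x) annihilating each of them, and the power θ⁰ = 1 leaves h(x) = 0.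
    integral : ∀ g x → x ≈ ev g θ → ∃[ e ] ∃[ h ] (MonicOfDegree e h × ev h x ≈ 0#)
    integral g x x≈ =
      let e , h , h-monic , kills = elimination x (suc n) 1 M v M-diag M-off M-rel
      in e , h , h-monic , trans (sym (*-identityʳ _)) (kills zero)
      where
      remainder : ∀ i → ∃[ q ] ∃[ r ] (g ⊗ X ^ i ≋ q ⊗ f ⊕ r × Degree< (suc n) r)
      remainder i = division (suc n) f f-monic (g ⊗ X ^ i)
      entry : Fin (suc n) → Fin (suc n) → R.Carrier
      entry i j = coeff (proj₁ (proj₂ (remainder (toℕ i)))) (toℕ j)
      M : Fin (suc n) → Fin (suc n) → Poly
      M i j = diagonal i j X ⊕ ⊖ (C (entry i j))
      v : Fin (suc n) → Carrier
      v j = θ ^ˢ toℕ j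
      M-diag : ∀ i → MonicOfDegree 1 (M i i)
      M-diag i = MonicOfDegree-⊕ 1 (diagonal i i X) (⊖ C (entry i i))
        (≡.subst (MonicOfDegree 1) (≡.sym (diagonal-≡ i X)) (R.refl , Degree<-∷ (Degree<-∷ (Degree<-[] 0))))
        (Degree<-⊖ (C (entry i i)) (Degree<-C (entry i i)))
      M-off : ∀ i j → i ≢ j → Degree< 1 (M i j)
      M-off i j i≢j = Degree<-⊕ (diagonal i j X) (⊖ C (entry i j))
        (≡.subst (Degree< 1) (≡.sym (diagonal-≢ i j X i≢j)) (Degree<-[] 1))
        (Degree<-⊖ (C (entry i j)) (Degree<-C (entry i j)))
      x*v : ∀ i → x * v i ≈ sum (λ j → ⟦ entry i j ⟧ * v j)
      x*v i = let q , r , e , hr = remainder (toℕ i) in begin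
        x * v i
                ≈⟨ *-cong x≈ (sym (trans (ev-^ θ X (toℕ i)) (^ˢ-congˡ (toℕ i) (ev-X θ)))) ⟩
        ev g θ * ev (X ^ toℕ i) θ             ≈⟨ ev-⊗ θ g (X ^ toℕ i) ⟨
        ev (g ⊗ X ^ toℕ i) θ                  ≈⟨ ev-cong θ e ⟩
        ev (q ⊗ f ⊕ r) θ                      ≈⟨ ev-⊕ θ (q ⊗ f) r ⟩
        ev (q ⊗ f) θ + ev r θ                 ≈⟨ +-congʳ (trans (ev-⊗ θ q f) (trans (*-congˡ f[θ]≈0) (zeroʳ _))) ⟩
        0# + ev r θ                           ≈⟨ +-identityˡ _ ⟩
        ev r θ                                ≈⟨ ev-Degree< θ (suc n) r hr ⟩
        sum (λ j → ⟦ entry i j ⟧ * v j)       ∎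
      M-entry : ∀ i j → ev (M i j) x * v j ≈ ev (diagonal i j X) x * v j + (- 1#) * (⟦ entry i j ⟧ * v j)
      M-entry i j = trans (*-congʳ (trans (ev-⊕ x (diagonal i j X) (⊖ C (entry i j)))
          (+-congˡ (trans (ev-⊖ x (C (entry i j))) (-‿cong (ev-C x (entry i j)))))))
        (solve 3 (λ a c v → (a :- c) :* v := a :* v :+ (:- :1) :* (c :* v)) refl (ev (diagonal i j X) x) ⟦ entry i j ⟧
                (v j))
      M-rel : ∀ i → sum (λ j → ev (M i j) x * v j) ≈ 0#
      M-rel i = begin
        sum (λ j → ev (M i j) x * v j)
          ≈⟨ sum-cong-≋ (M-entry i) ⟩
        sum (λ j → ev (diagonal i j X) x * v j + (- 1#) * (⟦ entry i j ⟧ * v j))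
          ≈⟨ ∑-distrib-+ (λ j → ev (diagonal i j X) x * v j) (λ j → (- 1#) * (⟦ entry i j ⟧ * v j)) ⟩
        sum (λ j → ev (diagonal i j X) x * v j) + sum (λ j → (- 1#) * (⟦ entry i j ⟧ * v j))
          ≈⟨ +-cong (trans (sum-diagonal x i X v) (*-congʳ (ev-X x)))
                  (sym (*-distribˡ-sum {suc n} (- 1#) (λ j → ⟦ entry i j ⟧ * v j))) ⟩
        x * v i + (- 1#) * sum (λ j → ⟦ entry i j ⟧ * v j)
          ≈⟨ +-congˡ (*-congˡ (x*v i)) ⟨
        x * v i + (- 1#) * (x * v i)
          ≈⟨ solve 1 (λ a → a :+ (:- :1) :* a := :0) refl (x * v i) ⟩
        0# ∎

  module _ (θ x : Carrier) (E U : Poly) (Ex≈U : ev E θ * x ≈ ev U θ) where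

    -- E^d h(U/E) is monic in U up to a multiple of E, so an equation for x = U/E
    -- becomes a relation in the coefficient ring.
    homogenise : ∀ d h → MonicOfDegree d h → ∃[ T ] ev E θ ^ˢ d * ev h x ≈ ev (U ^ d ⊕ E ⊗ T) θ
    homogenise zero h (h₁ , h₂) = [] , (begin
      1# * ev h x              ≈⟨ *-identityˡ _ ⟩
      ev h x                   ≈⟨ ev-cong x {h} {C R.1#} (mk≋ λ { zero → h₁ ; (suc k) → h₂ (suc k) (s≤s z≤n) }) ⟩
      ev (C R.1#) x            ≈⟨ ev-C x R.1# ⟩
      ⟦ R.1# ⟧                 ≈⟨ ev-C θ R.1# ⟨
      ev (C R.1#) θ            ≈⟨ ev-cong θ
              (≋-sym (≋-trans (⊕-cong (≋-refl {C R.1#}) (⊗-zeroʳ E)) (⊕-identityʳ (C R.1#)))) ⟩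
      ev (C R.1# ⊕ E ⊗ []) θ   ∎)
    homogenise (suc d) h (h₁ , h₂) =
      let T , e = homogenise d (tail h)
              (R.trans (coeff-tail h d) h₁ , λ k d<k → R.trans (coeff-tail h k) (h₂ (suc k) (s≤s d<k)))
      in U ⊗ T ⊕ E ^ d ⊗ C a , (begin
        ε * ε ^ˢ d * ev h x
          ≈⟨ *-congˡ (ev-cong x {h} {a ∷ tail h} (mk≋ λ { zero → R.refl ; (suc k) → R.sym (coeff-tail h k) })) ⟩
        ε * ε ^ˢ d * (⟦ a ⟧ + x * ev (tail h) x)
          ≈⟨ solve 5 (λ ε εd a x y → ε :* εd :* (a :+ x :* y) := ε :* x :* (εd :* y) :+ ε :* (εd :* a)) refl ε
                  (ε ^ˢ d) ⟦ a ⟧ x (ev (tail h) x) ⟩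
        ε * x * (ε ^ˢ d * ev (tail h) x) + ε * (ε ^ˢ d * ⟦ a ⟧)
          ≈⟨ +-congʳ (*-cong Ex≈U e) ⟩
        ev U θ * ev (U ^ d ⊕ E ⊗ T) θ + ε * (ε ^ˢ d * ⟦ a ⟧)
          ≈⟨ +-cong (*-congˡ (trans (ev-⊕ θ (U ^ d) (E ⊗ T)) (+-congˡ (ev-⊗ θ E T))))
                  (*-congˡ (*-cong (sym (ev-^ θ E d)) (sym (ev-C θ a)))) ⟩
        ev U θ * (ev (U ^ d) θ + ε * ev T θ) + ε * (ev (E ^ d) θ * ev (C a) θ)
          ≈⟨ solve 5 (λ u ud ε t w → u :* (ud :+ ε :* t) :+ ε :* w := u :* ud :+ ε :* (u :* t :+ w)) refl
               (ev U θ) (ev (U ^ d) θ) ε (ev T θ) (ev (E ^ d) θ * ev (C a) θ) ⟩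
        ev U θ * ev (U ^ d) θ + ε * (ev U θ * ev T θ + ev (E ^ d) θ * ev (C a) θ)
          ≈⟨ +-cong (ev-⊗ θ U (U ^ d)) (*-congˡ (+-cong (ev-⊗ θ U T) (ev-⊗ θ (E ^ d) (C a)))) ⟨
        ev (U ⊗ U ^ d) θ + ε * (ev (U ⊗ T) θ + ev (E ^ d ⊗ C a) θ)
          ≈⟨ +-congˡ (trans (ev-⊗ θ E _) (*-congˡ (ev-⊕ θ (U ⊗ T) (E ^ d ⊗ C a)))) ⟨
        ev (U ⊗ U ^ d) θ + ev (E ⊗ (U ⊗ T ⊕ E ^ d ⊗ C a)) θ
          ≈⟨ ev-⊕ θ (U ⊗ U ^ d) (E ⊗ (U ⊗ T ⊕ E ^ d ⊗ C a)) ⟨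
        ev (U ⊗ U ^ d ⊕ E ⊗ (U ⊗ T ⊕ E ^ d ⊗ C a)) θ ∎)
      where
      ε = ev E θ
      a = coeff h 0

-- Congruences and integers modulo p

module Congruence {c ℓ : Level} (S : CommutativeRing c ℓ) where

  open CommutativeRing S
  open RingSolver S
  open RawMagma *-rawMagma public using (_∣_; _,_)
  private module Q = Quotient S

  infix 4 _≈_mod_
  record _≈_mod_ (x y f : Carrier) : Set (c ⊔ ℓ) where
    constructor congruent
    field
      factor   : Carrier
      equation : x ≈ y + factor * f

  ≈⇒mod : ∀ {f x y} → x ≈ y → x ≈ y mod f
  ≈⇒mod {f} {x} {y} e = congruent 0# (trans e (solve 2 (λ y f → y := y :+ :0 :* f) refl y f))

  quotient⇒mod : ∀ {f x y} → x Q.≈ y mod f → x ≈ y mod f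
  quotient⇒mod {f} {x} {y} (k , e) = congruent k
          (trans (solve 2 (λ x y → x := y :+ (x :- y)) refl x y) (+-congˡ (sym e)))

  mod⇒quotient : ∀ {f x y} → x ≈ y mod f → x Q.≈ y mod f
  mod⇒quotient {f} {x} {y} (congruent k e) = k , sym
          (trans (+-congʳ e) (solve 3 (λ y k f → y :+ k :* f :- y := k :* f) refl y k f))

  -- The same ring as Quotient.quotientRing; wrapping the congruence in a record
  -- lets its two sides be inferred.
  residueRing : Carrier → CommutativeRing c (c ⊔ ℓ)
  residueRing f = record
    { Carrier = Carrier
    ; _≈_ = _≈_mod f
    ; _+_ = _+_
    ; _*_ = _*_
    ; -_  = -_
    ; 0#  = 0#
    ; 1#  = 1#
    ; isCommutativeRing = record
      { isRing = record
        { +-isAbelianGroup = record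
          { isGroup = record
            { isMonoid = record
              { isSemigroup = record
                { isMagma = record
                  { isEquivalence = record
                    { refl  = ≈⇒mod refl
                    ; sym   = λ e → quotient⇒mod (K.sym (mod⇒quotient e))
                    ; trans = λ e e′ → quotient⇒mod (K.trans (mod⇒quotient e) (mod⇒quotient e′))
                    }
                  ; ∙-cong = λ e e′ → quotient⇒mod (K.+-cong (mod⇒quotient e) (mod⇒quotient e′))
                  }
                ; assoc = λ x y z → ≈⇒mod (+-assoc x y z)
                }
              ; identity = (λ x → ≈⇒mod (+-identityˡ x)) , (λ x → ≈⇒mod (+-identityʳ x))
              }
            ; inverse = (λ x → ≈⇒mod (-‿inverseˡ x)) , (λ x → ≈⇒mod (-‿inverseʳ x))
            ; ⁻¹-cong = λ e → quotient⇒mod (K.-‿cong (mod⇒quotient e))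
            }
          ; comm = λ x y → ≈⇒mod (+-comm x y)
          }
        ; *-cong = λ e e′ → quotient⇒mod (K.*-cong (mod⇒quotient e) (mod⇒quotient e′))
        ; *-assoc = λ x y z → ≈⇒mod (*-assoc x y z)
        ; *-identity = (λ x → ≈⇒mod (*-identityˡ x)) , (λ x → ≈⇒mod (*-identityʳ x))
        ; distrib = (λ x y z → ≈⇒mod (distribˡ x y z)) , (λ x y z → ≈⇒mod (distribʳ x y z))
        }
      ; *-comm = λ x y → ≈⇒mod (*-comm x y)
      }
    }
    where module K = CommutativeRing (Q.quotientRing f)

  ^-residue : ∀ f x n → RingIdentities._^_ (residueRing f) x n ≡ RingIdentities._^_ S x n
  ^-residue f x zero    = ≡.refl
  ^-residue f x (suc n) = ≡.cong (x *_) (^-residue f x n)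

  ∣⇒mod0 : ∀ {f x} → f ∣ x → x ≈ 0# mod f
  ∣⇒mod0 {f} {x} (k , e) = congruent k (trans (sym e) (sym (+-identityˡ _)))

  ∣-resp : ∀ {f x y} → x ≈ y → f ∣ x → f ∣ y
  ∣-resp e (k , e′) = k , trans e′ e

  ∣-*ˡ : ∀ {f x} y → f ∣ x → f ∣ y * x
  ∣-*ˡ y (k , e) = y * k , trans (*-assoc y k _) (*-congˡ e)

  ∣-*ʳ : ∀ {f x} y → f ∣ x → f ∣ x * y
  ∣-*ʳ y d = ∣-resp (*-comm y _) (∣-*ˡ y d)

  ∣-multiple : ∀ {f} k → f ∣ k * f
  ∣-multiple k = k , refl

  ∣-+ : ∀ {f x y} → f ∣ x → f ∣ y → f ∣ x + y
  ∣-+ (k , e) (k′ , e′) = k + k′ , trans (distribʳ _ k k′) (+-cong e e′)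

  ∣-+-cancelʳ : ∀ {f x y} → f ∣ x + y → f ∣ y → f ∣ x
  ∣-+-cancelʳ {f} {x} {y} (k , e) (k′ , e′) = k - k′ ,
    trans (solve 3 (λ k k′ f → (k :- k′) :* f := k :* f :- k′ :* f) refl k k′ f)
      (trans (+-cong e (-‿cong e′)) (solve 2 (λ x y → x :+ y :- y := x) refl x y))

  ∣-neg : ∀ {f x} → f ∣ x → f ∣ - x
  ∣-neg {f} {x} (k , e) = - k , trans (solve 2 (λ k f → (:- k) :* f := :- (k :* f)) refl k f) (-‿cong e)

  square∣⇒∣ : ∀ {f x} → f * f ∣ x → f ∣ x
  square∣⇒∣ {f} (k , e) = k * f , trans (*-assoc k f f) e

  ∣-*-square : ∀ {f x y} → f ∣ x → f ∣ y → f * f ∣ x * y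
  ∣-*-square {f} {x} {y} (k , e) (k′ , e′) = k * k′ ,
    trans (solve 3 (λ k k′ f → k :* k′ :* (f :* f) := k :* f :* (k′ :* f)) refl k k′ f) (*-cong e e′)

  ∣-trans : ∀ {x y z} → x ∣ y → y ∣ z → x ∣ z
  ∣-trans x∣y (k , e) = ∣-resp e (∣-*ˡ k x∣y)

  ∣-mod : ∀ {f x y} → x ≈ y mod f → f ∣ x → f ∣ y
  ∣-mod {f} {x} {y} (congruent k e) (q , e′) = q - k ,
    trans (solve 3 (λ q k f → (q :- k) :* f := q :* f :- k :* f) refl q k f)
      (trans (+-congʳ (trans e′ e)) (solve 2 (λ y K → y :+ K :- K := y) refl y (k * f)))

  -- One Newton step: (2u - u² a) a = 1 - (u a - 1)².
  inverse-mod-square : ∀ {p} u a → u * a ≈ 1# mod p → ∃[ w ] w * a ≈ 1# mod (p * p)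
  inverse-mod-square {p} u a (congruent k e) = u + u - u * u * a , congruent (- (k * k))
    (trans (solve 2 (λ u a → (u :+ u :- u :* u :* a) :* a := :1 :- (u :* a :- :1) :* (u :* a :- :1)) refl u a)
      (trans (+-congˡ (-‿cong (*-cong (+-congʳ e) (+-congʳ e))))
        (solve 2 (λ k p → :1 :- (:1 :+ k :* p :- :1) :* (:1 :+ k :* p :- :1) := :1 :+ (:- (k :* k)) :* (p :* p)) refl
                k p)))

  cancel-unit : ∀ {f} u a b → u * a ≈ 1# mod f → f ∣ a * b → f ∣ b
  cancel-unit {f} u a b (congruent k e) (q , e′) = u * q - k * b ,
    trans (solve 5 (λ u q k b f → (u :* q :- k :* b) :* f := u :* (q :* f) :- k :* f :* b) refl u q k b f)
      (trans (+-congʳ (*-congˡ e′))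
        (trans (solve 4 (λ u a b K → u :* (a :* b) :- K :* b := (u :* a :- K) :* b) refl u a b (k * f))
          (trans (*-congʳ (+-congʳ e)) (solve 2 (λ b K → (:1 :+ K :- K) :* b := b) refl b (k * f)))))

  solve-linear : ∀ {f u a} b → u * a ≈ 1# mod f → a * - (u * b) ≈ - b mod f
  solve-linear {f} {u} {a} b (congruent k e) = congruent (- (k * b))
    (trans (solve 3 (λ u a b → a :* :- (u :* b) := :- (u :* a :* b)) refl u a b)
      (trans (-‿cong (*-congʳ e))
              (solve 3 (λ k f b → :- ((:1 :+ k :* f) :* b) := :- b :+ (:- (k :* b)) :* f) refl k f b)))

  mod-square⇒mod : ∀ {p x y} → x ≈ y mod (p * p) → x ≈ y mod p
  mod-square⇒mod {p} (congruent k e) = congruent (k * p) (trans e (+-congˡ (sym (*-assoc k p p))))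

  monic-linear : ∀ {L V w X n a} → L ≈ V * X + n → n ≈ - (V * a) → w * V ≈ 1# → X - a ≈ w * L
  monic-linear {L} {V} {w} {X} {n} {a} eL en ew = sym (trans (*-congˡ (trans eL (+-congˡ en)))
    (trans (solve 4 (λ w V X a → w :* (V :* X :- V :* a) := w :* V :* (X :- a)) refl w V X a)
      (trans (*-congʳ ew) (*-identityˡ _))))

  -- In the next two lemmas (w/P)² lies in the ring generated by the root of f.
  nilpotent-witness : ∀ {f A A′ P bm xn w y} → f ≈ xn + A * bm → xn * y ≈ w * w → A′ * (P * P) ≈ A →
                      f ∣ w * w - P * (P * - (A′ * y * bm))
  nilpotent-witness {f} {A} {A′} {P} {bm} {xn} {w} {y} ef ew eA = y ,
    trans (*-congˡ (trans ef (+-congˡ (*-congʳ (sym eA)))))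
      (trans (solve 5 (λ y xn A′ P bm → y :* (xn :+ A′ :* (P :* P) :* bm) := xn :* y :- P :*
              (P :* :- (A′ :* y :* bm))) refl y xn A′ P bm)
        (+-congʳ ew))

  double-root-witness : ∀ {f l w s c e F W P} → f ≈ l * w + c → w ≈ l * s + e → F * (P * P) ≈ c → W * (P * P) ≈ e →
                        f ∣ w * w - P * (P * (W * w - F * s))
  double-root-witness {f} {l} {w} {s} {c} {e} {F} {W} {P} ef ew eF eW = s ,
    trans (*-congˡ ef)
      (trans (solve 5 (λ s l w c e → s :* (l :* w :+ c) := w :* (l :* s :+ e) :- (e :* w :- c :* s)) refl s l w c e)
        (+-cong (*-congˡ (sym ew)) (-‿cong (trans (+-cong (*-congʳ (sym eW)) (-‿cong (*-congʳ (sym eF))))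
          (solve 5 (λ W P w F s → W :* (P :* P) :* w :- F :* (P :* P) :* s := P :* (P :* (W :* w :- F :* s))) refl W P
                  w F s)))))

module IntegerDivisibility where

  open Congruence ℤ.+-*-commutativeRing
  open RingSolver ℤ.+-*-commutativeRing
  open RingIdentities ℤ.+-*-commutativeRing using (_^_)
  open import Data.Integer.Base using (_+_; _*_; -_)

  ∣⇒∣ᵤ : ∀ {x y} → x ∣ y → x Unsigned.∣ y
  ∣⇒∣ᵤ (q , e) = Signed.∣⇒∣ᵤ (Signed.divides q (≡.sym e))

  ∣ᵤ⇒∣ : ∀ {x y} → x Unsigned.∣ y → x ∣ y
  ∣ᵤ⇒∣ d with Signed.divides q e ← Signed.∣ᵤ⇒∣ d = q , ≡.sym e

  ^≡^ : ∀ a n → a ^ n ≡ a ℤ.^ n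
  ^≡^ a zero    = ≡.refl
  ^≡^ a (suc n) = ≡.cong (a *_) (^≡^ a n)

  module _ {p : ℕ} (pr : Prime p) where

    private instance
      p≢0 = prime⇒nonZero pr

    p∤1 : ¬ + p ∣ 1ℤ
    p∤1 d with prime⇒nonTrivial pr | ℕ.∣1⇒≡1 (∣⇒∣ᵤ d)
    p∤1 d | () | ≡.refl

    p∣? : ∀ a → + p ∣ a ⊎ ¬ + p ∣ a
    p∣? a with p ℕ.∣? ℤ.∣ a ∣
    ... | yes d = inj₁ (∣ᵤ⇒∣ d)
    ... | no ¬d = inj₂ (¬d ∘ ∣⇒∣ᵤ)

    p∣*⇒ : ∀ a b → + p ∣ a * b → + p ∣ a ⊎ + p ∣ b
    p∣*⇒ a b d with euclidsLemma ℤ.∣ a ∣ ℤ.∣ b ∣ pr (≡.subst (p ℕ.∣_) (ℤ.abs-* a b) (∣⇒∣ᵤ d))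
    ... | inj₁ d₁ = inj₁ (∣ᵤ⇒∣ d₁)
    ... | inj₂ d₂ = inj₂ (∣ᵤ⇒∣ d₂)

    p∣^⇒ : ∀ a n → + p ∣ a ^ n → + p ∣ a
    p∣^⇒ a zero    d = contradiction d p∤1
    p∣^⇒ a (suc n) d with p∣*⇒ a (a ^ n) d
    ... | inj₁ d₁ = d₁
    ... | inj₂ d₂ = p∣^⇒ a n d₂

    private
      lift : ∀ y n x m → 1 ℕ.+ y ℕ.* n ≡ x ℕ.* m → 1ℤ + + y * + n ≡ + x * + m
      lift y n x m e = ≡.trans (≡.cong (λ t → 1ℤ + t) (≡.sym (ℤ.pos-* y n)))
        (≡.trans (≡.sym (ℤ.pos-+ 1 (y ℕ.* n))) (≡.trans (≡.cong +_ e) (ℤ.pos-* x m)))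

      inverse⁺ : ∀ n → ¬ p ℕ.∣ n → ∃[ u ] u * + n ≈ 1ℤ mod + p
      inverse⁺ n p∤n with Coprimality.coprime-Bézout coprime
        where
        coprime : Coprimality.Coprime p n
        coprime (d∣p , d∣n) with prime⇒irreducible pr d∣p
        ... | inj₁ d≡1    = d≡1
        ... | inj₂ ≡.refl = contradiction d∣n p∤n
      ... | Bézout.+- x y e = - + y , congruent (- + x)
              (≡.trans (solve 2 (λ y n → (:- y) :* n := :1 :- (:1 :+ y :* n)) ≡.refl (+ y) (+ n))
                (≡.trans (≡.cong (λ t → 1ℤ + - t) (lift y n x p e))
                  (solve 2 (λ x p → :1 :- x :* p := :1 :+ (:- x) :* p) ≡.refl (+ x) (+ p))))
      ... | Bézout.-+ x y e = + y , congruent (+ x) (≡.sym (lift x p y n e))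

    inverse-mod-p : ∀ a → ¬ + p ∣ a → ∃[ u ] u * a ≈ 1ℤ mod + p
    inverse-mod-p (+ n)      p∤a = inverse⁺ n (p∤a ∘ ∣ᵤ⇒∣)
    inverse-mod-p (-[1+ n ]) p∤a with u , m ← inverse⁺ (suc n) (p∤a ∘ ∣ᵤ⇒∣) =
      - u , ≡.subst (_≈ 1ℤ mod + p) (solve 2 (λ u n → u :* n := (:- u) :* (:- n)) ≡.refl u (+ suc n)) m

    inverse-mod-p² : ∀ a → ¬ + p ∣ a → ∃[ u ] u * a ≈ 1ℤ mod (+ p * + p)
    inverse-mod-p² a p∤a with u , m ← inverse-mod-p a p∤a = inverse-mod-square u a m

    cancel-mod-p² : ∀ a b → ¬ + p ∣ a → + p * + p ∣ a * b → + p * + p ∣ b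
    cancel-mod-p² a b p∤a d with u , m ← inverse-mod-p² a p∤a = cancel-unit u a b m d

-- Greatest common divisors with coprime cofactors, and the Euclidean algorithm modulo p

module _ {c ℓ : Level} (R : CommutativeRing c ℓ) where

  open CommutativeRing R
  open RingSolver R

  -- Coprimality is recorded for the cofactors. Multiplying by `h` yields h = α f + β g without any
  -- cancellation, and the relation between `f₁` and `g₁` is itself needed at a zero of `f₁`.
  record BézoutData (f g : Carrier) : Set (c ⊔ ℓ) where
    field
      {h f₁ g₁ α β} : Carrier
      f≈hf₁  : f ≈ h * f₁
      g≈hg₁  : g ≈ h * g₁
      αf₁+βg₁≈1 : α * f₁ + β * g₁ ≈ 1#

  unscale : ∀ {g g̃ u w} → u * w ≈ 1# → g̃ ≈ u * g → g ≈ w * g̃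
  unscale {g} {g̃} {u} {w} e e′ = sym (trans (*-congˡ e′)
    (trans (solve 3 (λ u w g → w :* (u :* g) := u :* w :* g) refl u w g) (trans (*-congʳ e) (*-identityˡ g))))

  bézout-0 : ∀ {f g} → g ≈ 0# → BézoutData f g
  bézout-0 {f} {g} e = record
    { h = f ; f₁ = 1# ; g₁ = 0# ; α = 1# ; β = 0#
    ; f≈hf₁ = sym (*-identityʳ f) ; g≈hg₁ = trans e (sym (zeroʳ f))
    ; αf₁+βg₁≈1 = solve 0 (:1 :* :1 :+ :0 :* :0 := :1) refl }

  bézout-resp : ∀ {f g g′} → g ≈ g′ → BézoutData f g′ → BézoutData f g
  bézout-resp e b = record { BézoutData b ; g≈hg₁ = trans e (BézoutData.g≈hg₁ b) }

  -- One Euclidean step acts on the cofactors by an invertible matrix, so they stay coprime. The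
  -- units `u` and `w` pass between `g` and its monic associate `g̃`, which is the actual divisor.
  bézout-step : ∀ {f g q g̃ r u w} → f ≈ q * g̃ + r → g ≈ w * g̃ → u * w ≈ 1# → BézoutData g̃ r → BézoutData f g
  bézout-step {q = q} {u = u} {w = w} ef eg uw b = record
    { h = h ; f₁ = q * f₁ + g₁ ; g₁ = w * f₁ ; α = β ; β = (α - β * q) * u
    ; f≈hf₁ = trans ef (trans (+-cong (*-congˡ f≈hf₁) g≈hg₁)
        (solve 4 (λ q h x y → q :* (h :* x) :+ h :* y := h :* (q :* x :+ y)) refl q h f₁ g₁))
    ; g≈hg₁ = trans eg (trans (*-congˡ f≈hf₁) (solve 3 (λ w h x → w :* (h :* x) := h :* (w :* x)) refl w h f₁))
    ; αf₁+βg₁≈1 = trans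
        (solve 7 (λ α β q u w x y → β :* (q :* x :+ y) :+ (α :- β :* q) :* u :* (w :* x)
                   := β :* q :* x :+ β :* y :+ (u :* w) :* ((α :- β :* q) :* x)) refl α β q u w f₁ g₁)
        (trans (+-congˡ (*-congʳ uw))
          (trans (solve 5 (λ α β q x y → β :* q :* x :+ β :* y :+ :1 :* ((α :- β :* q) :* x) := α :* x :+ β :* y) refl
                  α β q f₁ g₁)
            αf₁+βg₁≈1)) }
    where open BézoutData b

module BézoutConsequences {c ℓ : Level} (R : CommutativeRing c ℓ) {f g : CommutativeRing.Carrier R}
        (b : BézoutData R f g) where

  open CommutativeRing R
  open RingSolver R
  open Congruence R using (_∣_; _,_)
  open RingIdentities R using (_^_; ∣-^-combination)
  open BézoutData b

  h≈αf+βg : h ≈ α * f + β * g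
  h≈αf+βg = trans (sym (trans (*-congˡ αf₁+βg₁≈1) (*-identityʳ h)))
    (trans (solve 5 (λ h α f β g → h :* (α :* f :+ β :* g) := α :* (h :* f) :+ β :* (h :* g)) refl h α f₁ β g₁)
      (+-cong (*-congˡ (sym f≈hf₁)) (*-congˡ (sym g≈hg₁))))

  ∣^⇒∣h^ : ∀ d → f ∣ g ^ d → f ∣ h ^ d
  ∣^⇒∣h^ d = ∣-^-combination d h≈αf+βg

  unit⇒∣ : f₁ ∣ 1# → f ∣ g
  unit⇒∣ (ι , e) = ι * g₁ , trans (*-congˡ f≈hf₁)
    (trans (solve 4 (λ ι g h f → ι :* g :* (h :* f) := ι :* f :* (h :* g)) refl ι g₁ h f₁)
      (trans (*-congʳ e) (trans (*-identityˡ _) (sym g≈hg₁))))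

module PolynomialsModPrime {p : ℕ} (pr : Prime p) where

  open ℤP
  open IntegerDivisibility
  private module ℤ-mod = Congruence ℤ.+-*-commutativeRing
  open Congruence ℤ[X]-ring
  private module S = RingSolver ℤ.+-*-commutativeRing
  open import Data.Integer.Base using (_+_; _*_; -_)

  -- The elements remain integer polynomials, and a proof of equality contains the quotient by p;
  -- the polynomials `k₁` and `k₂` of the local argument are read off from such proofs.
  𝔽[X] : CommutativeRing _ _
  𝔽[X] = residueRing (C (+ p))
  module 𝔽 = CommutativeRing 𝔽[X]

  C-mod : ∀ {a b} → a ℤ-mod.≈ b mod + p → C a ≈ C b mod C (+ p)
  C-mod {a} {b} (ℤ-mod.congruent k e) = congruent (C k) (≋-trans (C-cong e) (⊕-cong (≋-refl {C b}) (C-⊗ k (+ p))))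

  C⊗-mod0 : ∀ {a} x → a ℤ-mod.≈ 0ℤ mod + p → C a ⊗ x 𝔽.≈ []
  C⊗-mod0 {a} x m = 𝔽.trans (𝔽.*-congʳ {x} (C-mod m)) (≈⇒mod (≋-trans (⊗-cong 0∷[]≋[] (≋-refl {x})) (≋-refl {[]})))

  subtract-multiple : ∀ {a} g x → a ℤ-mod.≈ 0ℤ mod + p → g ⊕ ⊖ (a · x) 𝔽.≈ g
  subtract-multiple {a} g x m = 𝔽.trans
    (𝔽.+-congˡ {g} (𝔽.-‿cong (𝔽.trans (≈⇒mod (·≋C⊗ a x)) (C⊗-mod0 x m)))) (≈⇒mod (⊕-identityʳ g))

  coeff-subtract-monomial : ∀ n g c → coeff (g ⊕ ⊖ (c · X ^ n)) n ≡ coeff g n + - c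
  coeff-subtract-monomial n g c = ≡.trans (coeff-⊕ g (⊖ (c · X ^ n)) n) (≡.cong (λ t → coeff g n + t)
    (≡.trans (coeff-⊖ (c · X ^ n) n) (≡.cong -_ (≡.trans (coeff-· c (X ^ n) n)
      (≡.trans (≡.cong (c *_) (proj₁ (MonicOfDegree-X^ n))) (ℤ.*-identityʳ c))))))

  Degree<-subtract-monomial : ∀ n g c → Degree< (suc n) g → Degree< (suc n) (g ⊕ ⊖ (c · X ^ n))
  Degree<-subtract-monomial n g c h =
    Degree<-⊕ g (⊖ (c · X ^ n)) h (Degree<-⊖ (c · X ^ n) (Degree<-· c (X ^ n) (proj₂ (MonicOfDegree-X^ n))))

  Degree<-drop : ∀ n g → Degree< (suc n) g → Degree< n (g ⊕ ⊖ (coeff g n · X ^ n))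
  Degree<-drop n g h k n≤k with ℕ.m≤n⇒m<n∨m≡n n≤k
  ... | inj₁ n<k    = Degree<-subtract-monomial n g (coeff g n) h k n<k
  ... | inj₂ ≡.refl = ≡.trans (coeff-subtract-monomial n g (coeff g n)) (ℤ.+-inverseʳ (coeff g n))

  module _ (n : ℕ) (g : Poly) (u z : ℤ) where

    -- If `u` inverts the top coefficient modulo p, scaling by `u` makes it 1 + z p, and removing z
    -- p Xⁿ makes it exactly 1. Division takes place over ℤ, where being monic modulo p would not
    -- suffice.
    normalised : Poly
    normalised = u · g ⊕ ⊖ ((z * + p) · X ^ n)

    normalised-monic : Degree< (suc n) g → u * coeff g n ≡ 1ℤ + z * + p → MonicOfDegree n normalised
    normalised-monic h e =
      ≡.trans (coeff-subtract-monomial n (u · g) (z * + p))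
        (≡.trans (≡.cong (_+ - (z * + p)) (≡.trans (coeff-· u g n) e))
          (S.solve 1 (λ k → S.:1 S.:+ k S.:- k S.:= S.:1) ≡.refl (z * + p))) ,
      Degree<-subtract-monomial n (u · g) (z * + p) (Degree<-· u g h)

  normalised≈ : ∀ n g u z → normalised n g u z 𝔽.≈ C u ⊗ g
  normalised≈ n g u z = 𝔽.trans
    (subtract-multiple {z * + p} (u · g) (X ^ n) (ℤ-mod.congruent z (≡.sym (ℤ.+-identityˡ (z * + p)))))
    (≈⇒mod (·≋C⊗ u g))

  bézout-unit : ∀ n f g u c → Degree< (suc n) g → coeff g n ≡ c → u * c ℤ-mod.≈ 1ℤ mod + p →
                (∀ f g → Degree< n g → BézoutData 𝔽[X] f g) → BézoutData 𝔽[X] f g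
  bézout-unit n f g u c h ec m rec =
    let ℤ-mod.congruent z e = m
        q , r , f≋ , hr = division n (normalised n g u z) (normalised-monic n g u z h (≡.trans (≡.cong (u *_) ec) e)) f
    in bézout-step 𝔽[X] {f} {g} {q} {normalised n g u z} {r} {C u} {C c} (≈⇒mod f≋)
            (unscale 𝔽[X] {g} {normalised n g u z} {C u} {C c} uc (normalised≈ n g u z)) uc
         (rec (normalised n g u z) r hr)
    where
    uc : C u ⊗ C c 𝔽.≈ C 1ℤ
    uc = 𝔽.trans (≈⇒mod (≋-sym (C-⊗ u c))) (C-mod m)

  -- The recursion runs on a bound for the degree of `g` over ℤ, as the degree modulo p is not
  -- visible in the list. If p divides the coefficient at the bound, that term is dropped without
  -- change modulo p; otherwise the monic associate of `g` leaves a remainder of smaller degree.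
  bézout : ∀ n f g → Degree< n g → BézoutData 𝔽[X] f g
  bézout zero    f g h = bézout-0 𝔽[X] (≈⇒mod (Degree<0⇒≋[] {g} h))
  bézout (suc n) f g h = by-leading-coefficient (p∣? pr (coeff g n))
    where
    by-leading-coefficient : + p ℤ-mod.∣ coeff g n ⊎ ¬ + p ℤ-mod.∣ coeff g n → BézoutData 𝔽[X] f g
    by-leading-coefficient (inj₁ p∣c) =
      bézout-resp 𝔽[X] (𝔽.sym (subtract-multiple {coeff g n} g (X ^ n) (ℤ-mod.∣⇒mod0 p∣c)))
        (bézout n f (g ⊕ ⊖ (coeff g n · X ^ n)) (Degree<-drop n g h))
    by-leading-coefficient (inj₂ p∤c) =
      let u , m = inverse-mod-p pr (coeff g n) p∤c
      in bézout-unit n f g u (coeff g n) h ≡.refl m (bézout n)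

-- The ring ℚ[X]/(f)

module IntegerInRationals where

  toℚᵘ-/1 : ∀ a → toℚᵘ (a / 1) ℚᵘ.≃ mkℚᵘ a 0
  toℚᵘ-/1 a = ℚ.toℚᵘ-fromℚᵘ (mkℚᵘ a 0)

  +-/1 : ∀ a b → (a ℤ.+ b) / 1 ≡ a / 1 ℚ.+ b / 1
  +-/1 a b = ℚ.toℚᵘ-injective (begin
    toℚᵘ ((a ℤ.+ b) / 1)              ≈⟨ toℚᵘ-/1 (a ℤ.+ b) ⟩
    mkℚᵘ (a ℤ.+ b) 0
            ≈⟨ *≡* (≡.cong (ℤ._* + 1) (≡.sym (≡.cong₂ ℤ._+_ (ℤ.*-identityʳ a) (ℤ.*-identityʳ b)))) ⟩
    mkℚᵘ a 0 ℚᵘ.+ mkℚᵘ b 0            ≈⟨ ℚᵘ.+-cong (toℚᵘ-/1 a) (toℚᵘ-/1 b) ⟨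
    toℚᵘ (a / 1) ℚᵘ.+ toℚᵘ (b / 1)    ≈⟨ ℚ.toℚᵘ-homo-+ (a / 1) (b / 1) ⟨
    toℚᵘ (a / 1 ℚ.+ b / 1)            ∎)
    where open import Relation.Binary.Reasoning.Setoid ℚᵘ.≃-setoid

  *-/1 : ∀ a b → (a ℤ.* b) / 1 ≡ (a / 1) ℚ.* (b / 1)
  *-/1 a b = ℚ.toℚᵘ-injective (begin
    toℚᵘ ((a ℤ.* b) / 1)              ≈⟨ toℚᵘ-/1 (a ℤ.* b) ⟩
    mkℚᵘ a 0 ℚᵘ.* mkℚᵘ b 0            ≈⟨ ℚᵘ.*-cong (toℚᵘ-/1 a) (toℚᵘ-/1 b) ⟨
    toℚᵘ (a / 1) ℚᵘ.* toℚᵘ (b / 1)    ≈⟨ ℚ.toℚᵘ-homo-* (a / 1) (b / 1) ⟨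
    toℚᵘ ((a / 1) ℚ.* (b / 1))            ∎)
    where open import Relation.Binary.Reasoning.Setoid ℚᵘ.≃-setoid

  /1≡0⇒≡0 : ∀ a → a / 1 ≡ 0ℚ → a ≡ 0ℤ
  /1≡0⇒≡0 a e with *≡* e′ ← ℚᵘ.≃-trans (ℚᵘ.≃-sym (toℚᵘ-/1 a)) (ℚ.toℚᵘ-cong e) =
    ≡.trans (≡.sym (ℤ.*-identityʳ a)) e′

  denominator-clears : ∀ q → (+ (ℚ.↧ₙ q) / 1) ℚ.* q ≡ ℚ.↥ q / 1
  denominator-clears q@(mkℚ n d-1 _) = ℚ.toℚᵘ-injective (begin
    toℚᵘ ((+ suc d-1 / 1) ℚ.* q)          ≈⟨ ℚ.toℚᵘ-homo-* (+ suc d-1 / 1) q ⟩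
    toℚᵘ (+ suc d-1 / 1) ℚᵘ.* toℚᵘ q    ≈⟨ ℚᵘ.*-cong (toℚᵘ-/1 (+ suc d-1)) (ℚᵘ.≃-refl {toℚᵘ q}) ⟩
    mkℚᵘ (+ suc d-1) 0 ℚᵘ.* mkℚᵘ n d-1
            ≈⟨ *≡* (≡.trans (ℤ.*-identityʳ _)
            (≡.trans (ℤ.*-comm (+ suc d-1) n) (≡.cong (λ k → n ℤ.* + suc k) (≡.sym (ℕ.+-identityʳ d-1))))) ⟩
    mkℚᵘ n 0                            ≈⟨ toℚᵘ-/1 n ⟨
    toℚᵘ (n / 1)                        ∎)
    where open import Relation.Binary.Reasoning.Setoid ℚᵘ.≃-setoid

  /1-inverse : ∀ N → .{{_ : ℕ.NonZero N}} → ∃[ ρ ] ρ ℚ.* (+ N / 1) ≡ 1ℚ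
  /1-inverse (suc N) = fromℚᵘ (mkℚᵘ (+ 1) N) , ℚ.toℚᵘ-injective (begin
    toℚᵘ (fromℚᵘ (mkℚᵘ (+ 1) N) ℚ.* (+ suc N / 1))        ≈⟨ ℚ.toℚᵘ-homo-* (fromℚᵘ (mkℚᵘ (+ 1) N)) (+ suc N / 1) ⟩
    toℚᵘ (fromℚᵘ (mkℚᵘ (+ 1) N)) ℚᵘ.* toℚᵘ (+ suc N / 1)
            ≈⟨ ℚᵘ.*-cong (ℚ.toℚᵘ-fromℚᵘ (mkℚᵘ (+ 1) N)) (toℚᵘ-/1 (+ suc N)) ⟩
    mkℚᵘ (+ 1) N ℚᵘ.* mkℚᵘ (+ suc N) 0
            ≈⟨ *≡* (≡.cong (λ k → + suc k)
            (≡.trans (ℕ.*-identityʳ (N ℕ.+ 0)) (≡.cong (ℕ._+ 0) (≡.sym (ℕ.*-identityʳ N))))) ⟩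
    toℚᵘ 1ℚ                                               ∎)
    where open import Relation.Binary.Reasoning.Setoid ℚᵘ.≃-setoid

  homomorphism : Homomorphism ℤ.+-*-commutativeRing ℚ.+-*-commutativeRing
  homomorphism = record
    { ⟦_⟧ = _/ 1 ; ⟦⟧-cong = ≡.cong (_/ 1) ; 0-homo = ≡.refl ; 1-homo = ≡.refl ; +-homo = +-/1 ; *-homo = *-/1 }

constants : Homomorphism ℤ.+-*-commutativeRing ℚ[X]-ring
constants = record
  { ⟦_⟧ = λ a → ℚP.C (a / 1)
  ; ⟦⟧-cong = λ e → ℚP.C-cong (≡.cong (_/ 1) e)
  ; 0-homo = ℚP.0∷[]≋[]
  ; 1-homo = ℚP.≋-refl
  ; +-homo = λ a b → ℚP.C-cong (IntegerInRationals.+-/1 a b)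
  ; *-homo = λ a b → ℚP.≋-trans (ℚP.C-cong (IntegerInRationals.*-/1 a b)) (ℚP.C-⊗ (a / 1) (b / 1))
  }

module Extension where

  open ℚP using (_≋_; _⊗_; _⊕_; ≋-refl; ≋-trans; ≋-sym; X; C)
  open Evaluation constants public
  private
    module S = CommutativeRing ℚ[X]-ring
    module QS = RingSolver ℚ[X]-ring

  embed : ℤP.Poly → ℚP.Poly
  embed g = ev g X

  toℚ[X]≋embed : ∀ g → toℚ[X] g ≋ embed g
  toℚ[X]≋embed []      = ≋-refl
  toℚ[X]≋embed (a ∷ g) = ≋-trans (ℚP.∷≋C⊕X⊗ (a / 1) (toℚ[X] g))
    (S.+-congˡ {C (a / 1)} (S.*-congˡ {X} (toℚ[X]≋embed g)))

  coeff-toℚ[X] : ∀ g k → ℚP.coeff (toℚ[X] g) k ≡ ℤP.coeff g k / 1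
  coeff-toℚ[X] []      k       = ≡.refl
  coeff-toℚ[X] (a ∷ g) zero    = ≡.refl
  coeff-toℚ[X] (a ∷ g) (suc k) = coeff-toℚ[X] g k

  toℚ[X]-Degree< : ∀ n g → ℤP.Degree< n g → ℚP.Degree< n (toℚ[X] g)
  toℚ[X]-Degree< n g h k n≤k = ≡.trans (coeff-toℚ[X] g k) (≡.cong (_/ 1) (h k n≤k))

  toℚ[X]-MonicOfDegree : ∀ n g → ℤP.MonicOfDegree n g → ℚP.MonicOfDegree n (toℚ[X] g)
  toℚ[X]-MonicOfDegree n g (h₁ , h₂) = ≡.trans (coeff-toℚ[X] g n) (≡.cong (_/ 1) h₁) , toℚ[X]-Degree< (suc n) g h₂

  toℚ[X]≋[]⇒≋[] : ∀ g → toℚ[X] g ≋ [] → g ℤP.≋ []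
  toℚ[X]≋[]⇒≋[] g e = ℤP.mk≋ λ k → IntegerInRationals./1≡0⇒≡0 (ℤP.coeff g k)
          (≡.trans (≡.sym (coeff-toℚ[X] g k)) (ℚP.at e k))

  embed-C-* : ∀ a b → embed (ℤP.C (a ℤ.* b)) ≋ embed (ℤP.C a) ⊗ embed (ℤP.C b)
  embed-C-* a b = ≋-trans (ev-cong X (ℤP.C-⊗ a b)) (ev-⊗ X (ℤP.C a) (ℤP.C b))

  common-denominator : ∀ x → ∃[ N ] ∃[ g ] embed (ℤP.C (+ suc N)) ⊗ x ≋ embed g
  common-denominator []      = 0 , [] , ℚP.⊗-zeroʳ (embed (ℤP.C (+ 1)))
  common-denominator (q ∷ x) =
    let N , g , e = common-denominator x
        d = ℚ.↧ₙ q
        ν = embed (ℤP.C (+ suc N))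
        δ = embed (ℤP.C (+ d))
        δq : δ ⊗ C q ≋ C (ℚ.↥ q / 1)
        δq = ≋-trans (S.*-congʳ {C q} (ev-C X (+ d)))
               (≋-trans (≋-sym (ℚP.C-⊗ (+ d / 1) q)) (ℚP.C-cong (IntegerInRationals.denominator-clears q)))
        s = + suc N ℤ.* ℚ.↥ q
    -- `ℚ.↧ₙ q` is a successor by definition, so `suc (ℕ.pred (suc N ℕ.* d))` reduces to the product
    -- of the two denominators.
    in ℕ.pred (suc N ℕ.* d) , s ∷ ℤP.C (+ d) ℤP.⊗ g , (begin
      embed (ℤP.C (+ suc (ℕ.pred (suc N ℕ.* d)))) ⊗ (q ∷ x)
        ≈⟨ S.*-cong {embed (ℤP.C (+ suc (ℕ.pred (suc N ℕ.* d))))} {ν ⊗ δ} {q ∷ x} {C q ⊕ X ⊗ x}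
             (≋-trans (S.reflexive (≡.cong (λ k → embed (ℤP.C k)) (ℤ.pos-* (suc N) d))) (embed-C-* (+ suc N) (+ d)))
             (ℚP.∷≋C⊕X⊗ q x) ⟩
      (ν ⊗ δ) ⊗ (C q ⊕ X ⊗ x)
        ≈⟨ QS.solve 5 (λ n d q X x → (n QS.:* d) QS.:* (q QS.:+ X QS.:* x) QS.:= n QS.:* (d QS.:* q) QS.:+ X QS.:*
                (d QS.:* (n QS.:* x)))
             ≋-refl ν δ (C q) X x ⟩
      ν ⊗ (δ ⊗ C q) ⊕ X ⊗ (δ ⊗ (ν ⊗ x))
        ≈⟨ S.+-cong {ν ⊗ (δ ⊗ C q)} {C (s / 1)} {X ⊗ (δ ⊗ (ν ⊗ x))} {X ⊗ embed (ℤP.C (+ d) ℤP.⊗ g)}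
             (≋-trans (S.*-cong {ν} {C (+ suc N / 1)} {δ ⊗ C q} {C (ℚ.↥ q / 1)} (ev-C X (+ suc N)) δq)
               (≋-trans (≋-sym (ℚP.C-⊗ (+ suc N / 1) (ℚ.↥ q / 1)))
                       (ℚP.C-cong (≡.sym (IntegerInRationals.*-/1 (+ suc N) (ℚ.↥ q))))))
             (S.*-congˡ {X} (≋-trans (S.*-congˡ {δ} e) (≋-sym (ev-⊗ X (ℤP.C (+ d)) g)))) ⟩
      C (s / 1) ⊕ X ⊗ embed (ℤP.C (+ d) ℤP.⊗ g) ∎)
    where open import Relation.Binary.Reasoning.Setoid S.setoid

  scalar-inverse : ∀ N → .{{_ : ℕ.NonZero N}} → ∃[ ρ ] ρ ⊗ embed (ℤP.C (+ N)) ≋ C 1ℚ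
  scalar-inverse N =
    let ρ , e = IntegerInRationals./1-inverse N
    in C ρ , ≋-trans (S.*-congˡ {C ρ} (ev-C X (+ N))) (≋-trans (≋-sym (ℚP.C-⊗ ρ (+ N / 1))) (ℚP.C-cong e))

-- Divisibility by the square of a prime element

module PrimeElement {c ℓ : Level} (S : CommutativeRing c ℓ) where

  open CommutativeRing S
  open Congruence S
  open RingSolver S
  open RingIdentities S

  -- Modulo p both `f₁ * g` and `g₁ * f` are h f₁ g₁; their difference divided by p is u = k₁ f₁ -
  -- g₁ k₂. At θ the multiple of `f` disappears, which makes u(θ) the value of f₁(θ) g(θ) / p.
  cofactor-multiple : ∀ {f g h f₁ g₁ k₁ k₂ p} → f ≈ h * f₁ + k₂ * p → g ≈ h * g₁ + k₁ * p →
                      f₁ * g ≈ g₁ * f + p * (k₁ * f₁ - g₁ * k₂)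
  cofactor-multiple {f} {g} {h} {f₁} {g₁} {k₁} {k₂} {p} ef eg = trans (*-congˡ eg)
    (trans (solve 6 (λ f h g k k′ p → f :* (h :* g :+ k :* p) := g :* (h :* f :+ k′ :* p) :+ p :* (k :* f :- g :* k′))
            refl f₁ h g₁ k₁ k₂ p)
      (+-congʳ (*-congˡ (sym ef))))

  module _ (p : Carrier) (p∤1 : ¬ p ∣ 1#) (p∣*⇒ : ∀ x y → p ∣ x * y → p ∣ x ⊎ p ∣ y) where

    p∣^⇒ : ∀ x n → p ∣ x ^ n → p ∣ x
    p∣^⇒ x zero    d = contradiction d p∤1
    p∣^⇒ x (suc n) d with p∣*⇒ x (x ^ n) d
    ... | inj₁ d₁ = d₁
    ... | inj₂ d₂ = p∣^⇒ x n d₂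

    module _ {f h f₁ g₁ k₁ k₂ k₃ α β q₁ k₄ q₂ t : Carrier} (d₁ d₂ : ℕ)
      (f≈ : f ≈ h * f₁ + k₂ * p) (bézout : α * f₁ + β * g₁ ≈ 1# + k₃ * p)
      (f∣h^d : q₁ * f ≈ h ^ d₁ + k₄ * p)
      (f∣u^d : q₂ * f ≈ (k₁ * f₁ - g₁ * k₂) ^ d₂ + f₁ * t) where

      -- The parameters are the values at one point of the polynomials in the local argument. From p
      -- ∣ f₁ follows p ∣ f, and the two power relations give p ∣ h and p ∣ u. Hence p ∣ g₁ k₂,
      -- while p ∤ g₁ by the Bézout relation; so p ∣ k₂, and both terms of h f₁ + k₂ p are divisible
      -- by p².
      p²∣-value : p ∣ f₁ → p * p ∣ f
      p²∣-value p∣f₁ = ∣-resp (sym f≈)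
              (∣-+ (∣-*-square p∣h p∣f₁) (∣-*-square p∣k₂ (∣-resp (*-identityˡ p) (∣-multiple 1#))))
        where
        u = k₁ * f₁ - g₁ * k₂
        p∣f : p ∣ f
        p∣f = ∣-resp (sym f≈) (∣-+ (∣-*ˡ h p∣f₁) (∣-multiple k₂))
        p∣h : p ∣ h
        p∣h = p∣^⇒ h d₁ (∣-+-cancelʳ (∣-resp f∣h^d (∣-*ˡ q₁ p∣f)) (∣-multiple k₄))
        p∣u : p ∣ u
        p∣u = p∣^⇒ u d₂ (∣-+-cancelʳ (∣-resp f∣u^d (∣-*ˡ q₂ p∣f)) (∣-*ʳ t p∣f₁))
        p∣g₁k₂ : p ∣ g₁ * k₂
        p∣g₁k₂ = ∣-+-cancelʳ (∣-resp (solve 2 (λ x y → x := y :+ (x :- y)) refl (k₁ * f₁) (g₁ * k₂)) (∣-*ˡ k₁ p∣f₁)) p∣u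
        p∤g₁ : ¬ p ∣ g₁
        p∤g₁ p∣g₁ = p∤1 (∣-+-cancelʳ (∣-resp bézout (∣-+ (∣-*ˡ α p∣f₁) (∣-*ˡ β p∣g₁))) (∣-multiple k₃))
        p∣k₂ : p ∣ k₂
        p∣k₂ = [ (λ p∣g₁ → contradiction p∣g₁ p∤g₁) , (λ d → d) ]′ (p∣*⇒ g₁ k₂ p∣g₁k₂)

-- Integer values and division by X - a

identity : Homomorphism ℤ.+-*-commutativeRing ℤ.+-*-commutativeRing
identity = record
  { ⟦_⟧ = λ a → a ; ⟦⟧-cong = λ e → e ; 0-homo = ≡.refl ; 1-homo = ≡.refl
  ; +-homo = λ _ _ → ≡.refl ; *-homo = λ _ _ → ≡.refl }

module IntegerValue (a : ℤ) where

  open ℤP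
  open Evaluation identity using (ev; ev-⊕; ev-⊗; ev-⊖; ev-C; ev-^; ev-cong; ev-X; ev-≋[])
  private
    module PS = RingSolver ℤ[X]-ring
    module S = CommutativeRing ℤ[X]-ring

  value : Poly → ℤ
  value g = ev g a

  linear : Poly
  linear = X ⊕ ⊖ C a

  -- Horner's scheme: the intermediate values met when evaluating at `a` are the coefficients of the
  -- quotient by X - a.
  quotient-linear : Poly → Poly
  quotient-linear []      = []
  quotient-linear (b ∷ g) = value g ∷ quotient-linear g

  divide-linear : ∀ g → g ≋ linear ⊗ quotient-linear g ⊕ C (value g)
  divide-linear []      = ≋-sym (≋-trans (S.+-cong {linear ⊗ []} {[]} {C 0ℤ} {[]} (⊗-zeroʳ linear) 0∷[]≋[]) ≋-refl)
  divide-linear (b ∷ g) = begin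
      b ∷ g
        ≈⟨ ∷≋C⊕X⊗ b g ⟩
      C b ⊕ X ⊗ g
        ≈⟨ S.+-congˡ {C b} (S.*-congˡ {X} (divide-linear g)) ⟩
      C b ⊕ X ⊗ (linear ⊗ w ⊕ C v)
        ≈⟨ PS.solve 5 (λ b X a w v → b PS.:+ X PS.:* ((X PS.:- a) PS.:* w PS.:+ v)
             PS.:= (X PS.:- a) PS.:* (v PS.:+ X PS.:* w) PS.:+ (b PS.:+ a PS.:* v)) ≋-refl (C b) X (C a) w (C v) ⟩
      linear ⊗ (C v ⊕ X ⊗ w) ⊕ (C b ⊕ C a ⊗ C v)
        ≈⟨ S.+-cong {linear ⊗ (C v ⊕ X ⊗ w)} {linear ⊗ (v ∷ w)} {C b ⊕ C a ⊗ C v} {C (b ℤ.+ a ℤ.* v)}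
             (S.*-congˡ {linear} (≋-sym (∷≋C⊕X⊗ v w))) (S.+-congˡ {C b} (≋-sym (C-⊗ a v))) ⟩
      linear ⊗ (v ∷ w) ⊕ C (b ℤ.+ a ℤ.* v) ∎
    where
    open import Relation.Binary.Reasoning.Setoid S.setoid
    v = value g
    w = quotient-linear g

  Degree<-quotient-linear : ∀ k g → Degree< (suc k) g → Degree< k (quotient-linear g)
  Degree<-quotient-linear k       []      h = Degree<-[] k
  Degree<-quotient-linear (suc k) (b ∷ g) h = Degree<-∷ {k} {value g}
          (Degree<-quotient-linear k g (Degree<-tail {suc k} {b} {g} h))
  Degree<-quotient-linear zero    (b ∷ g) h = λ
    { zero    _ → ev-≋[] a g (Degree<0⇒≋[] {g} g-small)
    ; (suc k) _ → Degree<-quotient-linear zero g (Degree<-mono {0} {1} {g} z≤n g-small) k z≤n }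
    where
    g-small : Degree< 0 g
    g-small = Degree<-tail {0} {b} {g} h

  MonicOfDegree-linear : MonicOfDegree 1 linear
  MonicOfDegree-linear = MonicOfDegree-⊕ 1 X (⊖ C a)
    (≡.refl , Degree<-∷ (Degree<-∷ (Degree<-[] 0))) (Degree<-⊖ (C a) (Degree<-C a))

  MonicOfDegree-quotient-linear : ∀ k g → MonicOfDegree (suc k) g → MonicOfDegree k (quotient-linear g)
  MonicOfDegree-quotient-linear k g (h₁ , h₂) = w₁ , Degree<-w
    where
    w = quotient-linear g
    Degree<-w : Degree< (suc k) w
    Degree<-w = Degree<-quotient-linear (suc k) g h₂
    w₁ : coeff w k ≡ 1ℤ
    w₁ = ≡-begin
      coeff w k                                             ≡⟨ ℤ.*-identityˡ (coeff w k) ⟨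
      1ℤ ℤ.* coeff w k                                      ≡⟨ ≡.cong (ℤ._* coeff w k) (proj₁ MonicOfDegree-linear) ⟨
      coeff linear 1 ℤ.* coeff w k
              ≡⟨ coeff-⊗-top 1 k linear w (proj₂ MonicOfDegree-linear) Degree<-w ⟨
      coeff (linear ⊗ w) (suc k)                            ≡⟨ ℤ.+-identityʳ (coeff (linear ⊗ w) (suc k)) ⟨
      coeff (linear ⊗ w) (suc k) ℤ.+ 0ℤ                     ≡⟨ coeff-⊕ (linear ⊗ w) (C (value g)) (suc k) ⟨
      coeff (linear ⊗ w ⊕ C (value g)) (suc k)              ≡⟨ at (divide-linear g) (suc k) ⟨
      coeff g (suc k)                                       ≡⟨ h₁ ⟩
      1ℤ                                                    ≡-∎
      where open ≡.≡-Reasoning renaming (begin_ to ≡-begin_; _∎ to _≡-∎)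

  value-⊕⊗ : ∀ {g h k l} → g ≋ h ⊕ k ⊗ l → value g ≡ value h ℤ.+ value k ℤ.* value l
  value-⊕⊗ {g} {h} {k} {l} e = ≡.trans (ev-cong a {g} {h ⊕ k ⊗ l} e)
    (≡.trans (ev-⊕ a h (k ⊗ l)) (≡.cong (λ t → value h ℤ.+ t) (ev-⊗ a k l)))

  value-C : ∀ b → value (C b) ≡ b
  value-C b = ev-C a b

  value-⊗ : ∀ g h → value (g ⊗ h) ≡ value g ℤ.* value h
  value-⊗ = ev-⊗ a

  value-⊕ : ∀ g h → value (g ⊕ h) ≡ value g ℤ.+ value h
  value-⊕ = ev-⊕ a

  value-⊖ : ∀ g → value (⊖ g) ≡ ℤ.- value g
  value-⊖ = ev-⊖ a

  value-^ : ∀ g n → value (g ^ n) ≡ RingIdentities._^_ ℤ.+-*-commutativeRing (value g) n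
  value-^ = ev-^ a

  value-cong : ∀ {g h} → g ≋ h → value g ≡ value h
  value-cong {g} {h} e = ev-cong a {g} {h} e

  value-X : value X ≡ a
  value-X = ev-X a

  value-linear : value linear ≡ 0ℤ
  value-linear = ≡.trans (value-⊕ X (⊖ C a))
          (≡.trans (≡.cong₂ ℤ._+_ value-X (≡.trans (value-⊖ (C a)) (≡.cong ℤ.-_ (value-C a)))) (ℤ.+-inverseʳ a))

-- ℤ[θ] and integral elements inside ℚ[X]/(f)

module Field (f : ℤP.Poly) {n : ℕ} (f-monic : ℤP.MonicOfDegree (suc n) f) where

  open Extension using (embed)
  open ℤP using (_⊕_; _⊗_; ⊖_; C; _≋_; _^_; Degree<; MonicOfDegree)
  private
    module E = Extension
    module Z∣ = Congruence ℤ[X]-ring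
    module Q∣ = Congruence ℚ[X]-ring
    module Q = CommutativeRing ℚ[X]-ring
    module QS = RingSolver ℚ[X]-ring
    module PS = RingSolver ℤ[X]-ring

  𝕂 : CommutativeRing _ _
  𝕂 = Q∣.residueRing (toℚ[X] f)
  module 𝕂 = CommutativeRing 𝕂

  constants𝕂 : Homomorphism ℤ.+-*-commutativeRing 𝕂
  constants𝕂 = record
    { ⟦_⟧ = ⟦_⟧ ; ⟦⟧-cong = λ e → Q∣.≈⇒mod (⟦⟧-cong e) ; 0-homo = Q∣.≈⇒mod 0-homo ; 1-homo = Q∣.≈⇒mod 1-homo
    ; +-homo = λ a b → Q∣.≈⇒mod (+-homo a b) ; *-homo = λ a b → Q∣.≈⇒mod (*-homo a b) }
    where open Homomorphism constants

  module E𝕂 = Evaluation constants𝕂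

  Integral : ℚP.Poly → Set
  Integral x = ∃[ d ] ∃[ h ] (MonicOfDegree d h × E𝕂.ev h x 𝕂.≈ [])

  embed-⊗ : ∀ g h → embed (g ⊗ h) 𝕂.≈ embed g 𝕂.* embed h
  embed-⊗ g h = Q∣.≈⇒mod (E.ev-⊗ ℚP.X g h)

  embed-⊕ : ∀ g h → embed (g ⊕ h) 𝕂.≈ embed g 𝕂.+ embed h
  embed-⊕ g h = Q∣.≈⇒mod (E.ev-⊕ ℚP.X g h)

  embed-cong : ∀ {g h} → g ≋ h → embed g 𝕂.≈ embed h
  embed-cong {g} {h} e = Q∣.≈⇒mod (E.ev-cong ℚP.X {g} {h} e)

  embed-f : embed f 𝕂.≈ []
  embed-f = Q∣.congruent (ℚP.C 1ℚ) (Q.trans {embed f} {toℚ[X] f} {ℚP.C 1ℚ ℚP.⊗ toℚ[X] f}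
    (Q.sym {toℚ[X] f} {embed f} (E.toℚ[X]≋embed f))
            (Q.sym {ℚP.C 1ℚ ℚP.⊗ toℚ[X] f} {toℚ[X] f} (ℚP.⊗-identityˡ (toℚ[X] f))))

  embed-multiple : ∀ q → embed (q ⊗ f) 𝕂.≈ []
  embed-multiple q = 𝕂.trans (embed-⊗ q f) (𝕂.trans (𝕂.*-congˡ {embed q} embed-f) (𝕂.zeroʳ (embed q)))

  -- This is fℚ[X] ∩ ℤ[X] = fℤ[X]. Division by the monic `f` stays over ℤ, and the remainder is
  -- again zero at θ. Over ℚ it is a multiple of `f` of degree below that of `f`, so the multiplier
  -- is zero.
  embed≈0⇒∣ : ∀ g → embed g 𝕂.≈ [] → f Z∣.∣ g
  embed≈0⇒∣ g e = q Z∣., ℤP.≋-sym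
          (ℤP.≋-trans g≋ (ℤP.≋-trans (ℤP.⊕-cong (ℤP.≋-refl {q ⊗ f}) r≋[]) (ℤP.⊕-identityʳ (q ⊗ f))))
    where
    div = ℤP.division (suc n) f f-monic g
    q = proj₁ div
    r = proj₁ (proj₂ div)
    g≋ = proj₁ (proj₂ (proj₂ div))
    r-small = proj₂ (proj₂ (proj₂ div))
    r≈0 : embed r 𝕂.≈ []
    r≈0 = 𝕂.trans (𝕂.sym (𝕂.trans (𝕂.+-congʳ {embed r} (embed-multiple q)) (𝕂.+-identityˡ (embed r))))
      (𝕂.trans (𝕂.sym (embed-⊕ (q ⊗ f) r)) (𝕂.trans (𝕂.sym (embed-cong {g} {q ⊗ f ⊕ r} g≋)) e))
    toℚr≋ : ∀ {s} → embed r ℚP.≋ s ℚP.⊗ toℚ[X] f → toℚ[X] r ℚP.≋ []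
    toℚr≋ {s} e = ℚP.≋-trans e′ (Q.*-congʳ {toℚ[X] f} {s} {[]}
        (ℚP.monic-cancel (suc n) (toℚ[X] f) (E.toℚ[X]-MonicOfDegree (suc n) f f-monic) s
          (ℚP.Degree<-resp e′ (E.toℚ[X]-Degree< (suc n) r r-small))))
      where
      e′ : toℚ[X] r ℚP.≋ s ℚP.⊗ toℚ[X] f
      e′ = ℚP.≋-trans (E.toℚ[X]≋embed r) e
    r≋[] : r ≋ []
    r≋[] = E.toℚ[X]≋[]⇒≋[] r (toℚr≋ {Q∣._≈_mod_.factor r≈0} (Q∣._≈_mod_.equation r≈0))

  integral-relation : ∀ x E U → Integral x → embed E 𝕂.* x 𝕂.≈ embed U → ∃[ d ] ∃[ T ] f Z∣.∣ U ^ d ⊕ E ⊗ T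
  integral-relation x E U (d , h , h-monic , h≈0) e =
    let T , e′ = E𝕂.homogenise ℚP.X x E U e d h h-monic
        ε^d = RingIdentities._^_ 𝕂 (embed E) d
    in d , T , embed≈0⇒∣ (U ^ d ⊕ E ⊗ T) (𝕂.trans (𝕂.sym e′) (𝕂.trans (𝕂.*-congˡ {ε^d} h≈0) (𝕂.zeroʳ ε^d)))

  embed-integral : ∀ g x → x 𝕂.≈ embed g → Integral x
  embed-integral g x e = E𝕂.integral ℚP.X {n} {f} f-monic embed-f g x e

  cancel-scalar : ∀ N .{{_ : ℕ.NonZero N}} x y → embed (C (+ N)) 𝕂.* x 𝕂.≈ embed (C (+ N)) 𝕂.* y → x 𝕂.≈ y
  cancel-scalar N x y e =
    let ρ , ρN≋1 = E.scalar-inverse N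
        ν = embed (C (+ N))
        undo : ∀ z → ρ 𝕂.* (ν 𝕂.* z) 𝕂.≈ z
        undo z = 𝕂.trans (𝕂.sym (𝕂.*-assoc ρ ν z))
                (𝕂.trans (𝕂.*-congʳ {z} {ρ 𝕂.* ν} {𝕂.1#} (Q∣.≈⇒mod ρN≋1)) (𝕂.*-identityˡ z))
    in 𝕂.trans (𝕂.sym (undo x)) (𝕂.trans (𝕂.*-congˡ {ρ} e) (undo y))

  -- The denominator of `x` is `P ⊗ M`, but only divisibility of the error term by `P` matters
  -- later, so `M` moves to the cofactor. It serves with `P` the constant p and with `P` the
  -- cofactor f₁.
  integral-relation₂ : ∀ x P M g → Integral x → embed P 𝕂.* (embed M 𝕂.* x) 𝕂.≈ embed g →
                       ∃[ d ] ∃[ T ] f Z∣.∣ g ^ d ⊕ (M ⊗ T) ⊗ P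
  integral-relation₂ x P M g x-integral e =
    let d , T , f∣ = integral-relation x (P ⊗ M) g x-integral
          (𝕂.trans (𝕂.*-congʳ {x} (embed-⊗ P M)) (𝕂.trans (𝕂.*-assoc (embed P) (embed M) x) e))
    in d , T , Z∣.∣-resp (ℤP.⊕-cong (ℤP.≋-refl {g ^ d})
         (PS.solve 3 (λ P N T → P PS.:* N PS.:* T PS.:= N PS.:* T PS.:* P) ℤP.≋-refl P M T)) f∣

  cofactor-numerator : ∀ P y {g h f₁ g₁ k₁ k₂} → f ≋ h ⊗ f₁ ⊕ k₂ ⊗ P → g ≋ h ⊗ g₁ ⊕ k₁ ⊗ P →
    embed P 𝕂.* y 𝕂.≈ embed g → embed P 𝕂.* (embed f₁ 𝕂.* y) 𝕂.≈ embed P 𝕂.* embed (k₁ ⊗ f₁ ⊕ ⊖ (g₁ ⊗ k₂))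
  cofactor-numerator P y {g} {h} {f₁} {g₁} {k₁} {k₂} ef eg e = begin
      embed P 𝕂.* (embed f₁ 𝕂.* y)
              ≈⟨ Q∣.≈⇒mod (QS.solve 3 (λ π φ y → π QS.:* (φ QS.:* y) QS.:= φ QS.:* (π QS.:* y)) ℚP.≋-refl (embed P)
              (embed f₁) y) ⟩
      embed f₁ 𝕂.* (embed P 𝕂.* y)            ≈⟨ 𝕂.*-congˡ {embed f₁} e ⟩
      embed f₁ 𝕂.* embed g                    ≈⟨ embed-⊗ f₁ g ⟨
      embed (f₁ ⊗ g)
              ≈⟨ embed-cong {f₁ ⊗ g} {g₁ ⊗ f ⊕ P ⊗ u}
              (PrimeElement.cofactor-multiple ℤ[X]-ring {f} {g} {h} {f₁} {g₁} {k₁} {k₂} {P} ef eg) ⟩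
      embed (g₁ ⊗ f ⊕ P ⊗ u)                  ≈⟨ embed-⊕ (g₁ ⊗ f) (P ⊗ u) ⟩
      embed (g₁ ⊗ f) 𝕂.+ embed (P ⊗ u)        ≈⟨ 𝕂.+-cong (embed-multiple g₁) (embed-⊗ P u) ⟩
      𝕂.0# 𝕂.+ embed P 𝕂.* embed u            ≈⟨ 𝕂.+-identityˡ (embed P 𝕂.* embed u) ⟩
      embed P 𝕂.* embed u                     ∎
    where
    open import Relation.Binary.Reasoning.Setoid 𝕂.setoid
    u = k₁ ⊗ f₁ ⊕ ⊖ (g₁ ⊗ k₂)

  ∣-difference⇒embed≈ : ∀ g h → f Z∣.∣ g ⊕ ⊖ h → embed g 𝕂.≈ embed h
  ∣-difference⇒embed≈ g h (q Z∣., e) = begin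
      embed g                          ≈⟨ embed-cong {g} {q ⊗ f ⊕ h} (ℤP.≋-trans
          (PS.solve 2 (λ g h → g PS.:= (g PS.:- h) PS.:+ h) ℤP.≋-refl g h)
          (ℤP.⊕-cong (ℤP.≋-sym e) (ℤP.≋-refl {h}))) ⟩
      embed (q ⊗ f ⊕ h)                ≈⟨ embed-⊕ (q ⊗ f) h ⟩
      embed (q ⊗ f) 𝕂.+ embed h        ≈⟨ 𝕂.+-congʳ {embed h} (embed-multiple q) ⟩
      𝕂.0# 𝕂.+ embed h                 ≈⟨ 𝕂.+-identityˡ (embed h) ⟩
      embed h                          ∎
    where open import Relation.Binary.Reasoning.Setoid 𝕂.setoid

  embed≈⇒∣-difference : ∀ g h → embed g 𝕂.≈ embed h → f Z∣.∣ g ⊕ ⊖ h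
  embed≈⇒∣-difference g h e = embed≈0⇒∣ (g ⊕ ⊖ h) (begin
      embed (g ⊕ ⊖ h)                  ≈⟨ embed-⊕ g (⊖ h) ⟩
      embed g 𝕂.+ embed (⊖ h)          ≈⟨ 𝕂.+-congʳ {embed (⊖ h)} e ⟩
      embed h 𝕂.+ embed (⊖ h)          ≈⟨ embed-⊕ h (⊖ h) ⟨
      embed (h ⊕ ⊖ h)                  ≈⟨ embed-cong {h ⊕ ⊖ h} {[]} (ℤP.⊖-inverseʳ h) ⟩
      embed []                         ∎)
    where open import Relation.Binary.Reasoning.Setoid 𝕂.setoid

  square-quotient : ∀ P w y G → embed P 𝕂.* y 𝕂.≈ embed w → embed (w ⊗ w) 𝕂.≈ embed (P ⊗ (P ⊗ G)) →
                    embed P 𝕂.* (embed P 𝕂.* (y 𝕂.* y)) 𝕂.≈ embed P 𝕂.* (embed P 𝕂.* embed G)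
  square-quotient P w y G e e′ = begin
      embed P 𝕂.* (embed P 𝕂.* (y 𝕂.* y))
        ≈⟨ Q∣.≈⇒mod (QS.solve 2 (λ π y → π QS.:* (π QS.:* (y QS.:* y)) QS.:= (π QS.:* y) QS.:* (π QS.:* y)) ℚP.≋-refl
                (embed P) y) ⟩
      (embed P 𝕂.* y) 𝕂.* (embed P 𝕂.* y)
        ≈⟨ 𝕂.*-cong e e ⟩
      embed w 𝕂.* embed w
        ≈⟨ embed-⊗ w w ⟨
      embed (w ⊗ w)
        ≈⟨ e′ ⟩
      embed (P ⊗ (P ⊗ G))
        ≈⟨ embed-⊗ P (P ⊗ G) ⟩
      embed P 𝕂.* embed (P ⊗ G)
        ≈⟨ 𝕂.*-congˡ {embed P} (embed-⊗ P G) ⟩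
      embed P 𝕂.* (embed P 𝕂.* embed G) ∎
    where open import Relation.Binary.Reasoning.Setoid 𝕂.setoid

  integral-square⇒integral : ∀ y → Integral (y 𝕂.* y) → Integral y
  integral-square⇒integral y (d , h , h-monic , e) =
    d ℕ.+ d , E𝕂.stretch h , E𝕂.MonicOfDegree-stretch d h h-monic , 𝕂.trans (E𝕂.ev-stretch h y) e

  -- With `r` the remainder of `g`, the polynomial w - P r is a multiple of `f` of degree at most
  -- `n`, one less than the degree of `f`, hence zero. So w = P r, and the leading coefficient 1 of
  -- `w` is P times an integer.
  monic-multiple-coefficient : ∀ P w g → MonicOfDegree n w → f Z∣.∣ w ⊕ ⊖ (C P ⊗ g) → ∃[ c ] P ℤ.* c ≡ 1ℤ
  monic-multiple-coefficient P w g (w₁ , w₂) (q Z∣., e) =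
    ℤP.coeff r n , ≡.trans (≡.sym (≡.trans (ℤP.at (ℤP.≋-sym (ℤP.·≋C⊗ P r)) n) (ℤP.coeff-· P r n)))
            (≡.trans (ℤP.at (ℤP.≋-sym w≋) n) w₁)
    where
    div = ℤP.division (suc n) f f-monic g
    q′ = proj₁ div
    r = proj₁ (proj₂ div)
    s = q ⊕ C P ⊗ q′
    sf≋ : s ⊗ f ≋ w ⊕ ⊖ (C P ⊗ r)
    sf≋ = begin
      (q ⊕ C P ⊗ q′) ⊗ f
        ≈⟨ PS.solve 4 (λ q P q′ f → (q PS.:+ P PS.:* q′) PS.:* f PS.:= q PS.:* f PS.:+ P PS.:* (q′ PS.:* f)) ℤP.≋-refl
                q (C P) q′ f ⟩
      q ⊗ f ⊕ C P ⊗ (q′ ⊗ f)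
        ≈⟨ ℤP.⊕-cong e (ℤP.≋-refl {C P ⊗ (q′ ⊗ f)}) ⟩
      w ⊕ ⊖ (C P ⊗ g) ⊕ C P ⊗ (q′ ⊗ f)
        ≈⟨ ℤP.⊕-cong (ℤP.⊕-cong (ℤP.≋-refl {w}) (ℤP.⊖-cong (ℤP.⊗-cong (ℤP.≋-refl {C P}) (proj₁ (proj₂ (proj₂ div))))))
                (ℤP.≋-refl {C P ⊗ (q′ ⊗ f)}) ⟩
      w ⊕ ⊖ (C P ⊗ (q′ ⊗ f ⊕ r)) ⊕ C P ⊗ (q′ ⊗ f)
        ≈⟨ PS.solve 4 (λ w P t r → w PS.:+ PS.:- (P PS.:* (t PS.:+ r)) PS.:+ P PS.:* t PS.:= w PS.:- P PS.:* r)
                ℤP.≋-refl w (C P) (q′ ⊗ f) r ⟩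
      w ⊕ ⊖ (C P ⊗ r) ∎
      where open import Relation.Binary.Reasoning.Setoid (CommutativeRing.setoid ℤ[X]-ring)
    small : Degree< (suc n) (s ⊗ f)
    small = ℤP.Degree<-resp (ℤP.≋-sym sf≋) (ℤP.Degree<-⊕ w (⊖ (C P ⊗ r)) w₂
      (ℤP.Degree<-⊖ (C P ⊗ r) (ℤP.Degree<-⊗ 0 (suc n) (C P) r (ℤP.Degree<-C P) (proj₂ (proj₂ (proj₂ div))))))
    w≋ : w ≋ C P ⊗ r
    w≋ = begin
      w                              ≈⟨ PS.solve 2 (λ w t → w PS.:= (w PS.:- t) PS.:+ t) ℤP.≋-refl w (C P ⊗ r) ⟩
      w ⊕ ⊖ (C P ⊗ r) ⊕ C P ⊗ r      ≈⟨ ℤP.⊕-cong (ℤP.≋-sym sf≋) (ℤP.≋-refl {C P ⊗ r}) ⟩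
      s ⊗ f ⊕ C P ⊗ r
              ≈⟨ ℤP.⊕-cong (ℤP.⊗-cong (ℤP.monic-cancel (suc n) f f-monic s small) (ℤP.≋-refl {f}))
              (ℤP.≋-refl {C P ⊗ r}) ⟩
      C P ⊗ r                        ∎
      where open import Relation.Binary.Reasoning.Setoid (CommutativeRing.setoid ℤ[X]-ring)

-- Removing one prime from a denominator

module LocalStep (f : ℤP.Poly) {n : ℕ} (f-monic : ℤP.MonicOfDegree (suc n) f) {p : ℕ} (pr : Prime p) where

  open ℤP using (Poly; _⊕_; _⊗_; ⊖_; C; _≋_; _^_; ≋-refl; ≋-sym; ≋-trans)
  open PolynomialsModPrime pr using (𝔽[X]; bézout; C-mod)
  open Field f f-monic
  open Extension using (embed)
  open IntegerDivisibility
  private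
    module 𝔽 = CommutativeRing 𝔽[X]
    module 𝔽∣ = Congruence 𝔽[X]
    module 𝔽^ = RingIdentities 𝔽[X]
    module ℤ∣ = Congruence ℤ.+-*-commutativeRing
    module Z∣ = Congruence ℤ[X]-ring
    module P = CommutativeRing ℤ[X]-ring
    module PS = RingSolver ℤ[X]-ring
    instance
      p≢0 = prime⇒nonZero pr

  open IntegerValue

  -- What has to be known about the cofactor f₁ of gcd(f , g) modulo p: either it
  -- is trivial, or all its roots equal one a at which f does not vanish modulo p².
  SquareSingular : Poly → Set
  SquareSingular f₁ = f₁ 𝔽∣.∣ C 1ℤ ⊎
    (∃[ a ] ¬ + p ℤ.* + p ℤ∣.∣ value a f × ∃[ d ] f₁ 𝔽∣.∣ linear a 𝔽^.^ d)

  ∣⇒divides-out : ∀ g y → f 𝔽∣.∣ g → embed (C (+ p)) 𝕂.* y 𝕂.≈ embed g → ∃[ g′ ] y 𝕂.≈ embed g′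
  ∣⇒divides-out g y (q 𝔽∣., Z∣.congruent k e) py≈g = ⊖ k , cancel-scalar p y (embed (⊖ k)) (begin
      embed (C (+ p)) 𝕂.* y                             ≈⟨ py≈g ⟩
      embed g                                           ≈⟨ embed-cong {g} {q ⊗ f ⊕ C (+ p) ⊗ ⊖ k} (≋-trans
          (PS.solve 3 (λ g k p → g PS.:= (g PS.:+ k PS.:* p) PS.:+ p PS.:* (PS.:- k)) ≋-refl g k (C (+ p)))
          (P.+-congʳ {C (+ p) ⊗ ⊖ k} (≋-sym e))) ⟩
      embed (q ⊗ f ⊕ C (+ p) ⊗ ⊖ k)                     ≈⟨ embed-⊕ (q ⊗ f) (C (+ p) ⊗ ⊖ k) ⟩
      embed (q ⊗ f) 𝕂.+ embed (C (+ p) ⊗ ⊖ k)           ≈⟨ 𝕂.+-cong (embed-multiple q) (embed-⊗ (C (+ p)) (⊖ k)) ⟩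
      𝕂.0# 𝕂.+ embed (C (+ p)) 𝕂.* embed (⊖ k)          ≈⟨ 𝕂.+-identityˡ (embed (C (+ p)) 𝕂.* embed (⊖ k)) ⟩
      embed (C (+ p)) 𝕂.* embed (⊖ k)                   ∎)
    where open import Relation.Binary.Reasoning.Setoid 𝕂.setoid

  -- In f₁ = (X - a) w + f₁(a) the constant is invertible modulo p, so `f₁` is comaximal with X - a,
  -- a power of which it divides.
  nonvanishing⇒unit : ∀ a f₁ d → ¬ + p ℤ∣.∣ value a f₁ → f₁ 𝔽∣.∣ linear a 𝔽^.^ d → f₁ 𝔽∣.∣ C 1ℤ
  nonvanishing⇒unit a f₁ d p∤ = 𝔽^.comaximal∧∣^⇒unit {f₁} {linear a} {C u} {⊖ (C u ⊗ w)} d (begin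
      C u ⊗ f₁ ⊕ (⊖ (C u ⊗ w)) ⊗ linear a
        ≈⟨ Z∣.≈⇒mod (P.+-congʳ {(⊖ (C u ⊗ w)) ⊗ linear a} (P.*-congˡ {C u} division)) ⟩
      C u ⊗ (linear a ⊗ w ⊕ C v) ⊕ (⊖ (C u ⊗ w)) ⊗ linear a
        ≈⟨ Z∣.≈⇒mod (PS.solve 4 (λ u l w v → u PS.:* (l PS.:* w PS.:+ v) PS.:+ (PS.:- (u PS.:* w)) PS.:* l PS.:= u
                PS.:* v) ≋-refl (C u) (linear a) w (C v)) ⟩
      C u ⊗ C v
        ≈⟨ Z∣.≈⇒mod (≋-sym (ℤP.C-⊗ u v)) ⟩
      C (u ℤ.* v)
        ≈⟨ C-mod (proj₂ inverse) ⟩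
      C 1ℤ ∎)
    where
    open import Relation.Binary.Reasoning.Setoid 𝔽.setoid
    v = value a f₁
    division = divide-linear a f₁
    w = quotient-linear a f₁
    inverse = inverse-mod-p pr v p∤
    u = proj₁ inverse

  relation⇒𝔽∣ : ∀ {g} d T → f Z∣.∣ g ^ d ⊕ T ⊗ C (+ p) → f 𝔽∣.∣ g 𝔽^.^ d
  relation⇒𝔽∣ {g} d T (q Z∣., e) = q 𝔽∣., ≡.subst (λ t → q ⊗ f 𝔽.≈ t) (≡.sym (Z∣.^-residue (C (+ p)) g d))
          (Z∣.congruent T e)

  module _ (N : ℕ) (x : ℚP.Poly) (x-integral : Integral x) (g : Poly)
           (pNx≈g : embed (C (+ p)) 𝕂.* (embed (C (+ N)) 𝕂.* x) 𝕂.≈ embed g)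
           (b : BézoutData 𝔽[X] f g) where

    open BézoutData b
    open BézoutConsequences 𝔽[X] b

    private
      ν = embed (C (+ N))

    -- Homogenising the equation of `x` with denominator p N gives gᵈ plus a multiple of p, and that
    -- multiple vanishes in `𝔽[X]`.
    f∣g^ : ∃[ d ] f 𝔽∣.∣ g 𝔽^.^ d
    f∣g^ = let d , T , f∣ = integral-relation₂ x (C (+ p)) (C (+ N)) g x-integral pNx≈g
           in d , relation⇒𝔽∣ d (C (+ N) ⊗ T) f∣

    f∣h^ : ∃[ d ] f 𝔽∣.∣ h 𝔽^.^ d
    f∣h^ = let d , e = f∣g^ in d , ∣^⇒∣h^ d e

    k₁ k₂ u : Poly
    k₁ = Z∣._≈_mod_.factor g≈hg₁
    k₂ = Z∣._≈_mod_.factor f≈hf₁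
    u  = k₁ ⊗ f₁ ⊕ ⊖ (g₁ ⊗ k₂)

    f₁Nx≈u : embed f₁ 𝕂.* (ν 𝕂.* x) 𝕂.≈ embed u
    f₁Nx≈u = cancel-scalar p (embed f₁ 𝕂.* (ν 𝕂.* x)) (embed u)
      (cofactor-numerator (C (+ p)) (ν 𝕂.* x) {g} {h} {f₁} {g₁} {k₁} {k₂}
        (Z∣._≈_mod_.equation f≈hf₁) (Z∣._≈_mod_.equation g≈hg₁) pNx≈g)

    -- Evaluation at `a` turns the polynomial relations into the integer ones of `p²∣-value`. The
    -- relation for hᵈ holds modulo p only; the one for `u` holds in ℤ[X] up to a multiple of `f₁`,
    -- because there the denominator of `x` is f₁ N.
    vanishing⇒p²∣ : ∀ a → + p ℤ∣.∣ value a f₁ → + p ℤ.* + p ℤ∣.∣ value a f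
    vanishing⇒p²∣ a = PrimeElement.p²∣-value ℤ.+-*-commutativeRing (+ p) (p∤1 pr) (p∣*⇒ pr) {k₁ = v k₁} {k₃ = v k₃}
            {α = v α} {β = v β} {q₁ = v q₁} {k₄ = v k₄} {q₂ = v q₂} {t = v t} d₁ d₂
        (mod-p f≈hf₁ (value-⊗ a h f₁))
        (≡.trans (≡.cong₂ ℤ._+_ (≡.sym (value-⊗ a α f₁)) (≡.sym (value-⊗ a β g₁)))
          (≡.trans (≡.sym (value-⊕ a (α ⊗ f₁) (β ⊗ g₁))) (mod-p αf₁+βg₁≈1 (value-C a 1ℤ))))
        (≡.trans (≡.sym (value-⊗ a q₁ f))
                (mod-p e₁ (≡.trans (≡.cong v (Z∣.^-residue (C (+ p)) h d₁)) (value-^ a h d₁))))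
        (≡.trans (≡.sym (value-⊗ a q₂ f)) (≡.trans (value-⊕⊗ a {q₂ ⊗ f} {u ^ d₂} {t} {f₁} e₂)
          (≡.cong₂ ℤ._+_ (≡.trans (value-^ a u d₂)
                  (≡.cong (λ w → RingIdentities._^_ ℤ.+-*-commutativeRing w d₂) value-u)) (ℤ.*-comm (v t) (v f₁)))))
      where
      v = value a
      relation₁ = f∣h^
      d₁ = proj₁ relation₁
      q₁ = RawMagma._∣ʳ_.quotient (proj₂ relation₁)
      e₁ : q₁ ⊗ f 𝔽.≈ h 𝔽^.^ d₁
      e₁ = RawMagma._∣ʳ_.equality (proj₂ relation₁)
      relation₂ = integral-relation₂ x f₁ (C (+ N)) u x-integral f₁Nx≈u
      d₂ = proj₁ relation₂
      t = C (+ N) ⊗ proj₁ (proj₂ relation₂)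
      q₂ = RawMagma._∣ʳ_.quotient (proj₂ (proj₂ relation₂))
      e₂ : q₂ ⊗ f ≋ u ^ d₂ ⊕ t ⊗ f₁
      e₂ = RawMagma._∣ʳ_.equality (proj₂ (proj₂ relation₂))
      k₃ = Z∣._≈_mod_.factor αf₁+βg₁≈1
      k₄ = Z∣._≈_mod_.factor e₁
      mod-p : ∀ {g g′ z} (m : g 𝔽.≈ g′) → v g′ ≡ z → v g ≡ z ℤ.+ v (Z∣._≈_mod_.factor m) ℤ.* + p
      mod-p {g} {g′} m e = ≡.trans (value-⊕⊗ a {g} {g′} {Z∣._≈_mod_.factor m} {C (+ p)} (Z∣._≈_mod_.equation m))
        (≡.cong₂ (λ z w → z ℤ.+ v (Z∣._≈_mod_.factor m) ℤ.* w) e (value-C a (+ p)))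
      value-u : v u ≡ v k₁ ℤ.* v f₁ ℤ.+ ℤ.- (v g₁ ℤ.* v k₂)
      value-u = ≡.trans (value-⊕ a (k₁ ⊗ f₁) (⊖ (g₁ ⊗ k₂)))
        (≡.cong₂ ℤ._+_ (value-⊗ a k₁ f₁) (≡.trans (value-⊖ a (g₁ ⊗ k₂)) (≡.cong ℤ.-_ (value-⊗ a g₁ k₂))))

    divides-out : SquareSingular f₁ → ∃[ g′ ] ν 𝕂.* x 𝕂.≈ embed g′
    divides-out (inj₁ f₁∣1) = ∣⇒divides-out g (ν 𝕂.* x) (unit⇒∣ f₁∣1) pNx≈g
    divides-out (inj₂ (a , p²∤ , d , f₁∣)) = [ (λ p∣ → contradiction (vanishing⇒p²∣ a p∣) p²∤)
      , (λ p∤ → ∣⇒divides-out g (ν 𝕂.* x) (unit⇒∣ (nonvanishing⇒unit a f₁ d p∤ f₁∣)) pNx≈g) ]′ (p∣? pr (value a f₁))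

  -- Beyond monicity, the shape of `f` enters through this first hypothesis alone. It is applied to
  -- the gcd and cofactor found by the Euclidean algorithm, for which integrality of `x` supplies f
  -- ∣ hᵈ.
  local-step : (∀ h f₁ d → f 𝔽.≈ h ⊗ f₁ → f 𝔽∣.∣ h 𝔽^.^ d → SquareSingular f₁) →
    ∀ N x → Integral x → ∀ g → embed (C (+ p)) 𝕂.* (embed (C (+ N)) 𝕂.* x) 𝕂.≈ embed g →
    ∃[ g′ ] embed (C (+ N)) 𝕂.* x 𝕂.≈ embed g′
  local-step singular N x x-integral g e = divides-out N x x-integral g e b
      (singular (BézoutData.h b) (BézoutData.f₁ b) (proj₁ relation) (BézoutData.f≈hf₁ b) (proj₂ relation))
    where
    b : BézoutData 𝔽[X] f g
    b = bézout (length g) f g (ℤP.Degree<-length g)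
    relation = f∣h^ N x x-integral g e b

-- From single primes to monogenicity, and an obstruction to it

module Monogenicity (f : ℤP.Poly) {n : ℕ} (f-monic : ℤP.MonicOfDegree (suc n) f) where

  open ℤP using (Poly; _⊕_; _⊗_; ⊖_; C; X; MonicOfDegree)
  open Field f f-monic
  open Extension using (embed)
  private
    module Q∣ = Congruence ℚ[X]-ring
    module Z∣ = Congruence ℤ[X]-ring
    module ℤ∣ = Congruence ℤ.+-*-commutativeRing

  open NumberField f using (_∈ℤ[θ]; _∈𝓞)

  ∈ℤ[θ]⇒ : ∀ {x} → x ∈ℤ[θ] → ∃[ g ] x 𝕂.≈ embed g
  ∈ℤ[θ]⇒ (g , e) = g , Q∣.quotient⇒mod e

  ⇒∈ℤ[θ] : ∀ {x} g → x 𝕂.≈ embed g → x ∈ℤ[θ]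
  ⇒∈ℤ[θ] g e = g , Q∣.mod⇒quotient e

  ∈𝓞⇒ : ∀ {x} → x ∈𝓞 → Integral x
  ∈𝓞⇒ (h , (d , h₁ , h₂) , e) = d , h , (h₁ , h₂) , Q∣.quotient⇒mod e

  ⇒∈𝓞 : ∀ {x} → Integral x → x ∈𝓞
  ⇒∈𝓞 (d , h , (h₁ , h₂) , e) = h , (d , h₁ , h₂) , Q∣.mod⇒quotient e

  PrimeStep : ℕ → Set
  PrimeStep p = ∀ N x → Integral x → ∀ g → embed (C (+ p)) 𝕂.* (embed (C (+ N)) 𝕂.* x) 𝕂.≈ embed g →
                ∃[ g′ ] embed (C (+ N)) 𝕂.* x 𝕂.≈ embed g′

  module _ (step : ∀ p → Prime p → PrimeStep p) where

    -- The integral element `x` never changes: each prime trades a numerator of p M x for one of M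
    -- x. This is why `PrimeStep` carries the extra factor `N`.
    clear-denominator : ∀ ps → All Prime ps → ∀ x → Integral x → ∀ g →
                        embed (C (+ product ps)) 𝕂.* x 𝕂.≈ embed g → ∃[ g′ ] x 𝕂.≈ embed g′
    clear-denominator []       []         x x-integral g e =
      g , 𝕂.trans (𝕂.sym (𝕂.trans (𝕂.*-congʳ {x} {embed (C 1ℤ)} {𝕂.1#} (Q∣.≈⇒mod (Extension.ev-C ℚP.X 1ℤ)))
              (𝕂.*-identityˡ x))) e
    clear-denominator (p ∷ ps) (pr ∷ prs) x x-integral g e =
      let M = product ps
          g′ , e′ = step p pr M x x-integral g (𝕂.trans (𝕂.sym (𝕂.trans
            (𝕂.*-congʳ {x} (𝕂.trans (𝕂.reflexive (≡.cong (λ k → embed (C k)) (ℤ.pos-* p M)))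
                    (Q∣.≈⇒mod (Extension.embed-C-* (+ p) (+ M)))))
            (𝕂.*-assoc (embed (C (+ p))) (embed (C (+ M))) x))) e)
      in clear-denominator ps prs x x-integral g′ e′

    monogenic : Monogenic f
    monogenic x = mk⇔
      (λ x∈ → let g , e = ∈ℤ[θ]⇒ {x} x∈ in ⇒∈𝓞 {x} (embed-integral g x e))
      (λ x∈ → let N , g , e = Extension.common-denominator x
                  module F = PrimeFactorisation (factorise (suc N))
                  g′ , e′ = clear-denominator F.factors F.factorsPrime x (∈𝓞⇒ {x} x∈) g
                    (𝕂.trans (𝕂.reflexive (≡.cong (λ k → embed (C (+ k)) 𝕂.* x) (≡.sym F.isFactorisation)))
                            (Q∣.≈⇒mod e))
              in ⇒∈ℤ[θ] {x} g′ e′)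

  module _ {p : ℕ} (pr : Prime p) (w G : Poly) (w-monic : MonicOfDegree n w)
           (f∣w²-p²G : f Z∣.∣ w ⊗ w ⊕ ⊖ (C (+ p) ⊗ (C (+ p) ⊗ G))) where

    private
      instance
        p≢0 = prime⇒nonZero pr
      inverse = Extension.scalar-inverse p
      ρ = proj₁ inverse
      π = embed (C (+ p))
      y = ρ 𝕂.* embed w

      πy≈w : π 𝕂.* y 𝕂.≈ embed w
      πy≈w = 𝕂.trans (𝕂.sym (𝕂.*-assoc π ρ (embed w)))
        (𝕂.trans (𝕂.*-congʳ {embed w} {π 𝕂.* ρ} {𝕂.1#} (𝕂.trans (𝕂.*-comm π ρ) (Q∣.≈⇒mod (proj₂ inverse))))
                (𝕂.*-identityˡ (embed w)))

      y²≈G : y 𝕂.* y 𝕂.≈ embed G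
      y²≈G = cancel-scalar p (y 𝕂.* y) (embed G) (cancel-scalar p (π 𝕂.* (y 𝕂.* y)) (π 𝕂.* embed G)
        (square-quotient (C (+ p)) w y G πy≈w (∣-difference⇒embed≈ (w ⊗ w) (C (+ p) ⊗ (C (+ p) ⊗ G)) f∣w²-p²G)))

    -- For y = w(θ)/p the square y² = G(θ) is integral, hence so is y. If y were g(θ), then w - p g
    -- would be a multiple of `f`, and p would divide the leading coefficient of `w`.
    divisible-square⇒¬monogenic : ¬ Monogenic f
    divisible-square⇒¬monogenic mono =
      let g , y≈g = ∈ℤ[θ]⇒ {y} (Equivalence.from (mono y) (⇒∈𝓞 {y}
            (integral-square⇒integral y (embed-integral G (y 𝕂.* y) y²≈G))))
          c , pc≡1 = monic-multiple-coefficient (+ p) w g w-monic (embed≈⇒∣-difference w (C (+ p) ⊗ g)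
            (𝕂.trans (𝕂.sym πy≈w) (𝕂.trans (𝕂.*-congˡ {π} y≈g) (𝕂.sym (embed-⊗ (C (+ p)) g)))))
      in IntegerDivisibility.p∤1 pr (c ℤ∣., ≡.trans (ℤ.*-comm c (+ p)) pc≡1)

-- Derivatives of powers

module _ where
  open ℤP
  private
    module P = CommutativeRing ℤ[X]-ring
    module PS = RingSolver ℤ[X]-ring

  deriv-C : ∀ a → deriv (C a) ≋ []
  deriv-C a = 0∷[]≋[]

  deriv-C⊗ : ∀ a p → deriv (C a ⊗ p) ≋ C a ⊗ deriv p
  deriv-C⊗ a p = ≋-trans (deriv-⊗ (C a) p) (P.+-congʳ {C a ⊗ deriv p} (P.*-congʳ {p} {deriv (C a)} {[]} (deriv-C a)))

  deriv-X : deriv X ≋ C 1ℤ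
  deriv-X = mk≋ λ { zero → ≡.refl ; (suc zero) → ≡.refl ; (suc (suc k)) → ≡.refl }

  -- The additional factor `p` avoids the exponent k - 1, so k = 0 is no exception.
  deriv-power : ∀ p k → p ⊗ deriv (p ^ k) ≋ C (+ k) ⊗ p ^ k ⊗ deriv p
  deriv-power p zero    = ≋-trans (P.*-congˡ {p} (deriv-C 1ℤ)) (≋-trans (⊗-zeroʳ p)
    (≋-sym (P.*-congʳ {deriv p} (≋-trans (P.*-congʳ {C 1ℤ} {C 0ℤ} {[]} 0∷[]≋[]) (≋-refl {[]})))))
  deriv-power p (suc k) = begin
    p ⊗ deriv (p ⊗ p ^ k)
      ≈⟨ P.*-congˡ {p} (deriv-⊗ p (p ^ k)) ⟩
    p ⊗ (deriv p ⊗ p ^ k ⊕ p ⊗ deriv (p ^ k))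
      ≈⟨ P.*-congˡ {p} (P.+-congˡ {deriv p ⊗ p ^ k} (deriv-power p k)) ⟩
    p ⊗ (deriv p ⊗ p ^ k ⊕ C (+ k) ⊗ p ^ k ⊗ deriv p)
      ≈⟨ PS.solve 4 (λ p d pk k → p PS.:* (d PS.:* pk PS.:+ k PS.:* pk PS.:* d) PS.:= (PS.:1 PS.:+ k) PS.:*
              (p PS.:* pk) PS.:* d) ≋-refl p (deriv p) (p ^ k) (C (+ k)) ⟩
    C (+ suc k) ⊗ (p ⊗ p ^ k) ⊗ deriv p ∎
    where open import Relation.Binary.Reasoning.Setoid P.setoid

-- The trinomial Xⁿ + A(BX+1)ᵐ

module Trinomial (m₀ N₀ : ℕ) (A B : ℤ) where

  open ℤP
  private
    module P = CommutativeRing ℤ[X]-ring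

  -- N is the paper's n - m.
  m N n : ℕ
  m = suc m₀
  N = suc N₀
  n = m ℕ.+ N

  v : ℤ
  v = + N ℤ.* B

  f b L : Poly
  f = fPoly n m A B
  b = C B ⊗ X ⊕ C 1ℤ
  L = C (+ N) ⊗ C B ⊗ X ⊕ C (+ n)

  f≋ : f ≋ X ^ n ⊕ C A ⊗ b ^ m
  f≋ = ≋-refl

  Degree<-b : Degree< 2 b
  Degree<-b = Degree<-⊕ (C B ⊗ X) (C 1ℤ) (Degree<-⊗ 0 2 (C B) X (Degree<-C B) (proj₂ (MonicOfDegree-X^′)))
          (Degree<-mono {p = C 1ℤ} (s≤s z≤n) (Degree<-C 1ℤ))
    where
    MonicOfDegree-X^′ : MonicOfDegree 1 X
    MonicOfDegree-X^′ = ≡.refl , Degree<-∷ (Degree<-∷ (Degree<-[] 0))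

  f-monic : MonicOfDegree n f
  f-monic = MonicOfDegree-⊕ n (X ^ n) (C A ⊗ b ^ m) (MonicOfDegree-X^ n)
    (Degree<-⊗ 0 n (C A) (b ^ m) (Degree<-C A)
            (Degree<-mono {p = b ^ m} (ℕ.m<m+n m (s≤s z≤n)) (Degree<-^ m b Degree<-b)))

  deriv-b : deriv b ≋ C B
  deriv-b = ≋-trans (deriv-⊕ (C B ⊗ X) (C 1ℤ)) (≋-trans (P.+-cong {deriv (C B ⊗ X)} {C B} {deriv (C 1ℤ)} {[]}
    (≋-trans (deriv-C⊗ B X) (≋-trans (P.*-congˡ {C B} deriv-X) (⊗-identityʳ (C B)))) (deriv-C 1ℤ)) (⊕-identityʳ (C B)))

  deriv-f : X ⊗ b ⊗ deriv f ≋ C (+ n) ⊗ b ⊗ f ⊕ ⊖ (C A ⊗ b ^ m ⊗ L)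
  deriv-f = RingIdentities.logarithmic-derivative ℤ[X]-ring {f} {deriv f} {X ^ n} {deriv (X ^ n)} {b ^ m}
          {deriv (b ^ m)} {X} {b} {C A} {C B} {L} {C (+ n)} {C (+ m)} {C (+ N)}
    (≋-trans (deriv-power X n) (≋-trans (P.*-congˡ {C (+ n) ⊗ X ^ n} deriv-X) (⊗-identityʳ (C (+ n) ⊗ X ^ n))))
    (≋-trans (deriv-power b m) (P.*-congˡ {C (+ m) ⊗ b ^ m} deriv-b))
    f≋
    (≋-trans (deriv-⊕ (X ^ n) (C A ⊗ b ^ m)) (P.+-congˡ {deriv (X ^ n)} (deriv-C⊗ A (b ^ m))))
    ≋-refl ≋-refl ≋-refl

module TrinomialValues (m₀ N₀ : ℕ) (A B : ℤ) where

  open Trinomial m₀ N₀ A B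
  open import Data.Integer.Base using (_+_; _*_; -_; -1ℤ)
  open RingIdentities ℤ.+-*-commutativeRing using (_^_; -1^²)
  open Congruence ℤ.+-*-commutativeRing
  open IntegerDivisibility
  open IntegerValue

  discriminant : ℤ
  discriminant = D n m A B

  A-coefficient : ℤ
  A-coefficient = -1ℤ ^ (n ℕ.+ m) * B ^ n * (+ N) ^ N * (+ m) ^ m

  discriminant≡ : discriminant ≡ (+ n) ^ n + A-coefficient * A
  discriminant≡ = ≡.trans
    (≡.cong (λ k → (+ n) ℤ.^ n + -1ℤ ℤ.^ (n ℕ.+ m) * B ℤ.^ n * (+ k) ℤ.^ k * (+ m) ℤ.^ m * A) (ℕ.m+n∸m≡n m N))
    (≡.sym (≡.cong₂ _+_ (^≡^ (+ n) n)
            (≡.cong (_* A) (≡.cong₂ _*_ (≡.cong₂ _*_ (≡.cong₂ _*_ (^≡^ -1ℤ (n ℕ.+ m)) (^≡^ B n)) (^≡^ (+ N) N))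
            (^≡^ (+ m) m)))))

  value-b : ∀ a → value a b ≡ B * a + 1ℤ
  value-b a = ≡.trans (value-⊕ a (ℤP.C B ℤP.⊗ ℤP.X) (ℤP.C 1ℤ))
    (≡.cong₂ _+_ (≡.trans (value-⊗ a (ℤP.C B) ℤP.X) (≡.cong₂ _*_ (value-C a B) (value-X a))) (value-C a 1ℤ))

  value-f : ∀ a → value a f ≡ a ^ n + A * (B * a + 1ℤ) ^ m
  value-f a = ≡.trans (value-⊕ a (ℤP.X ℤP.^ n) (ℤP.C A ℤP.⊗ b ℤP.^ m))
    (≡.cong₂ _+_ (≡.trans (value-^ a ℤP.X n) (≡.cong (_^ n) (value-X a)))
      (≡.trans (value-⊗ a (ℤP.C A) (b ℤP.^ m))
              (≡.cong₂ _*_ (value-C a A) (≡.trans (value-^ a b m) (≡.cong (_^ m) (value-b a))))))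

  value-f-0 : value 0ℤ f ≡ A
  value-f-0 = ≡.trans (value-f 0ℤ) (≡.trans (ℤ.+-identityˡ (A * (B * 0ℤ + 1ℤ) ^ m))
    (≡.trans (≡.cong (λ t → A * (t + 1ℤ) ^ m) (ℤ.*-zeroʳ B))
            (≡.trans (≡.cong (A *_) (RingIdentities.1^ ℤ.+-*-commutativeRing m)) (ℤ.*-identityʳ A))))

  -- a represents the critical point -n/v = -n/((n-m)B) modulo P.
  value-f-critical : ∀ P a → v * a ≈ - + n mod P → v ^ n * value a f ≈ (- 1ℤ) ^ n * discriminant mod P
  value-f-critical P a va≈-n = ≡.subst₂ (λ s t → s ≈ t mod P)
    (≡.cong₂ _*_ (r v n) (≡.trans (≡.cong₂ _+_ (r a n) (≡.cong (A *_) (r (B * a + 1ℤ) m))) (≡.sym (value-f a))))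
    (≡.cong₂ _*_ (r (- 1ℤ) n) (≡.trans (≡.cong₂ _+_ (r (+ n) n) (≡.cong (_* A) (≡.cong₂ _*_ (≡.cong₂ _*_
      (≡.cong₂ _*_ (r (- 1ℤ) (n ℕ.+ m)) (r B n)) (r (+ N) N)) (r (+ m) m)))) (≡.sym discriminant≡)))
    (RingIdentities.critical-value (residueRing P) m N {A} {B} {a} {+ n} {+ m} {+ N} {v} (≈⇒mod (ℤ.pos-+ m N))
            (≈⇒mod ≡.refl) va≈-n)
    where r = ^-residue P

  square∣value⇒square∣discriminant : ∀ P a → v * a ≈ - + n mod P → P ∣ value a f → P ∣ discriminant
  square∣value⇒square∣discriminant P a va≈-n d =
    ∣-resp (≡.trans (≡.sym (ℤ.*-assoc ε ε discriminant))
            (≡.trans (≡.cong (_* discriminant) (-1^² n)) (ℤ.*-identityˡ discriminant)))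
      (∣-*ˡ ε (∣-mod (value-f-critical P a va≈-n) (∣-*ˡ (v ^ n) d)))
    where ε = (- 1ℤ) ^ n

  module _ {p : ℕ} (pr : Prime p) where

    -- As n = m + N, a prime dividing both n and N divides m.
    p∣n⇒p∤v : (+ p ∣ + n → ¬ + p ∣ + m * B) → + p ∣ + n → ¬ + p ∣ v
    p∣n⇒p∤v p∤mB p∣n p∣v =
      [ (λ p∣N → p∤mB p∣n (∣-*ʳ {x = + m} B (∣-+-cancelʳ {x = + m} {+ N} (∣-resp (ℤ.pos-+ m N) p∣n) p∣N)))
      , (λ p∣B → p∤mB p∣n (∣-*ˡ (+ m) p∣B)) ]′ (p∣*⇒ pr (+ N) B p∣v)

    p∣A-coefficient⇒ : + p ∣ A-coefficient → + p ∣ v ⊎ + p ∣ + m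
    p∣A-coefficient⇒ d =
      [ (λ d₁ → [ (λ d₂ → [ (λ p∣ε → contradiction (∣-neg (p∣^⇒ pr -1ℤ (n ℕ.+ m) p∣ε)) (p∤1 pr))
                          , (λ p∣B^ → inj₁ (∣-*ˡ (+ N) (p∣^⇒ pr B n p∣B^))) ]′ (p∣*⇒ pr (-1ℤ ^ (n ℕ.+ m)) (B ^ n) d₂))
                , (λ p∣N^ → inj₁ (∣-*ʳ {x = + N} B (p∣^⇒ pr (+ N) N p∣N^))) ]′
                        (p∣*⇒ pr (-1ℤ ^ (n ℕ.+ m) * B ^ n) ((+ N) ^ N) d₁))
      , (λ p∣m^ → inj₂ (p∣^⇒ pr (+ m) m p∣m^)) ]′ (p∣*⇒ pr (-1ℤ ^ (n ℕ.+ m) * B ^ n * (+ N) ^ N) ((+ m) ^ m) d)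

    ⇒p∣A-coefficient : + p ∣ v ⊎ + p ∣ + m → + p ∣ A-coefficient
    ⇒p∣A-coefficient (inj₂ p∣m) = ∣-*ˡ (-1ℤ ^ (n ℕ.+ m) * B ^ n * (+ N) ^ N) (∣-*ʳ {x = + m} ((+ m) ^ m₀) p∣m)
    ⇒p∣A-coefficient (inj₁ p∣v) = ∣-*ʳ {x = -1ℤ ^ (n ℕ.+ m) * B ^ n * (+ N) ^ N} ((+ m) ^ m)
      ([ (λ p∣N → ∣-*ˡ (-1ℤ ^ (n ℕ.+ m) * B ^ n) (∣-*ʳ {x = + N} ((+ N) ^ N₀) p∣N))
       , (λ p∣B → ∣-*ʳ {x = -1ℤ ^ (n ℕ.+ m) * B ^ n} ((+ N) ^ N)
               (∣-*ˡ (-1ℤ ^ (n ℕ.+ m)) (∣-*ʳ {x = B} (B ^ (m₀ ℕ.+ N)) p∣B))) ]′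
       (p∣*⇒ pr (+ N) B p∣v))

-- Repeated factors of the trinomial modulo p

module _ (m₀ N₀ : ℕ) (A B : ℤ) {p : ℕ} (pr : Prime p) where

  open Trinomial m₀ N₀ A B
  open TrinomialValues m₀ N₀ A B
  open ℤP using (Poly; _⊕_; _⊗_; ⊖_; C; X; _≋_; _^_; ≋-sym; ≋-trans; deriv)
  open PolynomialsModPrime pr using (𝔽[X]; C-mod; C⊗-mod0)
  open IntegerDivisibility
  open IntegerValue
  open LocalStep f f-monic pr using (SquareSingular)
  private
    module 𝔽 = CommutativeRing 𝔽[X]
    module 𝔽∣ = Congruence 𝔽[X]
    module 𝔽^ = RingIdentities 𝔽[X]
    module ℤ∣ = Congruence ℤ.+-*-commutativeRing
    module Z∣ = Congruence ℤ[X]-ring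
    module P = CommutativeRing ℤ[X]-ring
    P² = + p ℤ.* + p

  𝔽^≡ : ∀ g d → g 𝔽^.^ d ≡ g ^ d
  𝔽^≡ = Z∣.^-residue (C (+ p))

  deriv-mod : ∀ g h → g 𝔽.≈ h → deriv g 𝔽.≈ deriv h
  deriv-mod g h (Z∣.congruent k e) = Z∣.congruent (deriv k) (begin
    deriv g                                               ≈⟨ ℤP.deriv-cong e ⟩
    deriv (h ⊕ k ⊗ C (+ p))                               ≈⟨ ℤP.deriv-⊕ h (k ⊗ C (+ p)) ⟩
    deriv h ⊕ deriv (k ⊗ C (+ p))                         ≈⟨ P.+-congˡ {deriv h} (ℤP.deriv-⊗ k (C (+ p))) ⟩
    deriv h ⊕ (deriv k ⊗ C (+ p) ⊕ k ⊗ deriv (C (+ p)))   ≈⟨ P.+-congˡ {deriv h} (P.+-congˡ {deriv k ⊗ C (+ p)}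
                                                               (≋-trans (P.*-congˡ {k} (deriv-C (+ p)))
                                                                       (ℤP.⊗-zeroʳ k))) ⟩
    deriv h ⊕ (deriv k ⊗ C (+ p) ⊕ [])                    ≈⟨ P.+-congˡ {deriv h} (ℤP.⊕-identityʳ (deriv k ⊗ C (+ p))) ⟩
    deriv h ⊕ deriv k ⊗ C (+ p)                           ∎)
    where open import Relation.Binary.Reasoning.Setoid P.setoid

  module _ (p∣n⇒p∤mB : + p ℤ∣.∣ + n → ¬ + p ℤ∣.∣ + m ℤ.* B)
           (p²∤A : ¬ P² ℤ∣.∣ A) (p²∤D : ¬ P² ℤ∣.∣ discriminant)
           (h f₁ : Poly) (d : ℕ) (f≈hf₁ : f 𝔽.≈ h ⊗ f₁) (f∣h^ : f 𝔽∣.∣ h 𝔽^.^ d) where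

    f₁∣f : f₁ 𝔽∣.∣ f
    f₁∣f = h 𝔽∣., 𝔽.sym f≈hf₁

    singular-p∣A : + p ℤ∣.∣ A → SquareSingular f₁
    singular-p∣A p∣A = inj₂ (0ℤ , (λ p²∣ → p²∤A (ℤ∣.∣-resp value-f-0 p²∣)) , n , 𝔽∣.∣-resp f≈ f₁∣f)
      where
      f≈ : f 𝔽.≈ linear 0ℤ 𝔽^.^ n
      f≈ = 𝔽.trans (𝔽.+-congˡ {X ^ n} (C⊗-mod0 (b ^ m) (ℤ∣.∣⇒mod0 p∣A)))
        (𝔽.trans (Z∣.≈⇒mod (≋-trans (ℤP.⊕-identityʳ (X ^ n)) (≋-sym (ℤP.^-congˡ n linear≋X))))
          (𝔽.reflexive (≡.sym (𝔽^≡ (linear 0ℤ) n))))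
        where
        linear≋X : linear 0ℤ ≋ X
        linear≋X = ≋-trans (P.+-congˡ {X} (ℤP.⊖-cong ℤP.0∷[]≋[])) (ℤP.⊕-identityʳ X)

    module _ (p∤A : ¬ + p ℤ∣.∣ A) where

      -- The product rule puts f′ into the ideal (f₁ , h), and since A and b are units there, `L`
      -- follows. Modulo `f₁` the power Lᵈ is thus a multiple of hᵈ, which `f₁` divides by way of
      -- `f`.
      f₁∣L^ : f₁ 𝔽∣.∣ L 𝔽^.^ d
      f₁∣L^ =
        let A′ , A′A = inverse-mod-p pr A p∤A
            x , y , comaximal = 𝔽^.trinomial-comaximal n m₀ {C A} {C B} {X} {b} {f} 𝔽.refl
              (𝔽.reflexive (≡.sym (≡.cong₂ (λ s t → s ⊕ C A ⊗ t) (𝔽^≡ X n) (𝔽^≡ b m))))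
            s , t , L≈ = 𝔽^.critical-combination m {C A} {C A′} {X} {L} {C (+ n)} {b} {f} {deriv f} {h} {deriv h} {f₁}
                    {deriv f₁} {x} {y}
              (𝔽.trans (Z∣.≈⇒mod (≋-sym (ℤP.C-⊗ A′ A))) (C-mod A′A)) comaximal
              (𝔽.trans (Z∣.≈⇒mod deriv-f)
                      (𝔽.reflexive (≡.cong (λ t → C (+ n) ⊗ b ⊗ f ⊕ ⊖ (C A ⊗ t ⊗ L)) (≡.sym (𝔽^≡ b m)))))
              f≈hf₁ (𝔽.trans (deriv-mod f (h ⊗ f₁) f≈hf₁) (Z∣.≈⇒mod (ℤP.deriv-⊗ h f₁)))
        in 𝔽^.∣-^-combination {f₁} {h} {L} {s} {t} d L≈ (𝔽∣.∣-trans f₁∣f f∣h^)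

      singular-p∣v : + p ℤ∣.∣ v → SquareSingular f₁
      singular-p∣v p∣v =
        let w , wn = inverse-mod-p pr (+ n) p∤n
        in inj₁ (𝔽^.comaximal∧∣^⇒unit {f₁} {L} {[]} {C w} d
          (𝔽.trans (𝔽.*-congˡ {C w} L≈n) (𝔽.trans (Z∣.≈⇒mod (≋-sym (ℤP.C-⊗ w (+ n)))) (C-mod wn))) f₁∣L^)
        where
        p∤n : ¬ + p ℤ∣.∣ + n
        p∤n p∣n = p∣n⇒p∤v pr p∣n⇒p∤mB p∣n p∣v
        L≈n : L 𝔽.≈ C (+ n)
        L≈n = 𝔽.trans (𝔽.+-congʳ {C (+ n)}
                (𝔽.trans (Z∣.≈⇒mod (P.*-congʳ {X} (≋-sym (ℤP.C-⊗ (+ N) B)))) (C⊗-mod0 X (ℤ∣.∣⇒mod0 p∣v))))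
          (𝔽.+-identityˡ (C (+ n)))

      singular-p∤v : ¬ + p ℤ∣.∣ v → SquareSingular f₁
      singular-p∤v p∤v =
        inj₂ (a , (λ p²∣ → p²∤D (square∣value⇒square∣discriminant P² a va≈-n p²∣)) , d ,
          𝔽^.∣-^-combination {f₁} {L} {linear a} {[]} {C w′} d
                  (𝔽∣.monic-linear {L} {C v} {C w′} {X} {C (+ n)} {C a} L≈ n≈ w′v) f₁∣L^)
        where
        inverse = inverse-mod-p² pr v p∤v
        a = ℤ.- (proj₁ inverse ℤ.* + n)
        va≈-n : v ℤ.* a ℤ∣.≈ ℤ.- + n mod P²
        va≈-n = ℤ∣.solve-linear {P²} {proj₁ inverse} {v} (+ n) (proj₂ inverse)
        -- Two precisions are needed: `a` has to be the critical point modulo p² for f(a) to see p²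
        -- ∣ D, whereas the comparison of `L` with X - a takes place modulo p.
        inverse′ = inverse-mod-p pr v p∤v
        w′ = proj₁ inverse′
        w′v : C w′ ⊗ C v 𝔽.≈ C 1ℤ
        w′v = 𝔽.trans (Z∣.≈⇒mod (≋-sym (ℤP.C-⊗ w′ v))) (C-mod (proj₂ inverse′))
        L≈ : L 𝔽.≈ C v ⊗ X ⊕ C (+ n)
        L≈ = Z∣.≈⇒mod (P.+-congʳ {C (+ n)} (P.*-congʳ {X} (≋-sym (ℤP.C-⊗ (+ N) B))))
        module ℤp = CommutativeRing (ℤ∣.residueRing (+ p))
        n≈ : C (+ n) 𝔽.≈ ⊖ (C v ⊗ C a)
        n≈ = 𝔽.trans (C-mod { + n} {ℤ.- (v ℤ.* a)} (ℤp.trans (ℤp.reflexive (≡.sym (ℤ.neg-involutive (+ n))))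
               (ℤp.-‿cong (ℤp.sym (ℤ∣.mod-square⇒mod va≈-n)))))
          (Z∣.≈⇒mod (ℤP.⊖-cong (ℤP.C-⊗ v a)))

    singular : SquareSingular f₁
    singular = [ singular-p∣A , (λ p∤A → [ singular-p∣v p∤A , singular-p∤v p∤A ]′ (p∣? pr v)) ]′ (p∣? pr A)

-- Failure of monogenicity when p² divides A or D

module Converse (m₀ N₀ : ℕ) (A B : ℤ) {p : ℕ} (pr : Prime p) where

  open Trinomial m₀ N₀ A B
  open TrinomialValues m₀ N₀ A B
  open ℤP using (_⊕_; _⊗_; ⊖_; C; X; _≋_; ≋-refl; ≋-sym; ≋-trans; deriv)
  open Monogenicity f f-monic using (divisible-square⇒¬monogenic)
  open IntegerDivisibility
  open IntegerValue
  open Congruence ℤ.+-*-commutativeRing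
  open RingIdentities ℤ.+-*-commutativeRing using (_^_)
  open import Data.Integer.Base using (_+_; _*_; -_)
  private
    module Z∣ = Congruence ℤ[X]-ring
    module P = CommutativeRing ℤ[X]-ring
    module PS = RingSolver ℤ[X]-ring
    module ℤS = RingSolver ℤ.+-*-commutativeRing
    P² = + p * + p

  C-square : ∀ q {c} → q * P² ≡ c → C q ⊗ (C (+ p) ⊗ C (+ p)) ≋ C c
  C-square q {c} e = ≋-trans (P.*-congˡ {C q} (≋-sym (ℤP.C-⊗ (+ p) (+ p))))
          (≋-trans (≋-sym (ℤP.C-⊗ q P²)) (ℤP.C-cong e))

  p²∣A⇒¬monogenic : P² ∣ A → ¬ Monogenic f
  p²∣A⇒¬monogenic (A′ , e) = divisible-square⇒¬monogenic pr w (⊖ (C A′ ⊗ y ⊗ b ℤP.^ m)) (ℤP.MonicOfDegree-X^ (m₀ ℕ.+ N))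
      (Z∣.nilpotent-witness {f} {C A} {C A′} {C (+ p)} {b ℤP.^ m} {X ℤP.^ n} {w} {y} f≋
        (≋-trans (PS.solve 3 (λ X w y → X PS.:* w PS.:* y PS.:= w PS.:* (X PS.:* y)) ≋-refl X w y)
          (P.*-congˡ {w} {X ⊗ y} {w} (P.reflexive (≡.cong (X ℤP.^_) (≡.sym (ℕ.+-suc m₀ N₀))))))
        (C-square A′ e))
    where
    -- The exponents of `w` and `y` are n - 1 and n - 2, so that Xⁿ y = w².
    w = X ℤP.^ (m₀ ℕ.+ N)
    y = X ℤP.^ (m₀ ℕ.+ N₀)

  -- Differentiating f = (X - a) w + f(a) and setting X = a leaves w(a). Thus f′(a) is the remainder
  -- of a second division by X - a.
  value-deriv : ∀ a → value a (deriv f) ≡ value a (quotient-linear a f)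
  value-deriv a = ≡.trans (value-cong a {deriv f} {deriv l ⊗ w ⊕ l ⊗ deriv w}
          (≋-trans (ℤP.deriv-cong (divide-linear a f))
      (≋-trans (ℤP.deriv-⊕ (l ⊗ w) (C c))
              (≋-trans (P.+-cong {deriv (l ⊗ w)} {deriv l ⊗ w ⊕ l ⊗ deriv w} {deriv (C c)} {[]}
        (ℤP.deriv-⊗ l w) (deriv-C c)) (ℤP.⊕-identityʳ (deriv l ⊗ w ⊕ l ⊗ deriv w))))))
    (≡.trans (value-⊕ a (deriv l ⊗ w) (l ⊗ deriv w))
      (≡.trans (≡.cong₂ _+_
        (≡.trans (value-⊗ a (deriv l) w) (≡.cong (_* value a w) value-l′))
        (≡.trans (value-⊗ a l (deriv w)) (≡.cong (_* value a (deriv w)) (value-linear a))))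
        (≡.trans (ℤ.+-identityʳ (1ℤ * value a w)) (ℤ.*-identityˡ (value a w)))))
    where
    l = linear a
    w = quotient-linear a f
    c = value a f
    value-l′ : value a (deriv l) ≡ 1ℤ
    value-l′ = ≡.trans (value-cong a {deriv l} {C 1ℤ} (≋-trans (ℤP.deriv-⊕ X (⊖ C a))
      (≋-trans (P.+-cong {deriv X} {C 1ℤ} {deriv (⊖ C a)} {[]} deriv-X (deriv-C (- a))) (ℤP.⊕-identityʳ (C 1ℤ)))))
              (value-C a 1ℤ)

  -- The two successive remainders on division by X - a are f(a) and f′(a). With both divisible by
  -- p², the square of the quotient `w` is p² times an integer polynomial modulo `f`.
  double-root⇒¬monogenic : ∀ a → P² ∣ value a f → P² ∣ value a (deriv f) → ¬ Monogenic f
  double-root⇒¬monogenic a (F , eF) (W , eW) = divisible-square⇒¬monogenic pr w (C W ⊗ w ⊕ ⊖ (C F ⊗ s))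
      (MonicOfDegree-quotient-linear a (m₀ ℕ.+ N) f f-monic)
      (Z∣.double-root-witness {f} {linear a} {w} {s} {C (value a f)} {C (value a w)} {C F} {C W} {C (+ p)}
        (divide-linear a f) (divide-linear a w) (C-square F eF) (C-square W (≡.trans eW (value-deriv a))))
    where
    w = quotient-linear a f
    s = quotient-linear a w

  value-deriv-f : ∀ a → a * (B * a + 1ℤ) * value a (deriv f)
                      ≡ + n * (B * a + 1ℤ) * value a f + - (A * (B * a + 1ℤ) ^ m * (v * a + + n))
  value-deriv-f a = ≡.trans (≡.sym (≡.trans (value-⊗ a (X ⊗ b) (deriv f)) (≡.cong (_* value a (deriv f))
      (≡.trans (value-⊗ a X b) (≡.cong₂ _*_ (value-X a) (value-b a))))))
    (≡.trans (value-cong a {X ⊗ b ⊗ deriv f} {C (+ n) ⊗ b ⊗ f ⊕ ⊖ (C A ⊗ b ℤP.^ m ⊗ L)} deriv-f)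
    (≡.trans (value-⊕ a (C (+ n) ⊗ b ⊗ f) (⊖ (C A ⊗ b ℤP.^ m ⊗ L))) (≡.cong₂ _+_
      (≡.trans (value-⊗ a (C (+ n) ⊗ b) f)
              (≡.cong (_* value a f) (≡.trans (value-⊗ a (C (+ n)) b) (≡.cong₂ _*_ (value-C a (+ n)) (value-b a)))))
      (≡.trans (value-⊖ a (C A ⊗ b ℤP.^ m ⊗ L)) (≡.cong -_ (≡.trans (value-⊗ a (C A ⊗ b ℤP.^ m) L) (≡.cong₂ _*_
        (≡.trans (value-⊗ a (C A) (b ℤP.^ m))
                (≡.cong₂ _*_ (value-C a A) (≡.trans (value-^ a b m) (≡.cong (_^ m) (value-b a)))))
        (≡.trans (value-⊕ a (C (+ N) ⊗ C B ⊗ X) (C (+ n))) (≡.cong₂ _+_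
          (≡.trans (value-⊗ a (C (+ N) ⊗ C B) X) (≡.cong₂ _*_
            (≡.trans (value-⊗ a (C (+ N)) (C B)) (≡.cong₂ _*_ (value-C a (+ N)) (value-C a B))) (value-X a)))
          (value-C a (+ n)))))))))))

  module _ (p∣n⇒p∤mB : + p ∣ + n → ¬ + p ∣ + m * B) (p²∣D : P² ∣ discriminant) where

    private
      p²∣D′ : P² ∣ A-coefficient * A + (+ n) ^ n
      p²∣D′ = ∣-resp (≡.trans discriminant≡ (ℤ.+-comm ((+ n) ^ n) (A-coefficient * A))) p²∣D

    -- As n ≥ 2, p² divides nⁿ and hence the A-term of D. The coefficient of A there is built from
    -- B, n - m and m, all prime to p because p divides n but not m B; so p² ∣ A.
    p∣n⇒¬monogenic : + p ∣ + n → ¬ Monogenic f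
    p∣n⇒¬monogenic p∣n = p²∣A⇒¬monogenic
            (cancel-mod-p² pr A-coefficient A p∤A-coefficient (∣-+-cancelʳ {x = A-coefficient * A} p²∣D′ p²∣n^n))
      where
      p∤A-coefficient : ¬ + p ∣ A-coefficient
      p∤A-coefficient d = [ p∣n⇒p∤v pr p∣n⇒p∤mB p∣n , (λ p∣m → p∣n⇒p∤mB p∣n (∣-*ʳ {x = + m} B p∣m)) ]′
              (p∣A-coefficient⇒ pr d)
      p²∣n^n : P² ∣ (+ n) ^ n
      p²∣n^n = ∣-*-square {x = + n} {(+ n) ^ (m₀ ℕ.+ N)} p∣n
        (≡.subst (λ k → + p ∣ (+ n) ^ k) (≡.sym (ℕ.+-suc m₀ N₀)) (∣-*ʳ {x = + n} ((+ n) ^ (m₀ ℕ.+ N₀)) p∣n))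

    -- If p divided v or m, it would divide the A-term of D and so nⁿ. Hence a = -n/v exists modulo
    -- p², and p² ∣ f(a). In a β f′(a) = n β f(a) - A βᵐ (v a + n) the right side is then divisible
    -- by p²; a and β are prime to p, so p² ∣ f′(a).
    p∤n⇒¬monogenic : ¬ + p ∣ + n → ¬ Monogenic f
    p∤n⇒¬monogenic p∤n = double-root⇒¬monogenic a p²∣f
        (cancel-mod-p² pr (a * β) (value a (deriv f)) p∤aβ p²∣aβf′)
      where
      p∤A-coefficient : ¬ + p ∣ A-coefficient
      p∤A-coefficient d = p∤n (p∣^⇒ pr (+ n) n (∣-+-cancelʳ {x = (+ n) ^ n} {A-coefficient * A}
        (∣-resp discriminant≡ (square∣⇒∣ p²∣D)) (∣-*ʳ {x = A-coefficient} A d)))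
      p∤v : ¬ + p ∣ v
      p∤v d = p∤A-coefficient (⇒p∣A-coefficient pr (inj₁ d))
      p∤m : ¬ + p ∣ + m
      p∤m d = p∤A-coefficient (⇒p∣A-coefficient pr (inj₂ d))
      inverse = inverse-mod-p² pr v p∤v
      a = - (proj₁ inverse * + n)
      β = B * a + 1ℤ
      va≈-n : v * a ≈ - + n mod P²
      va≈-n = solve-linear {P²} {proj₁ inverse} {v} (+ n) (proj₂ inverse)
      p²∣va+n : P² ∣ v * a + + n
      p²∣va+n = va≈-n .factor , ≡.sym (≡.trans (≡.cong (_+ + n) (va≈-n .equation))
        (ℤS.solve 2 (λ n k → ℤS.:- n ℤS.:+ k ℤS.:+ n ℤS.:= k) ≡.refl (+ n) (va≈-n .factor * P²)))
        where open _≈_mod_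
      p²∣f : P² ∣ value a f
      p²∣f = cancel-mod-p² pr (v ^ n) (value a f) (λ d → p∤v (p∣^⇒ pr v n d))
        (∣-mod (CommutativeRing.sym (residueRing P²) (value-f-critical P² a va≈-n)) (∣-*ˡ ((- 1ℤ) ^ n) p²∣D))
      p²∣aβf′ : P² ∣ a * β * value a (deriv f)
      p²∣aβf′ = ∣-resp (≡.sym (value-deriv-f a))
        (∣-+ {x = + n * β * value a f} { - (A * β ^ m * (v * a + + n))} (∣-*ˡ (+ n * β) p²∣f)
                (∣-neg (∣-*ˡ (A * β ^ m) p²∣va+n)))
      p∤a : ¬ + p ∣ a
      p∤a d = p∤n (∣-+-cancelʳ {x = + n} {v * a} (∣-resp (ℤ.+-comm (v * a) (+ n)) (square∣⇒∣ p²∣va+n)) (∣-*ˡ v d))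
      -- Modulo p this reads v β = -m B, so p ∣ β would force p ∣ m B.
      mB≡ : B * (v * a + + n) + - (v * β) ≡ + m * B
      mB≡ = ≡.trans (≡.cong (λ t → B * (v * a + t) + - (v * β)) (ℤ.pos-+ m N))
        (ℤS.solve 4 (λ B N a m → B ℤS.:* (N ℤS.:* B ℤS.:* a ℤS.:+ (m ℤS.:+ N)) ℤS.:- N ℤS.:* B ℤS.:*
                (B ℤS.:* a ℤS.:+ ℤS.:1) ℤS.:= m ℤS.:* B)
          ≡.refl B (+ N) a (+ m))
      p∤β : ¬ + p ∣ β
      p∤β d = [ p∤m , (λ p∣B → p∤v (∣-*ˡ (+ N) p∣B)) ]′ (p∣*⇒ pr (+ m) B (∣-resp mB≡
        (∣-+ {x = B * (v * a + + n)} { - (v * β)} (∣-*ˡ B (square∣⇒∣ p²∣va+n)) (∣-neg (∣-*ˡ v d)))))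
      p∤aβ : ¬ + p ∣ a * β
      p∤aβ d = [ p∤a , p∤β ]′ (p∣*⇒ pr a β d)

    p²∣D⇒¬monogenic : ¬ Monogenic f
    p²∣D⇒¬monogenic = [ p∣n⇒¬monogenic , p∤n⇒¬monogenic ]′ (p∣? pr (+ n))

-- The equivalence for n = m + N

module _ (m₀ N₀ : ℕ) (A B : ℤ) (coprime : gcd (+ (suc m₀ ℕ.+ suc N₀)) (+ suc m₀ ℤ.* B) ≡ 1ℤ) where

  open Trinomial m₀ N₀ A B
  open TrinomialValues m₀ N₀ A B using (discriminant)
  open IntegerDivisibility
  private module ℤ∣ = Congruence ℤ.+-*-commutativeRing

  p∣n⇒p∤mB : ∀ {p} → Prime p → + p ℤ∣.∣ + n → ¬ + p ℤ∣.∣ + m ℤ.* B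
  p∣n⇒p∤mB {p} pr p∣n p∣mB = p∤1 pr (∣ᵤ⇒∣ (≡.subst (+ p Unsigned.∣_) coprime
    (gcd-greatest {+ n} {+ m ℤ.* B} {+ p} (∣⇒∣ᵤ p∣n) (∣⇒∣ᵤ p∣mB))))

  ^2≡ : ∀ p → (+ p) ℤ.^ 2 ≡ + p ℤ.* + p
  ^2≡ p = ≡.cong (+ p ℤ.*_) (ℤ.*-identityʳ (+ p))

  square∣ᵤ⇒∣ : ∀ p a → (+ p) ℤ.^ 2 Unsigned.∣ a → + p ℤ.* + p ℤ∣.∣ a
  square∣ᵤ⇒∣ p a d = ≡.subst (ℤ∣._∣ a) (^2≡ p) (∣ᵤ⇒∣ d)

  squareFree⇒ : ∀ a {p} → SquareFree a → Prime p → ¬ + p ℤ.* + p ℤ∣.∣ a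
  squareFree⇒ a {p} sf pr d = sf p pr (∣⇒∣ᵤ (≡.subst (ℤ∣._∣ a) (≡.sym (^2≡ p)) d))

  monogenic⇔squareFree : Monogenic f ⇔ (SquareFree A × SquareFree discriminant)
  monogenic⇔squareFree = mk⇔
    (λ mono → (λ p pr d → Converse.p²∣A⇒¬monogenic m₀ N₀ A B pr (square∣ᵤ⇒∣ p A d) mono)
            , (λ p pr d → Converse.p²∣D⇒¬monogenic m₀ N₀ A B pr (p∣n⇒p∤mB pr) (square∣ᵤ⇒∣ p discriminant d) mono))
    (λ (sfA , sfD) → Monogenicity.monogenic f f-monic λ p pr → LocalStep.local-step f f-monic pr
      (singular m₀ N₀ A B pr (p∣n⇒p∤mB pr) (squareFree⇒ A sfA pr) (squareFree⇒ discriminant sfD pr)))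

open import Data.Integer.Base using (_*_)

theorem4p1 : (A B : ℤ) → B ≢ 0ℤ →
    (n m : ℕ) → 1 ≤ m → m < n → 2 < n →
    gcd (+ n) (+ m * B) ≡ 1ℤ →
    IrreducibleOverℚ (fPoly n m A B) →
    Monogenic (fPoly n m A B) ⇔ (SquareFree A × SquareFree (D n m A B))
theorem4p1 A B _ n (suc m₀) _ m<n _ coprime _ =
  let N₀ , e = ℕ.m≤n⇒∃[o]m+o≡n m<n
  in from-sum N₀ (≡.trans (≡.sym e) (≡.sym (ℕ.+-suc (suc m₀) N₀))) coprime
  where
  from-sum : ∀ {n} N₀ → n ≡ suc m₀ ℕ.+ suc N₀ → gcd (+ n) (+ suc m₀ * B) ≡ 1ℤ →
             Monogenic (fPoly n (suc m₀) A B) ⇔ (SquareFree A × SquareFree (D n (suc m₀) A B))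
  from-sum N₀ ≡.refl = monogenic⇔squareFree m₀ N₀ A B
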